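{- Let $a,b,c$ be positive integers. Then $f_a\equiv f_bf_c\pmod 2$ if and only if, up to interchanging $b$ and $c$, the triple $(a,b,c)$ is of the form $(2q,4q,4q)$ or $(4q,8q,8q)$ for some positive odd integer $q$, or belongs to the finite set $$\{(4,6,12),(6,8,24),(8,12,24),(10,12,60),(15,24,40),(16,24,48),(20,24,120),(21,24,168)\}.$$
   Context: For a positive integer $m$, define the formal power series $f_m(q):=\sum_{n\ge 0,\ mn+1 \text{ is a perfect square}} q^n\in\mathbb{Z}[[q]]$. For power series $F,G$ with integer coefficients, $F\equiv G\pmod 2$ means that corresponding coefficients of $F$ and $G$ are congruent modulo $2$. -}

module Defs where

open import Data.Nat using (ℕ; zero; suc; _+_; _*_; _∸_; _%_; _≤_; _<_; z≤n; s≤s)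
open import Data.Nat.Properties using (_≟_; ≤-refl; m≤n⇒m≤1+n; m≤n⇒m<n∨m≡n; m≤m*n)
open import Data.List using (List; map; upTo)
open import Data.Nat.ListAction using (sum)
open import Data.Product using (∃-syntax; _×_; _,_)
open import Data.Sum using (inj₁; inj₂)
open import Data.Empty using (⊥)
open import Relation.Binary.PropositionalEquality using (_≡_; refl; subst)
open import Relation.Nullary using (Dec; yes; no; ¬_)

IsSquare : ℕ → Set
IsSquare N = ∃[ k ] (k * k ≡ N)

boundedSquare? : (N B : ℕ) → Dec (∃[ k ] (k ≤ B × k * k ≡ N))
boundedSquare? N zero with 0 * 0 ≟ N
... | yes e = yes (0 , z≤n , e)
... | no ne = no λ { (zero , _ , e) → ne e }
boundedSquare? N (suc B) with suc B * suc B ≟ N | boundedSquare? N B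
... | yes e | _ = yes (suc B , ≤-refl , e)
... | no _  | yes (k , k≤B , e) = yes (k , m≤n⇒m≤1+n k≤B , e)
... | no ne | no nr = no helper
  where
    helper : ¬ (∃[ k ] (k ≤ suc B × k * k ≡ N))
    helper (k , k≤ , e) with m≤n⇒m<n∨m≡n k≤
    ... | inj₁ (s≤s k≤B) = nr (k , k≤B , e)
    ... | inj₂ refl = ne e

private
  root≤ : ∀ k → k ≤ k * k
  root≤ zero = z≤n
  root≤ (suc k) = m≤m*n (suc k) (suc k)

isSquare? : (N : ℕ) → Dec (IsSquare N)
isSquare? N with boundedSquare? N N
... | yes (k , _ , e) = yes (k , e)
... | no nr = no λ { (k , e) → nr (k , subst (k ≤_) e (root≤ k) , e) }

⌊_⌋₀₁ : {P : Set} → Dec P → ℕ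
⌊ yes _ ⌋₀₁ = 1
⌊ no _ ⌋₀₁ = 0

-- Formal power series with ℕ coefficients, represented by coefficient sequences.
Series : Set
Series = ℕ → ℕ

f : ℕ → Series
f m n = ⌊ isSquare? (m * n + 1) ⌋₀₁

_⊛_ : Series → Series → Series
(F ⊛ G) n = sum (map (λ i → F i * G (n ∸ i)) (upTo (suc n)))

_≡₂_ : Series → Series → Set
F ≡₂ G = ∀ n → F n % 2 ≡ G n % 2

Odd : ℕ → Set
Odd q = q % 2 ≡ 1

data Exceptional : ℕ → ℕ → ℕ → Set where
  e1 : Exceptional 4 6 12
  e2 : Exceptional 6 8 24
  e3 : Exceptional 8 12 24
  e4 : Exceptional 10 12 60
  e5 : Exceptional 15 24 40
  e6 : Exceptional 16 24 48
  e7 : Exceptional 20 24 120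
  e8 : Exceptional 21 24 168

data Form (a b c : ℕ) : Set where
  form2q : ∀ q → 0 < q → Odd q → a ≡ 2 * q → b ≡ 4 * q → c ≡ 4 * q → Form a b c
  form4q : ∀ q → 0 < q → Odd q → a ≡ 4 * q → b ≡ 8 * q → c ≡ 8 * q → Form a b c
  formExc : Exceptional a b c → Form a b c

{-# OPTIONS --safe #-}
-- The coefficient of qⁿ in f_b f_c is the number of positive solutions of
-- c x² + b y² = b c n + b + c with x² ≡ 1 (mod b) and y² ≡ 1 (mod c).
--
-- Necessity.  Put D = bc - a(b + c).  If D ≠ 0, then 4bcD² - 1 has a prime factor p ≡ 3 (mod 4),
-- and p ∣ c x² + b y² forces p ∣ x and p ∣ y, hence p² ∣ c x² + b y².  Applied to a square
-- a n + 1 whose coefficient is odd and to its neighbour with n replaced by n + 2kp + ap², this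
-- gives a contradiction, so bc = a(b + c).  The hypothesis now says that for all M the number of
-- integral solutions of c x² + b y² = (b + c) M with x² ≡ s (mod b), y² ≡ s (mod c) is, modulo 8,
-- 4 or 0 according to whether M is a square congruent to s modulo a, for s = 1.  This passes from
-- s = l² s′ to s′ for all large primes l: the solutions for l² M that are not divisible by l come
-- in two conjugate classes modulo l, and composition with a small solution of
-- c x₀² + b y₀² = g l (Thue) identifies a class with one of finitely many sets not depending on l.
-- The cardinality of such a set is divisible by 4 when l does not divide the norm, hence always,
-- as the least exception would be smaller than l.  So s may be the square of any unit modulo bc.
-- Writing (a , b , c) = (h u v , h u w , h v w) with w = u + v, the values M = 1, 4, 9 yield
-- w ∣ 24 and leave finitely many triples besides the two families.
--
-- Sufficiency.  From F(q)² ≡ F(q²) one gets f_{2q} ≡ f_{4q}² and f_{4q} ≡ f_{8q}² for odd q, which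
-- settle the two families and reduce the exceptional triples to four of them.  For these, the
-- solutions correspond to those of X² + d Y² = M, where Y ↦ -Y leaves only Y = 0, with a descent
-- when M is divisible by the primes ramified in the correspondence.

module Submission where

open import Defs
open import Data.Nat as ℕ using (ℕ; zero; suc; _%_; _∸_; z≤n; s≤s)
import Data.Nat.Properties as ℕP
import Data.Nat.Divisibility as ℕD
open import Data.Nat.Coprimality using (Coprime; coprime-Bézout; coprime-divisor; gcd≡1⇒coprime; coprime⇒gcd≡1)
open import Data.Nat.DivMod
  using ([m+kn]%n≡m%n; %-distribˡ-+; %-distribˡ-*; m*n%n≡0)
open import Data.Nat.GCD using (module Bézout; gcd; gcd[m,n]∣m; gcd[m,n]∣n; gcd-greatest)
open import Data.Nat.Induction using (<-rec)
open import Data.Nat.ListAction using (sum; product)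
open import Data.Nat.ListAction.Properties using (∈⇒∣product)
open import Data.Nat.Primality
  using (Prime; prime?; prime[2]; ¬prime[1]; euclidsLemma; prime⇒irreducible; prime⇒nonZero; prime⇒nonTrivial)
open import Data.Nat.Primality.Factorisation using (factorise; module PrimeFactorisation; factorisationHasAllPrimeFactors)
open import Data.Nat.Tactic.RingSolver using () renaming (solve-∀ to solveᴺ-∀)
open import Data.Integer as ℤ
  using (ℤ; +_; -[1+_]; _+_; _*_; -_; _-_; 0ℤ; 1ℤ; _<_; _<?_; +<+; _≟_)
  renaming (∣_∣ to abs)
import Data.Integer.Properties as ℤP
open import Data.Integer.Divisibility.Signed
  using (_∣_; divides; _∣?_; ∣⇒∣ᵤ; ∣ᵤ⇒∣; ∣m∣n⇒∣m+n; ∣m∣n⇒∣m-n; ∣n⇒∣m*n; ∣m⇒∣m*n; ∣-refl; ∣-trans; *-cancelˡ-∣)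
open import Data.Integer.DivMod using (_%ℕ_; _/ℕ_; a≡a%ℕn+[a/ℕn]*n; n%ℕd<d)
open import Data.Integer.Tactic.RingSolver using (solve-∀; solve)
open import Data.Fin using (Fin; toℕ; fromℕ<; remQuot; combine)
open import Data.Fin.Properties using (all?; toℕ-fromℕ<; toℕ-injective; toℕ<n; pigeonhole; <⇒≢; combine-remQuot)
open import Data.List using (List; []; _∷_; _++_; length; map; upTo; filter; cartesianProduct)
open import Data.List.Properties using (length-++)
open import Data.List.Membership.Propositional using (_∈_)
open import Data.List.Membership.Propositional.Properties
open import Data.List.Relation.Unary.Any using (here; there)
open import Data.List.Relation.Unary.All as All using (All)
import Data.List.Relation.Unary.AllPairs as AllPairs
open import Data.List.Relation.Unary.Unique.Propositional using (Unique)
open import Data.List.Relation.Unary.Unique.Propositional.Properties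
  using (Unique[x∷xs]⇒x∉xs; map⁺; ++⁺; upTo⁺; cartesianProduct⁺; filter⁺)
open import Data.Product using (∃; ∃₂; _×_; _,_; proj₁; proj₂)
open import Data.Sum using (_⊎_; inj₁; inj₂; [_,_]′)
open import Data.Empty using (⊥; ⊥-elim)
open import Function using (_∘_; id)
open import Relation.Nullary using (¬_; Dec; yes; no; ¬?; _×-dec_; _⊎-dec_; _→-dec_)
open import Relation.Nullary.Decidable using (True; toWitness; toWitnessFalse; decidable-stable)
open import Relation.Unary using (Decidable)
open import Relation.Binary.PropositionalEquality
  using (_≡_; _≢_; refl; sym; trans; cong; cong₂; subst; subst₂)

-- The obstacle to necessity is that the hypothesis speaks only of the class s = 1, where the small
-- squares M = 4 and M = 9 usually give no information. To move s to the square of an arbitrary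
-- unit, no primes in arithmetic progressions are needed: a residue is shifted until it avoids all
-- small primes, and its factors, all large, are used one at a time. How large they must be depends
-- on whether infinitely many counts are all divisible by 4. This is never decided, so the bound
-- exists only up to double negation, which disappears again because the divisibility by 8 finally
-- extracted is decidable. The number 4bcD² - 1 is 3 modulo 4, makes bc the inverse of the square
-- (2D)² modulo p, and keeps p away from 2, b, c and D. The shape with w = 4 resists the values 4
-- and 9, since there a = 3h is even, hence prime to neither 2 nor 3. It is carried to w = 3 by
-- cancelling a power series, the same cancellation that yields the identity for (8, 12, 24).

record Enum {A : Set} (P : A → Set) : Set where
  constructor enum
  field
    list     : List A
    unique   : Unique list
    sound    : ∀ {a} → a ∈ list → P a
    complete : ∀ {a} → P a → a ∈ list

open Enum public

card : ∀ {A} {P : A → Set} → Enum P → ℕ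
card e = length (list e)

-- Comparing the sizes of enumerated sets.

module _ {A B : Set} (R : A → B → Set) where

  -- Since `R` is injective, the partner of the first element of `xs` is not a partner of any later
  -- one; it can be deleted from `ys` before the induction continues.
  length-≤ : ∀ xs ys → Unique xs → (∀ {a} → a ∈ xs → ∃ λ b → b ∈ ys × R a b) →
    (∀ {a a′ b} → R a b → R a′ b → a ≡ a′) → length xs ℕ.≤ length ys
  length-≤ []       ys _ _ _ = z≤n
  length-≤ (x ∷ xs) ys u@(_ AllPairs.∷ u′) f inj with f (here refl)
  ... | b , b∈ , xRb with ∈-∃++ b∈
  ... | ys₁ , ys₂ , refl = subst (suc (length xs) ℕ.≤_) (sym eq) (s≤s ih)
    where
    eq : length (ys₁ ++ b ∷ ys₂) ≡ suc (length (ys₁ ++ ys₂))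
    eq = trans (length-++ ys₁) (trans (ℕP.+-suc _ _) (cong suc (sym (length-++ ys₁))))
    rest : ∀ {a} → a ∈ xs → ∃ λ b′ → b′ ∈ ys₁ ++ ys₂ × R a b′
    rest a∈ with f (there a∈)
    ... | b′ , b′∈ , aRb′ with ∈-++⁻ ys₁ b′∈
    ... | inj₁ i = b′ , ∈-++⁺ˡ i , aRb′
    ... | inj₂ (there i) = b′ , ∈-++⁺ʳ ys₁ i , aRb′
    ... | inj₂ (here refl) with inj xRb aRb′
    ... | refl = ⊥-elim (Unique[x∷xs]⇒x∉xs u a∈)
    ih : length xs ℕ.≤ length (ys₁ ++ ys₂)
    ih = length-≤ xs (ys₁ ++ ys₂) u′ rest inj

module _ {A B : Set} {P : A → Set} {Q : B → Set} (R : A → B → Set) where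

  -- The bijection is given by its graph, because most maps below involve exact divisions whose
  -- quotients exist only as witnesses of divisibility.
  card-≡ : (eP : Enum P) (eQ : Enum Q) →
    (∀ {a} → P a → ∃ λ b → Q b × R a b) → (∀ {b} → Q b → ∃ λ a → P a × R a b) →
    (∀ {a a′ b} → R a b → R a′ b → a ≡ a′) → (∀ {a b b′} → R a b → R a b′ → b ≡ b′) →
    card eP ≡ card eQ
  card-≡ eP eQ to from inj fun = ℕP.≤-antisym
    (length-≤ R _ _ (unique eP)
      (λ i → let b , q , r = to (sound eP i) in b , complete eQ q , r) inj)
    (length-≤ (λ b a → R a b) _ _ (unique eQ)
      (λ i → let a , p , r = from (sound eQ i) in a , complete eP p , r) fun)

card-⇔ : ∀ {A} {P Q : A → Set} (eP : Enum P) (eQ : Enum Q) →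
  (∀ {a} → P a → Q a) → (∀ {a} → Q a → P a) → card eP ≡ card eQ
card-⇔ eP eQ to from = card-≡ _≡_ eP eQ (λ p → _ , to p , refl) (λ q → _ , from q , refl)
  (λ { refl refl → refl }) (λ { refl refl → refl })

module _ {A : Set} {P Q : A → Set} (Q? : Decidable Q) where

  restrict : Enum P → Enum (λ a → P a × Q a)
  restrict e = enum (filter Q? (list e)) (filter⁺ Q? (unique e))
    (λ i → let j , q = ∈-filter⁻ Q? i in sound e j , q)
    (λ { (p , q) → ∈-filter⁺ Q? (complete e p) q })

private
  filter-split : ∀ {A : Set} {Q : A → Set} (Q? : Decidable Q) xs →
    length xs ≡ length (filter Q? xs) ℕ.+ length (filter (λ a → ¬? (Q? a)) xs)
  filter-split Q? [] = refl
  filter-split Q? (x ∷ xs) with Q? x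
  ... | yes _ = cong suc (filter-split Q? xs)
  ... | no _  = trans (cong suc (filter-split Q? xs)) (sym (ℕP.+-suc _ _))

card-split : ∀ {A} {P Q : A → Set} (Q? : Decidable Q) (e : Enum P) →
  card e ≡ card (restrict Q? e) ℕ.+ card (restrict (λ a → ¬? (Q? a)) e)
card-split Q? e = filter-split Q? (list e)

-- The involution exchanges `Q` with its complement inside `P`, so the two halves are equally large.
-- Every factor 2 that comes from a sign change or a conjugation is obtained in this way.
card-double : ∀ {A} {P Q : A → Set} (Q? : Decidable Q) (e : Enum P) (σ : A → A) →
  (∀ a → σ (σ a) ≡ a) → (∀ {a} → P a → P (σ a)) →
  (∀ {a} → P a → Q a → ¬ Q (σ a)) → (∀ {a} → P a → ¬ Q a → Q (σ a)) →
  card e ≡ 2 ℕ.* card (restrict Q? e)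
card-double Q? e σ inv pres out inn = trans (card-split Q? e)
  (cong (card (restrict Q? e) ℕ.+_) (trans (sym halves) (sym (ℕP.+-identityʳ _))))
  where
  halves : card (restrict Q? e) ≡ card (restrict (λ a → ¬? (Q? a)) e)
  halves = card-≡ (λ a b → σ a ≡ b) (restrict Q? e) (restrict (λ a → ¬? (Q? a)) e)
    (λ { (p , q) → _ , (pres p , out p q) , refl })
    (λ { (p , q) → _ , (pres p , inn p q) , inv _ })
    (λ { {a} {a′} r s → trans (sym (inv a)) (trans (cong σ (trans r (sym s))) (inv a′)) })
    (λ { refl refl → refl })

card-zero : ∀ {A} {P : A → Set} (e : Enum P) → (∀ {a} → ¬ P a) → card e ≡ 0
card-zero (enum [] _ _ _) _ = refl
card-zero (enum (x ∷ _) _ s _) h = ⊥-elim (h (s (here refl)))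

card-inhabited : ∀ {A} {P : A → Set} (e : Enum P) → ¬ card e ≡ 0 → ∃ P
card-inhabited (enum [] _ _ _) h = ⊥-elim (h refl)
card-inhabited (enum (x ∷ _) _ s _) _ = x , s (here refl)

card-one : ∀ {A} {P : A → Set} (e : Enum P) (a : A) → P a → (∀ {b} → P b → b ≡ a) → card e ≡ 1
card-one e a pa only = card-⇔ e
  (enum {P = λ b → b ≡ a} (a ∷ []) (All.[] AllPairs.∷ AllPairs.[]) (λ { (here r) → r }) (λ { refl → here refl }))
  only (λ { refl → pa })

-- Ring identities, divisibility and coprimality in the integers.

-- Equations are transferred by exhibiting the difference of two sides as a
-- linear combination; the side condition is a ring identity.

lin : ∀ {A B C D : ℤ} k → A ≡ B → C - D ≡ k * (A - B) → C ≡ D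
lin {A} {.A} {C} {D} k refl h = ℤP.i-j≡0⇒i≡j C D
  (trans h (trans (cong (k *_) (ℤP.+-inverseʳ A)) (ℤP.*-zeroʳ k)))

lin₂ : ∀ {A B A′ B′ C D : ℤ} k k′ → A ≡ B → A′ ≡ B′ →
  C - D ≡ k * (A - B) + k′ * (A′ - B′) → C ≡ D
lin₂ {A} {.A} {A′} {.A′} {C} {D} k k′ refl refl h = ℤP.i-j≡0⇒i≡j C D
  (trans h (cong₂ _+_ (trans (cong (k *_) (ℤP.+-inverseʳ A)) (ℤP.*-zeroʳ k))
                      (trans (cong (k′ *_) (ℤP.+-inverseʳ A′)) (ℤP.*-zeroʳ k′))))

cancelˡ : ∀ k {x y} → k ≢ 0ℤ → k * x ≡ k * y → x ≡ y
cancelˡ k {x} {y} k≢0 = ℤP.*-cancelˡ-≡ k x y {{ℤ.≢-nonZero k≢0}}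

x≡y⇒x-y≡0 : ∀ {x y} → x ≡ y → x - y ≡ 0ℤ
x≡y⇒x-y≡0 {x} refl = ℤP.+-inverseʳ x

integral : ∀ x {y} → x * y ≡ 0ℤ → x ≡ 0ℤ ⊎ y ≡ 0ℤ
integral x = ℤP.i*j≡0⇒i≡0∨j≡0 x

sq-eq : ∀ x y → x * x ≡ y * y → x ≡ y ⊎ x ≡ - y
sq-eq x y e with integral (x - y) {x + y} (lin {D = 0ℤ} 1ℤ e (solve (x ∷ y ∷ [])))
... | inj₁ h = inj₁ (ℤP.i-j≡0⇒i≡j x y h)
... | inj₂ h = inj₂ (lin {A = x + y} {B = 0ℤ} (+ 1) h (solve (x ∷ y ∷ [])))

∣-by : ∀ {d x y} → d ∣ x → x ≡ y → d ∣ y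
∣-by h refl = h

∣1⇒ : ∀ {d} → d ∣ 1ℤ → abs d ≡ 1
∣1⇒ h = ℕD.∣1⇒≡1 (∣⇒∣ᵤ h)

-- Coprimality as a Bézout identity

Cop : ℤ → ℤ → Set
Cop m n = ∃₂ λ u v → u * m + v * n ≡ 1ℤ

Cop-sym : ∀ {m n} → Cop m n → Cop n m
Cop-sym {m} {n} (u , v , e) = v , u , trans (ℤP.+-comm (v * n) (u * m)) e

Cop-* : ∀ {m n n′} → Cop m n → Cop m n′ → Cop m (n * n′)
Cop-* {m} {n} {n′} (u , v , e) (u′ , v′ , e′) =
  u * u′ * m + u * v′ * n′ + v * n * u′ , v * v′ ,
  lin₂ {A = u * m + v * n} {B = 1ℤ} {A′ = u′ * m + v′ * n′} {B′ = 1ℤ}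
    (u′ * m + v′ * n′) 1ℤ e e′
    (solve (u ∷ v ∷ u′ ∷ v′ ∷ m ∷ n ∷ n′ ∷ []))

Cop-euclid : ∀ {m n} z → Cop m n → m ∣ n * z → m ∣ z
Cop-euclid {m} {n} z (u , v , e) (divides q nz) = divides (u * z + v * q)
  (lin₂ {A = u * m + v * n} {B = 1ℤ} {A′ = n * z} {B′ = q * m} (- z) v e nz
    (solve (u ∷ v ∷ m ∷ n ∷ z ∷ q ∷ [])))

Cop-∣ : ∀ {m n k} → Cop m n → k ∣ m → Cop k n
Cop-∣ {n = n} {k} (u , v , e) (divides q refl) =
  u * q , v , trans (cong (_+ v * n) (ℤP.*-assoc u q k)) e

Cop-∣ʳ : ∀ {m n k} → Cop m n → k ∣ n → Cop m k
Cop-∣ʳ c d = Cop-sym (Cop-∣ (Cop-sym c) d)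

Cop-shift : ∀ {m n} k → Cop m n → Cop m (n + k * m)
Cop-shift {m} {n} k (u , v , e) = u - v * k , v ,
  lin {A = u * m + v * n} {B = 1ℤ} 1ℤ e (solve (u ∷ v ∷ m ∷ n ∷ k ∷ []))

Cop-∣∣ : ∀ {m n z} → Cop m n → m ∣ z → n ∣ z → m * n ∣ z
Cop-∣∣ {m} {n} {z} (u , v , e) (divides p zp) (divides q zq) = divides (u * q + v * p)
  (lin₂ {A = u * m + v * n} {B = 1ℤ} {A′ = 0ℤ} {B′ = 0ℤ} (- z) 0ℤ e refl
    (trans (cong (λ t → t - (u * q + v * p) * (m * n)) zq′)
      (trans (cong₂ (λ a b → (u * m * a + v * n * b + (z - (u * m + v * n) * z))
         - (u * q + v * p) * (m * n)) zq zp)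
       (solve (u ∷ v ∷ m ∷ n ∷ z ∷ p ∷ q ∷ [])))))
  where
  zq′ : z ≡ u * m * z + v * n * z + (z - (u * m + v * n) * z)
  zq′ = solve (u ∷ v ∷ m ∷ n ∷ z ∷ [])

private
  bézout : ∀ x m y n → + 1 + y * n ≡ x * m → x * m + - y * n ≡ 1ℤ
  bézout x m y n e = lin {A = + 1 + y * n} {B = x * m} (- 1ℤ) e (solve (x ∷ m ∷ y ∷ n ∷ []))

  bézoutᴺ : ∀ x m y n → 1 ℕ.+ y ℕ.* n ≡ x ℕ.* m → + x * + m + - (+ y) * + n ≡ 1ℤ
  bézoutᴺ x m y n e = bézout (+ x) (+ m) (+ y) (+ n)
    (trans (cong (λ t → + 1 + t) (sym (ℤP.pos-* y n))) (trans (cong +_ e) (ℤP.pos-* x m)))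

Cop-coprime : ∀ {m n} → Coprime m n → Cop (+ m) (+ n)
Cop-coprime {m} {n} c with coprime-Bézout c
... | Bézout.+- x y e = + x , - (+ y) , bézoutᴺ x m y n e
... | Bézout.-+ x y e = Cop-sym (+ y , - (+ x) , bézoutᴺ y n x m e)

prime-Cop : ∀ {p z} → Prime p → ¬ (+ p ∣ z) → Cop (+ p) z
prime-Cop {p} {z} pr p∤z = sgn z (Cop-coprime co)
  where
  co : Coprime p (abs z)
  co (d∣p , d∣z) with prime⇒irreducible pr d∣p
  ... | inj₁ d≡1 = d≡1
  ... | inj₂ refl = ⊥-elim (p∤z (∣ᵤ⇒∣ d∣z))
  sgn : ∀ z → Cop (+ p) (+ abs z) → Cop (+ p) z
  sgn (+ _) c = c
  sgn -[1+ n ] (u , v , e) = u , - v , trans (cong (λ t → u * + p + t) (h v (+ suc n))) e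
    where
    h : ∀ v n → - v * - n ≡ v * n
    h v n = solve (v ∷ n ∷ [])

prime-euclid : ∀ {p} x y → Prime p → + p ∣ x * y → + p ∣ x ⊎ + p ∣ y
prime-euclid {p} x y pr h with + p ∣? x
... | yes d = inj₁ d
... | no n = inj₂ (Cop-euclid y (prime-Cop pr n) h)

prime-sq : ∀ {p} x → Prime p → + p ∣ x * x → + p ∣ x
prime-sq x pr h = [ id , id ]′ (prime-euclid x x pr h)

-- Finite boxes in ℤ × ℤ

ints : ℕ → List ℤ
ints B = map +_ (upTo (suc B)) ++ map -[1+_] (upTo B)

ints-unique : ∀ B → Unique (ints B)
ints-unique B = ++⁺ (map⁺ ℤP.+-injective (upTo⁺ (suc B))) (map⁺ ℤP.-[1+-injective (upTo⁺ B)) disj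
  where
  disj : ∀ {v} → v ∈ map +_ (upTo (suc B)) × v ∈ map -[1+_] (upTo B) → ⊥
  disj (i , j) with ∈-map⁻ +_ i | ∈-map⁻ -[1+_] j
  ... | _ , _ , refl | _ , _ , ()

ints-complete : ∀ B z → abs z ℕ.≤ B → z ∈ ints B
ints-complete B (+ n) h = ∈-++⁺ˡ (∈-map⁺ +_ (∈-upTo⁺ (ℕ.s≤s h)))
ints-complete B -[1+ n ] h = ∈-++⁺ʳ (map +_ (upTo (suc B))) (∈-map⁺ -[1+_] (∈-upTo⁺ h))

enumBox : ∀ {P : ℤ × ℤ → Set} (P? : Decidable P) B →
  (∀ {x y} → P (x , y) → abs x ℕ.≤ B × abs y ℕ.≤ B) → Enum P
enumBox P? B bd = enum (filter P? box) (filter⁺ P? (cartesianProduct⁺ (ints-unique B) (ints-unique B)))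
  (λ i → proj₂ (∈-filter⁻ P? {xs = box} i))
  (λ { {x , y} p → ∈-filter⁺ P? (∈-cartesianProduct⁺ (ints-complete B x (proj₁ (bd p)))
    (ints-complete B y (proj₂ (bd p)))) p })
  where box = cartesianProduct (ints B) (ints B)

-- Deciding congruence formulas in two integer variables by residues

infixl 6 _⊕_ _⊖_
infixl 7 _⊗_
infixr 3 _⇒_
infixr 4 _∨ᶠ_
infixr 5 _∧ᶠ_

data Ex : Set where
  𝕩 𝕪 : Ex
  κ : ℤ → Ex
  _⊕_ _⊖_ _⊗_ : Ex → Ex → Ex

⟦_⟧ : Ex → ℤ → ℤ → ℤ
⟦ 𝕩 ⟧ x y = x
⟦ 𝕪 ⟧ x y = y
⟦ κ k ⟧ x y = k
⟦ e ⊕ e′ ⟧ x y = ⟦ e ⟧ x y + ⟦ e′ ⟧ x y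
⟦ e ⊖ e′ ⟧ x y = ⟦ e ⟧ x y - ⟦ e′ ⟧ x y
⟦ e ⊗ e′ ⟧ x y = ⟦ e ⟧ x y * ⟦ e′ ⟧ x y

data Fm : Set where
  dv ndv : ℕ → Ex → Fm
  _⇒_ _∨ᶠ_ _∧ᶠ_ : Fm → Fm → Fm
  ⊥ᶠ : Fm

Sem : Fm → ℤ → ℤ → Set
Sem (dv d e) x y = + d ∣ ⟦ e ⟧ x y
Sem (ndv d e) x y = ¬ (+ d ∣ ⟦ e ⟧ x y)
Sem (φ ⇒ ψ) x y = Sem φ x y → Sem ψ x y
Sem (φ ∨ᶠ ψ) x y = Sem φ x y ⊎ Sem ψ x y
Sem (φ ∧ᶠ ψ) x y = Sem φ x y × Sem ψ x y
Sem ⊥ᶠ x y = ⊥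

sem? : ∀ φ x y → Dec (Sem φ x y)
sem? (dv d e) x y = + d ∣? ⟦ e ⟧ x y
sem? (ndv d e) x y = ¬? (+ d ∣? ⟦ e ⟧ x y)
sem? (φ ⇒ ψ) x y = sem? φ x y →-dec sem? ψ x y
sem? (φ ∨ᶠ ψ) x y = sem? φ x y ⊎-dec sem? ψ x y
sem? (φ ∧ᶠ ψ) x y = sem? φ x y ×-dec sem? ψ x y
sem? ⊥ᶠ x y = no (λ ())

-- An atom whose modulus divides `m` depends on its variables only modulo `m`; this is what makes a
-- check on residues sufficient.
Level : ℕ → Fm → Set
Level m (dv d e) = d ℕD.∣ m
Level m (ndv d e) = d ℕD.∣ m
Level m (φ ⇒ ψ) = Level m φ × Level m ψ
Level m (φ ∨ᶠ ψ) = Level m φ × Level m ψ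
Level m (φ ∧ᶠ ψ) = Level m φ × Level m ψ
Level m ⊥ᶠ = 0 ≡ 0

level? : ∀ m φ → Dec (Level m φ)
level? m (dv d e) = d ℕD.∣? m
level? m (ndv d e) = d ℕD.∣? m
level? m (φ ⇒ ψ) = level? m φ ×-dec level? m ψ
level? m (φ ∨ᶠ ψ) = level? m φ ×-dec level? m ψ
level? m (φ ∧ᶠ ψ) = level? m φ ×-dec level? m ψ
level? m ⊥ᶠ = yes refl

module _ (m : ℕ) {x x′ y y′ : ℤ} (hx : + m ∣ x - x′) (hy : + m ∣ y - y′) where

  ⟦⟧-cong : ∀ e → + m ∣ ⟦ e ⟧ x y - ⟦ e ⟧ x′ y′
  ⟦⟧-cong 𝕩 = hx
  ⟦⟧-cong 𝕪 = hy
  ⟦⟧-cong (κ k) = divides 0ℤ (ℤP.+-inverseʳ k)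
  ⟦⟧-cong (e ⊕ e′) = ∣-by (∣m∣n⇒∣m+n (⟦⟧-cong e) (⟦⟧-cong e′)) (h (⟦ e ⟧ x y) _ (⟦ e′ ⟧ x y) _)
    where
    h : ∀ a a′ b b′ → (a - a′) + (b - b′) ≡ (a + b) - (a′ + b′)
    h = solve-∀
  ⟦⟧-cong (e ⊖ e′) = ∣-by (∣m∣n⇒∣m-n (⟦⟧-cong e) (⟦⟧-cong e′)) (h (⟦ e ⟧ x y) _ (⟦ e′ ⟧ x y) _)
    where
    h : ∀ a a′ b b′ → (a - a′) - (b - b′) ≡ (a - b) - (a′ - b′)
    h = solve-∀
  ⟦⟧-cong (e ⊗ e′) = ∣-by
    (∣m∣n⇒∣m+n (∣n⇒∣m*n (⟦ e′ ⟧ x y) (⟦⟧-cong e)) (∣n⇒∣m*n (⟦ e ⟧ x′ y′) (⟦⟧-cong e′)))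
    (h (⟦ e ⟧ x y) (⟦ e ⟧ x′ y′) (⟦ e′ ⟧ x y) (⟦ e′ ⟧ x′ y′))
    where
    h : ∀ a a′ b b′ → b * (a - a′) + a′ * (b - b′) ≡ a * b - a′ * b′
    h = solve-∀

  private
    dvTo : ∀ d e → d ℕD.∣ m → + d ∣ ⟦ e ⟧ x y → + d ∣ ⟦ e ⟧ x′ y′
    dvTo d e dm h = ∣-by (∣m∣n⇒∣m-n h (∣-trans (∣ᵤ⇒∣ dm) (⟦⟧-cong e))) (r (⟦ e ⟧ x y) (⟦ e ⟧ x′ y′))
      where
      r : ∀ a a′ → a - (a - a′) ≡ a′
      r = solve-∀
    dvFrom : ∀ d e → d ℕD.∣ m → + d ∣ ⟦ e ⟧ x′ y′ → + d ∣ ⟦ e ⟧ x y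
    dvFrom d e dm h = ∣-by (∣m∣n⇒∣m+n h (∣-trans (∣ᵤ⇒∣ dm) (⟦⟧-cong e))) (r (⟦ e ⟧ x y) (⟦ e ⟧ x′ y′))
      where
      r : ∀ a a′ → a′ + (a - a′) ≡ a
      r = solve-∀

  semTo : ∀ φ → Level m φ → Sem φ x y → Sem φ x′ y′
  semFrom : ∀ φ → Level m φ → Sem φ x′ y′ → Sem φ x y
  semTo (dv d e) l s = dvTo d e l s
  semTo (ndv d e) l s = s ∘ dvFrom d e l
  semTo (φ ⇒ ψ) (l , l′) s = semTo ψ l′ ∘ s ∘ semFrom φ l
  semTo (φ ∨ᶠ ψ) (l , l′) (inj₁ s) = inj₁ (semTo φ l s)
  semTo (φ ∨ᶠ ψ) (l , l′) (inj₂ s) = inj₂ (semTo ψ l′ s)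
  semTo (φ ∧ᶠ ψ) (l , l′) (s , s′) = semTo φ l s , semTo ψ l′ s′
  semFrom (dv d e) l s = dvFrom d e l s
  semFrom (ndv d e) l s = s ∘ dvTo d e l
  semFrom (φ ⇒ ψ) (l , l′) s = semFrom ψ l′ ∘ s ∘ semTo φ l
  semFrom (φ ∨ᶠ ψ) (l , l′) (inj₁ s) = inj₁ (semFrom φ l s)
  semFrom (φ ∨ᶠ ψ) (l , l′) (inj₂ s) = inj₂ (semFrom ψ l′ s)
  semFrom (φ ∧ᶠ ψ) (l , l′) (s , s′) = semFrom φ l s , semFrom ψ l′ s′

residues? : ∀ m φ → Dec (Level m φ × (∀ (i j : Fin m) → Sem φ (+ toℕ i) (+ toℕ j)))
residues? m φ = level? m φ ×-dec all? (λ i → all? (λ j → sem? φ (+ toℕ i) (+ toℕ j)))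

residue : ∀ m .{{_ : ℕ.NonZero m}} z → ∃ λ (i : Fin m) → + m ∣ z - + toℕ i
residue m z = fromℕ< (n%ℕd<d z m) , divides (z /ℕ m) (trans
  (cong₂ _-_ (a≡a%ℕn+[a/ℕn]*n z m) (cong +_ (toℕ-fromℕ< (n%ℕd<d z m))))
  (h (+ (z %ℕ m)) (z /ℕ m * + m)))
  where
  h : ∀ a b → a + b - a ≡ b
  h = solve-∀

decide : ∀ m .{{_ : ℕ.NonZero m}} φ {_ : True (residues? m φ)} → ∀ x y → Sem φ x y
decide m φ {t} x y with toWitness t | residue m x | residue m y
... | l , s | i , hx | j , hy = semFrom m hx hy φ l (s i j)


-- Solutions of `c x² + b y² = N` with congruence conditions.

nonZero : ∀ n .{{_ : ℕ.NonZero n}} → + n ≢ 0ℤ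
nonZero (suc n) ()

sq-abs : ∀ x → x * x ≡ + (abs x ℕ.* abs x)
sq-abs (+ n) = sym (ℤP.pos-* n n)
sq-abs -[1+ n ] = refl

neg-pos : ∀ {z} → z ≢ 0ℤ → ¬ (0ℤ < z) → 0ℤ < - z
neg-pos {+ zero} h _ = ⊥-elim (h refl)
neg-pos {+ suc n} _ h = ⊥-elim (h (+<+ (s≤s z≤n)))
neg-pos { -[1+ n ]} _ _ = +<+ (s≤s z≤n)

pos-neg : ∀ {z} → 0ℤ < z → ¬ (0ℤ < - z)
pos-neg {+ suc n} _ ()
pos-neg {+ zero} (+<+ ())

neg-sq : ∀ z → - z * - z ≡ z * z
neg-sq = solve-∀

pos-sq-inj : ∀ {x y} → 0ℤ < x → 0ℤ < y → x * x ≡ y * y → x ≡ y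
pos-sq-inj {x} {y} 0<x 0<y e with sq-eq x y e
... | inj₁ h = h
... | inj₂ refl = ⊥-elim (pos-neg 0<y 0<x)

V : (b c : ℕ) (s N : ℤ) → ℤ × ℤ → Set
V b c s N (x , y) = + c * (x * x) + + b * (y * y) ≡ N × + b ∣ x * x - s × + c ∣ y * y - s

V? : ∀ b c s N → Decidable (V b c s N)
V? b c s N (x , y) = (_ ≟ N) ×-dec (_ ∣? _) ×-dec (_ ∣? _)

form-bound : ∀ b c .{{_ : ℕ.NonZero b}} .{{_ : ℕ.NonZero c}} {N} x y →
  + c * (x * x) + + b * (y * y) ≡ N → abs x ℕ.≤ abs N × abs y ℕ.≤ abs N
form-bound b c x y refl = subst (λ t → abs x ℕ.≤ t × abs y ℕ.≤ t) (cong abs (sym eq))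
  ( ℕP.≤-trans (n≤c*n² c (abs x)) (ℕP.m≤m+n _ _)
  , ℕP.≤-trans (n≤c*n² b (abs y)) (ℕP.m≤n+m _ _))
  where
  eq : + c * (x * x) + + b * (y * y) ≡ + (c ℕ.* (abs x ℕ.* abs x) ℕ.+ b ℕ.* (abs y ℕ.* abs y))
  eq = cong₂ _+_ (trans (cong (+ c *_) (sq-abs x)) (sym (ℤP.pos-* c _)))
                 (trans (cong (+ b *_) (sq-abs y)) (sym (ℤP.pos-* b _)))
  n≤c*n² : ∀ c .{{_ : ℕ.NonZero c}} n → n ℕ.≤ c ℕ.* (n ℕ.* n)
  n≤c*n² c zero = z≤n
  n≤c*n² c (suc n) = ℕP.≤-trans (ℕP.m≤m*n (suc n) (suc n)) (ℕP.m≤n*m (suc n ℕ.* suc n) c)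

enumV : ∀ b c .{{_ : ℕ.NonZero b}} .{{_ : ℕ.NonZero c}} s N → Enum (V b c s N)
enumV b c s N = enumBox (V? b c s N) (abs N) (λ {x} {y} v → form-bound b c x y (proj₁ v))

-- Coefficients of the product as numbers of representations

Split : (b c n i : ℕ) → Set
Split b c n i = IsSquare (b ℕ.* i ℕ.+ 1) × IsSquare (c ℕ.* (n ∸ i) ℕ.+ 1)

split? : ∀ b c n → Decidable (Split b c n)
split? b c n i = isSquare? (b ℕ.* i ℕ.+ 1) ×-dec isSquare? (c ℕ.* (n ∸ i) ℕ.+ 1)

enumSplit : ∀ b c n → Enum (λ i → i ℕ.≤ n × Split b c n i)
enumSplit b c n = enum (filter (split? b c n) (upTo (suc n))) (filter⁺ (split? b c n) (upTo⁺ (suc n)))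
  (λ i → let j , q = ∈-filter⁻ (split? b c n) {xs = upTo (suc n)} i in ℕP.≤-pred (∈-upTo⁻ j) , q)
  (λ { (h , q) → ∈-filter⁺ (split? b c n) (∈-upTo⁺ (s≤s h)) q })

card-enumSplit : ∀ b c n → card (enumSplit b c n) ≡ (f b ⊛ f c) n
card-enumSplit b c n = sym (go (upTo (suc n)))
  where
  go : ∀ xs → sum (map (λ i → f b i ℕ.* f c (n ∸ i)) xs) ≡ length (filter (split? b c n) xs)
  go [] = refl
  go (i ∷ xs) with isSquare? (b ℕ.* i ℕ.+ 1) | isSquare? (c ℕ.* (n ∸ i) ℕ.+ 1)
  ... | yes _ | yes _ = cong suc (go xs)
  ... | yes _ | no _ = go xs
  ... | no _ | yes _ = go xs
  ... | no _ | no _ = go xs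

root-pos : ∀ {k m} → k ℕ.* k ≡ m ℕ.+ 1 → 0ℤ < + k
root-pos {zero} {m} e with trans e (ℕP.+-comm m 1)
... | ()
root-pos {suc k} _ = +<+ (s≤s z≤n)

pos-square : ∀ b {z} → 0ℤ < z → + b ∣ z * z - 1ℤ → ∃ λ i → z * z ≡ + (b ℕ.* i ℕ.+ 1)
pos-square b {+ zero} (+<+ ())
pos-square b {+ suc n} _ d with ∣⇒∣ᵤ d
... | ℕD.divides i e = i , cong +_ (trans (cong suc (trans e (ℕP.*-comm i b))) (ℕP.+-comm 1 _))

cast : ∀ b i → + (b ℕ.* i ℕ.+ 1) ≡ + b * + i + 1ℤ
cast b i = cong (_+ 1ℤ) (ℤP.pos-* b i)

Pos : (b c : ℕ) (N : ℤ) → ℤ × ℤ → Set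
Pos b c N xy = (V b c 1ℤ N xy × 0ℤ < proj₁ xy) × 0ℤ < proj₂ xy

-- This is c (b i + 1) + b (c j + 1) with i + j = n.
norm₁ : (b c n : ℕ) → ℤ
norm₁ b c n = + b * + c * + n + (+ b + + c)

module _ (b c n : ℕ) .{{nzb : ℕ.NonZero b}} .{{nzc : ℕ.NonZero c}} where

  private
    Root : ℕ → ℤ × ℤ → Set
    Root i (x , y) = (x * x ≡ + (b ℕ.* i ℕ.+ 1) × 0ℤ < x) × y * y ≡ + (c ℕ.* (n ∸ i) ℕ.+ 1) × 0ℤ < y

    alg : ∀ b c i j x² y² → x² ≡ b * i + 1ℤ → y² ≡ c * j + 1ℤ →
      c * x² + b * y² ≡ b * c * (i + j) + (b + c)
    alg b c i j _ _ refl refl = solve (b ∷ c ∷ i ∷ j ∷ [])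

    sqn : ∀ k {m} → k ℕ.* k ≡ m → + k * + k ≡ + m
    sqn k e = trans (sym (ℤP.pos-* k k)) (cong +_ e)

    dvd : ∀ b i {x²} → x² ≡ + b * + i + 1ℤ → + b ∣ x² - 1ℤ
    dvd b i refl = divides (+ i) (h (+ b) (+ i))
      where
      h : ∀ b i → b * i + 1ℤ - 1ℤ ≡ i * b
      h = solve-∀

    i+j : ∀ {i} → i ℕ.≤ n → + i + + (n ∸ i) ≡ + n
    i+j h = cong +_ (ℕP.m+[n∸m]≡n h)

    to : ∀ {i} → i ℕ.≤ n × Split b c n i → ∃ λ xy → Pos b c (norm₁ b c n) xy × Root i xy
    to {i} (h , (k , ek) , (l , el)) = (+ k , + l) ,
      ((( trans (alg (+ b) (+ c) (+ i) (+ (n ∸ i)) _ _ ex ey)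
            (cong (λ t → + b * + c * t + (+ b + + c)) (i+j h))
        , dvd b i ex , dvd c (n ∸ i) ey) , root-pos ek) , root-pos el) ,
      ((sqn k ek , root-pos ek) , sqn l el , root-pos el)
      where
      ex : + k * + k ≡ + b * + i + 1ℤ
      ex = trans (sqn k ek) (cast b i)
      ey : + l * + l ≡ + c * + (n ∸ i) + 1ℤ
      ey = trans (sqn l el) (cast c (n ∸ i))

    unsq : ∀ x {m} → x * x ≡ + m → IsSquare m
    unsq x e = abs x , ℤP.+-injective (trans (sym (sq-abs x)) e)

    from : ∀ {xy} → Pos b c (norm₁ b c n) xy → ∃ λ i → (i ℕ.≤ n × Split b c n i) × Root i xy
    from {x , y} (((e , d , d′) , px) , py) with pos-square b px d | pos-square c py d′
    ... | i , ex | j , ey = i , (subst (i ℕ.≤_) ij (ℕP.m≤m+n i j) , unsq x ex , unsq y ey′) , (ex , px) , ey′ , py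
      where
      cancel : ∀ b c i+j n → b ≢ 0ℤ → c ≢ 0ℤ → b * c * i+j + (b + c) ≡ b * c * n + (b + c) → i+j ≡ n
      cancel b c z n hb hc h = cancelˡ c hc (cancelˡ b hb
        (lin {A = b * c * z + (b + c)} {b * c * n + (b + c)} 1ℤ h (solve (b ∷ c ∷ z ∷ n ∷ []))))
      ij : i ℕ.+ j ≡ n
      ij = ℤP.+-injective (cancel (+ b) (+ c) (+ i + + j) (+ n)
        (nonZero b) (nonZero c)
        (trans (sym (alg (+ b) (+ c) (+ i) (+ j) _ _ (trans ex (cast b i)) (trans ey (cast c j)))) e))
      ey′ : y * y ≡ + (c ℕ.* (n ∸ i) ℕ.+ 1)
      ey′ = trans ey (cong (λ t → + (c ℕ.* t ℕ.+ 1))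
        (trans (sym (ℕP.m+n∸m≡n i j)) (cong (_∸ i) ij)))

  card-Pos : (e : Enum (Pos b c (norm₁ b c n))) → card e ≡ (f b ⊛ f c) n
  card-Pos e = trans (sym (card-≡ Root (enumSplit b c n) e to from inj fun)) (card-enumSplit b c n)
    where
    inj : ∀ {i i′ xy} → Root i xy → Root i′ xy → i ≡ i′
    inj ((r , _) , _) ((r′ , _) , _) = ℕP.*-cancelˡ-≡ _ _ b
      (ℕP.+-cancelʳ-≡ 1 _ _ (ℤP.+-injective (trans (sym r) r′)))
    fun : ∀ {i xy xy′} → Root i xy → Root i xy′ → xy ≡ xy′
    fun ((r , p) , (s , q)) ((r′ , p′) , (s′ , q′)) =
      cong₂ _,_ (pos-sq-inj p p′ (trans r (sym r′))) (pos-sq-inj q q′ (trans s (sym s′)))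

  -- Zero is not a square root of 1 modulo `b` or `c` once both are at least 2, so the two sign
  -- changes act freely and every positive solution accounts for exactly four.
  card-V : 2 ℕ.≤ b → 2 ℕ.≤ c → (e : Enum (V b c 1ℤ (norm₁ b c n))) → card e ≡ 4 ℕ.* (f b ⊛ f c) n
  card-V 2≤b 2≤c e = trans (card-double px? e (λ { (x , y) → - x , y })
      (λ { (x , y) → cong (_, y) (ℤP.neg-involutive x) })
      (λ { {x , y} (h , d , d′) → trans (cong (λ t → + c * t + + b * (y * y)) (neg-sq x)) h
                                , subst (λ t → + b ∣ t - 1ℤ) (sym (neg-sq x)) d , d′ })
      (λ _ → pos-neg)
      (λ { {x , y} (h , d , d′) → neg-pos (nz 2≤b d) }))
    (trans (cong (2 ℕ.*_) (trans (card-double py? e₁ (λ { (x , y) → x , - y })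
      (λ { (x , y) → cong (x ,_) (ℤP.neg-involutive y) })
      (λ { {x , y} ((h , d , d′) , p) → (trans (cong (λ t → + c * (x * x) + + b * t) (neg-sq y)) h
                                , d , subst (λ t → + c ∣ t - 1ℤ) (sym (neg-sq y)) d′) , p })
      (λ _ → pos-neg)
      (λ { {x , y} ((h , d , d′) , _) → neg-pos (nz 2≤c d′) }))
      (cong (2 ℕ.*_) (card-Pos (restrict py? e₁)))))
     (sym (ℕP.*-assoc 2 2 ((f b ⊛ f c) n))))
    where
    px? : Decidable (λ (xy : ℤ × ℤ) → 0ℤ < proj₁ xy)
    px? (x , _) = 0ℤ <? x
    py? : Decidable (λ (xy : ℤ × ℤ) → 0ℤ < proj₂ xy)
    py? (_ , y) = 0ℤ <? y
    e₁ = restrict px? e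
    nz : ∀ {d z} → 2 ℕ.≤ d → + d ∣ z * z - 1ℤ → z ≢ 0ℤ
    nz {suc zero} (s≤s ()) h refl
    nz {suc (suc d)} 2≤d h refl with ℕD.∣1⇒≡1 (∣⇒∣ᵤ h)
    ... | ()

-- Thue's lemma and the composition of representations.

isqrt : ∀ l → ∃ λ k → k ℕ.* k ℕ.≤ l × l ℕ.< suc k ℕ.* suc k
isqrt zero = 0 , z≤n , s≤s z≤n
isqrt (suc l) with isqrt l
... | k , lo , hi with suc l ℕ.<? suc k ℕ.* suc k
...   | yes h = k , ℕP.m≤n⇒m≤1+n lo , h
...   | no h = suc k , ℕP.≮⇒≥ h , ℕP.<-≤-trans (s≤s hi) (ℕP.*-mono-< (ℕP.n<1+n (suc k)) (ℕP.n<1+n (suc k)))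

-- Thue's lemma: among the (k+1)² > l pairs of naturals up to k = ⌊√l⌋, two have
-- the same residue of i y₁ - j x₁ modulo l.
module Thue (l : ℕ) .{{_ : ℕ.NonZero l}} (x₁ y₁ : ℤ) (k : ℕ)
  (lo : k ℕ.* k ℕ.≤ l) (hi : l ℕ.< suc k ℕ.* suc k) where

  private
    val : Fin (suc k) × Fin (suc k) → ℤ
    val (p , q) = + toℕ p * y₁ - x₁ * + toℕ q

    pair : Fin (suc k ℕ.* suc k) → Fin (suc k) × Fin (suc k)
    pair = remQuot {suc k} (suc k)

    eq : ∀ {m} {u v : Fin m} → + toℕ u - + toℕ v ≡ 0ℤ → u ≡ v
    eq {u = u} {v} h = toℕ-injective (ℤP.+-injective (ℤP.i-j≡0⇒i≡j (+ toℕ u) (+ toℕ v) h))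

    ident : ∀ p p′ q q′ x₁ y₁ r r′ → r ≡ r′ →
      (p * y₁ - x₁ * q - r) - (p′ * y₁ - x₁ * q′ - r′) ≡ (p - p′) * y₁ - x₁ * (q - q′)
    ident p p′ q q′ x₁ y₁ r .r refl = solve (p ∷ p′ ∷ q ∷ q′ ∷ x₁ ∷ y₁ ∷ r ∷ [])

    small : ∀ (u v : Fin (suc k)) → abs (+ toℕ u - + toℕ v) ℕ.* abs (+ toℕ u - + toℕ v) ℕ.≤ l
    small u v = ℕP.≤-trans (ℕP.*-mono-≤ bd bd) lo
      where
      bd : abs (+ toℕ u - + toℕ v) ℕ.≤ k
      bd = subst (ℕ._≤ k) (cong abs (sym (ℤP.m-n≡m⊖n (toℕ u) (toℕ v))))
        (ℕP.≤-trans (ℤP.∣m⊝n∣≤m⊔n (toℕ u) (toℕ v))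
          (ℕP.⊔-lub (ℕP.≤-pred (toℕ<n u)) (ℕP.≤-pred (toℕ<n v))))

  solution : ∃₂ λ x y → ¬ (x ≡ 0ℤ × y ≡ 0ℤ) ×
    + l ∣ x * y₁ - x₁ * y × abs x ℕ.* abs x ℕ.≤ l × abs y ℕ.* abs y ℕ.≤ l
  solution with pigeonhole hi (λ i → proj₁ (residue l (val (pair i))))
  ... | i , j , i<j , ri≡rj = + toℕ p - + toℕ p′ , + toℕ q - + toℕ q′ , nz , dvd , small p p′ , small q q′
    where
    p = proj₁ (pair i) ; q = proj₂ (pair i) ; p′ = proj₁ (pair j) ; q′ = proj₂ (pair j)
    nz : ¬ (+ toℕ p - + toℕ p′ ≡ 0ℤ × + toℕ q - + toℕ q′ ≡ 0ℤ)
    nz (hx , hy) = <⇒≢ i<j (trans (sym (combine-remQuot {suc k} (suc k) i))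
      (trans (cong₂ combine (eq {u = p} {p′} hx) (eq {u = q} {q′} hy)) (combine-remQuot {suc k} (suc k) j)))
    dvd : + l ∣ (+ toℕ p - + toℕ p′) * y₁ - x₁ * (+ toℕ q - + toℕ q′)
    dvd = ∣-by (∣m∣n⇒∣m-n (proj₂ (residue l (val (pair i)))) (proj₂ (residue l (val (pair j)))))
      (ident (+ toℕ p) (+ toℕ p′) (+ toℕ q) (+ toℕ q′) x₁ y₁
        (+ toℕ (proj₁ (residue l (val (pair i))))) (+ toℕ (proj₁ (residue l (val (pair j)))))
        (cong (λ t → + toℕ t) ri≡rj))

thue : ∀ l .{{_ : ℕ.NonZero l}} x₁ y₁ → ∃₂ λ x y → ¬ (x ≡ 0ℤ × y ≡ 0ℤ) ×
  + l ∣ x * y₁ - x₁ * y × abs x ℕ.* abs x ℕ.≤ l × abs y ℕ.* abs y ℕ.≤ l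
thue l x₁ y₁ = let k , lo , hi = isqrt l in Thue.solution l x₁ y₁ k lo hi

-- The congruence class, with respect to the reference solution (x₀ , y₀), of a
-- representation of a multiple of l.
T : (b c l : ℕ) (x₀ y₀ s N : ℤ) → ℤ × ℤ → Set
T b c l x₀ y₀ s N (x , y) = V b c s N (x , y) × + l ∣ x * y₀ - x₀ * y

-- Composition with (x₀ , y₀), where c x₀² + b y₀² = g l, turns T into this set; it
-- depends on x₀, y₀ and s only modulo g² b c.
E : (b c g : ℕ) (x₀ y₀ s m : ℤ) → ℤ × ℤ → Set
E b c g x₀ y₀ s m (z , w) =
  + 1 * (z * z) + + (b ℕ.* c) * (w * w) ≡ + g * ((+ b + + c) * m) ×
  + g ∣ x₀ * z + + b * y₀ * w ×
  + g ∣ y₀ * z - + c * x₀ * w ×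
  + g * + g * + b ∣ (x₀ * z + + b * y₀ * w) * (x₀ * z + + b * y₀ * w) - + g * + g * s ×
  + g * + g * + c ∣ (y₀ * z - + c * x₀ * w) * (y₀ * z - + c * x₀ * w) - + g * + g * s

E? : ∀ b c g x₀ y₀ s m → Decidable (E b c g x₀ y₀ s m)
E? b c g x₀ y₀ s m (z , w) =
  (_ ≟ _) ×-dec (_ ∣? _) ×-dec (_ ∣? _) ×-dec (_ ∣? _) ×-dec (_ ∣? _)

enumE : ∀ b c g .{{_ : ℕ.NonZero b}} .{{_ : ℕ.NonZero c}} x₀ y₀ s m → Enum (E b c g x₀ y₀ s m)
enumE b c g x₀ y₀ s m = enumBox (E? b c g x₀ y₀ s m) (abs (+ g * ((+ b + + c) * m)))
  (λ {z} {w} v → form-bound (b ℕ.* c) 1 {{ℕP.m*n≢0 b c}} z w (proj₁ v))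

module _ (b c g : ℕ) (z w m : ℤ) {x₀ x₁ y₀ y₁ s t : ℤ}
  (hx : + (g ℕ.* g ℕ.* (b ℕ.* c)) ∣ x₀ - x₁) (hy : + (g ℕ.* g ℕ.* (b ℕ.* c)) ∣ y₀ - y₁)
  (hs : + (g ℕ.* g ℕ.* (b ℕ.* c)) ∣ s - t) where

  private
    modulus : + (g ℕ.* g ℕ.* (b ℕ.* c)) ≡ + g * + g * (+ b * + c)
    modulus = trans (ℤP.pos-* (g ℕ.* g) (b ℕ.* c)) (cong₂ _*_ (ℤP.pos-* g g) (ℤP.pos-* b c))

    dg : ∀ {n} → + (g ℕ.* g ℕ.* (b ℕ.* c)) ∣ n → + g ∣ n
    dg = ∣-trans (divides (+ g * (+ b * + c)) (trans modulus (h (+ g) (+ b) (+ c))))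
      where
      h : ∀ g b c → g * g * (b * c) ≡ g * (b * c) * g
      h = solve-∀

    db : ∀ {n} → + (g ℕ.* g ℕ.* (b ℕ.* c)) ∣ n → + g * + g * + b ∣ n
    db = ∣-trans (divides (+ c) (trans modulus (h (+ g) (+ b) (+ c))))
      where
      h : ∀ g b c → g * g * (b * c) ≡ c * (g * g * b)
      h = solve-∀

    dc : ∀ {n} → + (g ℕ.* g ℕ.* (b ℕ.* c)) ∣ n → + g * + g * + c ∣ n
    dc = ∣-trans (divides (+ b) (trans modulus (h (+ g) (+ b) (+ c))))
      where
      h : ∀ g b c → g * g * (b * c) ≡ b * (g * g * c)
      h = solve-∀

    shift : ∀ {d α β} → d ∣ α - β → d ∣ α → d ∣ β
    shift {d} {α} {β} h h′ = ∣-by (∣m∣n⇒∣m-n h′ h) (r α β)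
      where
      r : ∀ α β → α - (α - β) ≡ β
      r = solve-∀

    hα : ∀ b → + (g ℕ.* g ℕ.* (b ℕ.* c)) ∣ x₀ - x₁ → + (g ℕ.* g ℕ.* (b ℕ.* c)) ∣ y₀ - y₁ →
      + (g ℕ.* g ℕ.* (b ℕ.* c)) ∣ (x₀ * z + + b * y₀ * w) - (x₁ * z + + b * y₁ * w)
    hα b hx hy = ∣-by (∣m∣n⇒∣m+n (∣n⇒∣m*n z hx) (∣n⇒∣m*n (+ b * w) hy)) (r z w (+ b) x₀ x₁ y₀ y₁)
      where
      r : ∀ z w b x₀ x₁ y₀ y₁ → z * (x₀ - x₁) + b * w * (y₀ - y₁) ≡ (x₀ * z + b * y₀ * w) - (x₁ * z + b * y₁ * w)
      r = solve-∀

    hβ : + (g ℕ.* g ℕ.* (b ℕ.* c)) ∣ (y₀ * z - + c * x₀ * w) - (y₁ * z - + c * x₁ * w)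
    hβ = ∣-by (∣m∣n⇒∣m-n (∣n⇒∣m*n z hy) (∣n⇒∣m*n (+ c * w) hx)) (r z w (+ c) x₀ x₁ y₀ y₁)
      where
      r : ∀ z w c x₀ x₁ y₀ y₁ → z * (y₀ - y₁) - c * w * (x₀ - x₁) ≡ (y₀ * z - c * x₀ * w) - (y₁ * z - c * x₁ * w)
      r = solve-∀

    hsq : ∀ {k} α β → k ∣ α - β → k ∣ s - t → k ∣ (α * α - + g * + g * s) - (β * β - + g * + g * t)
    hsq α β h h′ = ∣-by (∣m∣n⇒∣m-n (∣n⇒∣m*n (α + β) h) (∣n⇒∣m*n (+ g * + g) h′)) (r α β (+ g) s t)
      where
      r : ∀ α β g s t → (α + β) * (α - β) - g * g * (s - t) ≡ (α * α - g * g * s) - (β * β - g * g * t)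
      r = solve-∀

  E-cong : E b c g x₀ y₀ s m (z , w) → E b c g x₁ y₁ t m (z , w)
  E-cong (e , d₁ , d₂ , d₃ , d₄) = e , shift (dg (hα b hx hy)) d₁ , shift (dg hβ) d₂ ,
    shift (db (hsq (x₀ * z + + b * y₀ * w) (x₁ * z + + b * y₁ * w) (hα b hx hy) hs)) d₃ ,
    shift (dc (hsq (y₀ * z - + c * x₀ * w) (y₁ * z - + c * x₁ * w) hβ hs)) d₄

module _ (b c g l : ℕ) .{{_ : ℕ.NonZero g}} .{{_ : ℕ.NonZero l}} (x₀ y₀ s m : ℤ)
  (lg : + c * (x₀ * x₀) + + b * (y₀ * y₀) ≡ + g * + l) (l⊥y₀ : Cop (+ l) y₀) where

  private
    l≢0 = nonZero l
    g≢0 = nonZero g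

    -- Brahmagupta composition with (x₀ , y₀): (c x x₀ + b y y₀)² + bc (x y₀ - x₀ y)² is the product
    -- of the two norms, here (b + c) l m · g l. Both components are multiples of `l`, and dividing
    -- by it leaves the norm g (b + c) m. The inverse map is g x = x₀ z + b y₀ w, g y = y₀ z - c x₀
    -- w.
    R : ℤ × ℤ → ℤ × ℤ → Set
    R (x , y) (z , w) = + l * z ≡ + c * x * x₀ + + b * y * y₀ × + l * w ≡ x * y₀ - x₀ * y

    gx : ∀ c b x₀ y₀ x y z w g l → c * (x₀ * x₀) + b * (y₀ * y₀) ≡ g * l →
      l * z ≡ c * x * x₀ + b * y * y₀ → l * w ≡ x * y₀ - x₀ * y → l * (g * x) ≡ l * (x₀ * z + b * y₀ * w)
    gx c b x₀ y₀ x y z w g l e ez ew = lin {C = l * (g * x)} {l * (x₀ * z + b * y₀ * w)} (- x) e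
      (lin {A = x₀ * (l * z) + b * y₀ * (l * w)}
           {x₀ * (c * x * x₀ + b * y * y₀) + b * y₀ * (x * y₀ - x₀ * y)} (- 1ℤ)
        (cong₂ (λ u v → x₀ * u + b * y₀ * v) ez ew)
        (solve (c ∷ b ∷ x₀ ∷ y₀ ∷ x ∷ y ∷ z ∷ w ∷ g ∷ l ∷ [])))

    gy : ∀ c b x₀ y₀ x y z w g l → c * (x₀ * x₀) + b * (y₀ * y₀) ≡ g * l →
      l * z ≡ c * x * x₀ + b * y * y₀ → l * w ≡ x * y₀ - x₀ * y → l * (g * y) ≡ l * (y₀ * z - c * x₀ * w)
    gy c b x₀ y₀ x y z w g l e ez ew = lin {C = l * (g * y)} {l * (y₀ * z - c * x₀ * w)} (- y) e
      (lin {A = y₀ * (l * z) - c * x₀ * (l * w)}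
           {y₀ * (c * x * x₀ + b * y * y₀) - c * x₀ * (x * y₀ - x₀ * y)} (- 1ℤ)
        (cong₂ (λ u v → y₀ * u - c * x₀ * v) ez ew)
        (solve (c ∷ b ∷ x₀ ∷ y₀ ∷ x ∷ y ∷ z ∷ w ∷ g ∷ l ∷ [])))

    lnorm : ∀ c b x₀ y₀ x y z w g l n → c * (x₀ * x₀) + b * (y₀ * y₀) ≡ g * l →
      l * z ≡ c * x * x₀ + b * y * y₀ → l * w ≡ x * y₀ - x₀ * y → c * (x * x) + b * (y * y) ≡ n →
      l * l * (+ 1 * (z * z) + b * c * (w * w)) ≡ n * (g * l)
    lnorm c b x₀ y₀ x y z w g l n e ez ew en = trans
      (trans (r₁ b c l z w) (cong₂ (λ u v → u * u + b * c * (v * v)) ez ew))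
      (trans (r₂ b c x y x₀ y₀) (cong₂ _*_ en e))
      where
      r₁ : ∀ b c l z w → l * l * (+ 1 * (z * z) + b * c * (w * w)) ≡ (l * z) * (l * z) + b * c * ((l * w) * (l * w))
      r₁ = solve-∀
      r₂ : ∀ b c x y x₀ y₀ → (c * x * x₀ + b * y * y₀) * (c * x * x₀ + b * y * y₀)
        + b * c * ((x * y₀ - x₀ * y) * (x * y₀ - x₀ * y))
        ≡ (c * (x * x) + b * (y * y)) * (c * (x₀ * x₀) + b * (y₀ * y₀))
      r₂ = solve-∀

    toNorm : ∀ c b x₀ y₀ x y z w g l m → l ≢ 0ℤ → c * (x₀ * x₀) + b * (y₀ * y₀) ≡ g * l →
      l * z ≡ c * x * x₀ + b * y * y₀ → l * w ≡ x * y₀ - x₀ * y →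
      c * (x * x) + b * (y * y) ≡ (b + c) * (l * m) →
      + 1 * (z * z) + b * c * (w * w) ≡ g * ((b + c) * m)
    toNorm c b x₀ y₀ x y z w g l m l≢0 e ez ew en = cancelˡ l l≢0 (cancelˡ l l≢0
      (trans (sym (ℤP.*-assoc l l (+ 1 * (z * z) + b * c * (w * w))))
        (trans (lnorm c b x₀ y₀ x y z w g l ((b + c) * (l * m)) e ez ew en) (r (b + c) l m g))))
      where
      r : ∀ n l m g → n * (l * m) * (g * l) ≡ l * (l * (g * (n * m)))
      r = solve-∀

    -- Because `l` is prime to `y₀`, this identity makes the first component of the composition
    -- divisible by `l` as soon as the second one is.
    lz : ∀ c b x₀ y₀ x y g l → c * (x₀ * x₀) + b * (y₀ * y₀) ≡ g * l →
      c * x₀ * (x * y₀ - x₀ * y) + y * g * l ≡ y₀ * (c * x * x₀ + b * y * y₀)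
    lz c b x₀ y₀ x y g l e = lin (- y) e (solve (c ∷ b ∷ x₀ ∷ y₀ ∷ x ∷ y ∷ g ∷ l ∷ []))

    scale : ∀ {d} x {α} → + g * x ≡ α → + d ∣ x * x - s → + g * + g * + d ∣ α * α - + g * + g * s
    scale {d} x refl (divides q e) = divides q (lin (+ g * + g) e (r (+ g) x s q (+ d)))
      where
      r : ∀ g x s q d → g * x * (g * x) - g * g * s - q * (g * g * d) ≡ g * g * (x * x - s - q * d)
      r = solve-∀

    unscale : ∀ {d} x {α} → + g * x ≡ α → + g * + g * + d ∣ α * α - + g * + g * s → + d ∣ x * x - s
    unscale {d} x refl (divides q e) = divides q (cancelˡ (+ g) g≢0 (cancelˡ (+ g) g≢0
      (lin 1ℤ e (r (+ g) x s q (+ d)))))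
      where
      r : ∀ g x s q d → g * (g * (x * x - s)) - g * (g * (q * d)) ≡
        1ℤ * (g * x * (g * x) - g * g * s - q * (g * g * d))
      r = solve-∀

    toE : ∀ x y z w → + c * (x * x) + + b * (y * y) ≡ (+ b + + c) * (+ l * m) →
      + b ∣ x * x - s → + c ∣ y * y - s →
      + l * z ≡ + c * x * x₀ + + b * y * y₀ → + l * w ≡ x * y₀ - x₀ * y → E b c g x₀ y₀ s m (z , w)
    toE x y z w e d₁ d₂ ez ew =
      trans (cong (λ t → + 1 * (z * z) + t * (w * w)) (ℤP.pos-* b c))
        (toNorm (+ c) (+ b) x₀ y₀ x y z w (+ g) (+ l) m l≢0 lg ez ew e)
      , divides x (trans (sym ex) (ℤP.*-comm (+ g) x)) , divides y (trans (sym ey) (ℤP.*-comm (+ g) y))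
      , scale {b} x ex d₁ , scale {c} y ey d₂
      where
      ex : + g * x ≡ x₀ * z + + b * y₀ * w
      ex = cancelˡ (+ l) l≢0 (gx (+ c) (+ b) x₀ y₀ x y z w (+ g) (+ l) lg ez ew)
      ey : + g * y ≡ y₀ * z - + c * x₀ * w
      ey = cancelˡ (+ l) l≢0 (gy (+ c) (+ b) x₀ y₀ x y z w (+ g) (+ l) lg ez ew)

    to′ : ∀ x y → V b c s ((+ b + + c) * (+ l * m)) (x , y) → + l ∣ x * y₀ - x₀ * y →
      + l ∣ + c * x * x₀ + + b * y * y₀ → ∃ λ zw → E b c g x₀ y₀ s m zw × R (x , y) zw
    to′ x y (e , d₁ , d₂) (divides w ew) (divides z ez) =
      (z , w) , toE x y z w e d₁ d₂ ez′ ew′ , ez′ , ew′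
      where
      ez′ : + l * z ≡ + c * x * x₀ + + b * y * y₀
      ez′ = trans (ℤP.*-comm (+ l) z) (sym ez)
      ew′ : + l * w ≡ x * y₀ - x₀ * y
      ew′ = trans (ℤP.*-comm (+ l) w) (sym ew)

    to : ∀ {xy} → T b c l x₀ y₀ s ((+ b + + c) * (+ l * m)) xy → ∃ λ zw → E b c g x₀ y₀ s m zw × R xy zw
    to {x , y} (v , d) = to′ x y v d (Cop-euclid (+ c * x * x₀ + + b * y * y₀) l⊥y₀ (∣-by
      (∣m∣n⇒∣m+n (∣n⇒∣m*n (+ c * x₀) d) (∣n⇒∣m*n (y * + g) ∣-refl))
      (lz (+ c) (+ b) x₀ y₀ x y (+ g) (+ l) lg)))

    gnorm : ∀ c b x₀ y₀ x y z w g l m n → c * (x₀ * x₀) + b * (y₀ * y₀) ≡ g * l →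
      g * x ≡ x₀ * z + b * y₀ * w → g * y ≡ y₀ * z - c * x₀ * w →
      + 1 * (z * z) + b * c * (w * w) ≡ g * (n * m) →
      g * (g * (c * (x * x) + b * (y * y))) ≡ g * (g * (n * (l * m)))
    gnorm c b x₀ y₀ x y z w g l m n e ex ey en = trans
      (trans (r₁ c b x y g) (cong₂ (λ u v → c * (u * u) + b * (v * v)) ex ey))
      (trans (r₂ c b x₀ y₀ z w) (trans (cong₂ _*_ e en) (r₃ g l m n)))
      where
      r₁ : ∀ c b x y g → g * (g * (c * (x * x) + b * (y * y))) ≡ c * ((g * x) * (g * x)) + b * ((g * y) * (g * y))
      r₁ = solve-∀
      r₂ : ∀ c b x₀ y₀ z w → c * ((x₀ * z + b * y₀ * w) * (x₀ * z + b * y₀ * w))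
        + b * ((y₀ * z - c * x₀ * w) * (y₀ * z - c * x₀ * w))
        ≡ (c * (x₀ * x₀) + b * (y₀ * y₀)) * (+ 1 * (z * z) + b * c * (w * w))
      r₂ = solve-∀
      r₃ : ∀ g l m n → g * l * (g * (n * m)) ≡ g * (g * (n * (l * m)))
      r₃ = solve-∀

    gz : ∀ c b x₀ y₀ x y z w g l → c * (x₀ * x₀) + b * (y₀ * y₀) ≡ g * l →
      g * x ≡ x₀ * z + b * y₀ * w → g * y ≡ y₀ * z - c * x₀ * w →
      g * (l * z) ≡ g * (c * x * x₀ + b * y * y₀)
    gz c b x₀ y₀ x y z w g l e ex ey = lin {A = c * (x₀ * x₀) + b * (y₀ * y₀)} {g * l} (- z) e
      (lin {A = c * x₀ * (g * x) + b * y₀ * (g * y)}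
           {c * x₀ * (x₀ * z + b * y₀ * w) + b * y₀ * (y₀ * z - c * x₀ * w)} (- 1ℤ)
        (cong₂ (λ u v → c * x₀ * u + b * y₀ * v) ex ey)
        (solve (c ∷ b ∷ x₀ ∷ y₀ ∷ x ∷ y ∷ z ∷ w ∷ g ∷ l ∷ [])))

    gw : ∀ c b x₀ y₀ x y z w g l → c * (x₀ * x₀) + b * (y₀ * y₀) ≡ g * l →
      g * x ≡ x₀ * z + b * y₀ * w → g * y ≡ y₀ * z - c * x₀ * w →
      g * (l * w) ≡ g * (x * y₀ - x₀ * y)
    gw c b x₀ y₀ x y z w g l e ex ey = lin {A = c * (x₀ * x₀) + b * (y₀ * y₀)} {g * l} (- w) e
      (lin {A = y₀ * (g * x) - x₀ * (g * y)}
           {y₀ * (x₀ * z + b * y₀ * w) - x₀ * (y₀ * z - c * x₀ * w)} (- 1ℤ)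
        (cong₂ (λ u v → y₀ * u - x₀ * v) ex ey)
        (solve (c ∷ b ∷ x₀ ∷ y₀ ∷ x ∷ y ∷ z ∷ w ∷ g ∷ l ∷ [])))

    fromNorm : ∀ c b x₀ y₀ x y z w g l m → g ≢ 0ℤ → c * (x₀ * x₀) + b * (y₀ * y₀) ≡ g * l →
      g * x ≡ x₀ * z + b * y₀ * w → g * y ≡ y₀ * z - c * x₀ * w →
      + 1 * (z * z) + b * c * (w * w) ≡ g * ((b + c) * m) → c * (x * x) + b * (y * y) ≡ (b + c) * (l * m)
    fromNorm c b x₀ y₀ x y z w g l m g≢0 e ex ey en =
      cancelˡ g g≢0 (cancelˡ g g≢0 (gnorm c b x₀ y₀ x y z w g l m (b + c) e ex ey en))

    fromT : ∀ x y z w → E b c g x₀ y₀ s m (z , w) →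
      + g * x ≡ x₀ * z + + b * y₀ * w → + g * y ≡ y₀ * z - + c * x₀ * w →
      T b c l x₀ y₀ s ((+ b + + c) * (+ l * m)) (x , y) × R (x , y) (z , w)
    fromT x y z w (e , _ , _ , d₁ , d₂) ex ey =
      (( fromNorm (+ c) (+ b) x₀ y₀ x y z w (+ g) (+ l) m g≢0 lg ex ey
           (trans (cong (λ t → + 1 * (z * z) + t * (w * w)) (sym (ℤP.pos-* b c))) e)
       , unscale {b} x ex d₁ , unscale {c} y ey d₂)
      , divides w (trans (sym lw) (ℤP.*-comm (+ l) w)))
      , cancelˡ (+ g) g≢0 (gz (+ c) (+ b) x₀ y₀ x y z w (+ g) (+ l) lg ex ey) , lw
      where
      lw : + l * w ≡ x * y₀ - x₀ * y
      lw = cancelˡ (+ g) g≢0 (gw (+ c) (+ b) x₀ y₀ x y z w (+ g) (+ l) lg ex ey)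

    from : ∀ {zw} → E b c g x₀ y₀ s m zw → ∃ λ xy → T b c l x₀ y₀ s ((+ b + + c) * (+ l * m)) xy × R xy zw
    from {z , w} h@(_ , divides x ex , divides y ey , _) = (x , y) , fromT x y z w h
      (trans (ℤP.*-comm (+ g) x) (sym ex)) (trans (ℤP.*-comm (+ g) y) (sym ey))

    inj : ∀ {p q r} → R p r → R q r → p ≡ q
    inj {x , y} {x′ , y′} {z , w} (e , e′) (h , h′) = cong₂ _,_
      (cancelˡ (+ g) g≢0 (cancelˡ (+ l) l≢0 (trans (gx (+ c) (+ b) x₀ y₀ x y z w (+ g) (+ l) lg e e′)
        (sym (gx (+ c) (+ b) x₀ y₀ x′ y′ z w (+ g) (+ l) lg h h′)))))
      (cancelˡ (+ g) g≢0 (cancelˡ (+ l) l≢0 (trans (gy (+ c) (+ b) x₀ y₀ x y z w (+ g) (+ l) lg e e′)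
        (sym (gy (+ c) (+ b) x₀ y₀ x′ y′ z w (+ g) (+ l) lg h h′)))))

    fun : ∀ {p q r} → R p q → R p r → q ≡ r
    fun (e , e′) (h , h′) = cong₂ _,_ (cancelˡ (+ l) l≢0 (trans e (sym h)))
      (cancelˡ (+ l) l≢0 (trans e′ (sym h′)))

  card-T≡card-E : (eT : Enum (T b c l x₀ y₀ s ((+ b + + c) * (+ l * m)))) →
    (eE : Enum (E b c g x₀ y₀ s m)) → card eT ≡ card eE
  card-T≡card-E eT eE = card-≡ R eT eE to from inj fun

-- Solutions modulo a large prime.

form-abs : ∀ b c x y → + c * (x * x) + + b * (y * y) ≡ + (c ℕ.* (abs x ℕ.* abs x) ℕ.+ b ℕ.* (abs y ℕ.* abs y))
form-abs b c x y = cong₂ _+_ (trans (cong (+ c *_) (sq-abs x)) (sym (ℤP.pos-* c (abs x ℕ.* abs x))))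
                             (trans (cong (+ b *_) (sq-abs y)) (sym (ℤP.pos-* b (abs y ℕ.* abs y))))

small-multiple : ∀ {l z} → abs z ℕ.< l → + l ∣ z → z ≡ 0ℤ
small-multiple {l} {z} h d with abs z in eq
... | zero = ℤP.∣i∣≡0⇒i≡0 eq
... | suc n = ⊥-elim (ℕP.<⇒≱ h (ℕD.∣⇒≤ (subst (l ℕD.∣_) eq (∣⇒∣ᵤ d))))

sq≤⇒< : ∀ {n l} → 1 ℕ.< l → n ℕ.* n ℕ.≤ l → n ℕ.< l
sq≤⇒< {n} {l} 1<l h with n ℕ.<? l
... | yes p = p
... | no p = ⊥-elim (ℕP.<⇒≱ (ℕP.≤-<-trans (ℕP.≤-reflexive (sym (ℕP.*-identityʳ l))) (ℕP.*-monoʳ-< l {{ℕ.>-nonZero (ℕP.<-trans (s≤s z≤n) 1<l)}} 1<l))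
  (ℕP.≤-trans (ℕP.*-mono-≤ (ℕP.≮⇒≥ p) (ℕP.≮⇒≥ p)) h))

module Counting {b c l : ℕ} (pr : Prime l) (l≢2 : ¬ (+ l ∣ + 2))
  (l⊥b : Cop (+ l) (+ b)) (l⊥c : Cop (+ l) (+ c)) where

  module _ {s N : ℤ} (l∣N : + l ∣ N) where

    l∣x⇒l∣y : ∀ x y → + c * (x * x) + + b * (y * y) ≡ N → + l ∣ x → + l ∣ y
    l∣x⇒l∣y x y refl d = prime-sq y pr (Cop-euclid (y * y) l⊥b
      (∣-by (∣m∣n⇒∣m-n l∣N (∣n⇒∣m*n (+ c * x) d)) (r (+ c) (+ b) x y)))
      where
      r : ∀ c b x y → c * (x * x) + b * (y * y) - c * x * x ≡ b * (y * y)
      r = solve-∀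

  module _ {x₀ y₀ : ℤ} (l⊥y₀ : Cop (+ l) y₀) (l∣₀ : + l ∣ + c * (x₀ * x₀) + + b * (y₀ * y₀)) {s N : ℤ} (l∣N : + l ∣ N) where

    private
      Near : ℤ × ℤ → Set
      Near (x , y) = + l ∣ x * y₀ - x₀ * y

      near? : Decidable Near
      near? (x , y) = + l ∣? x * y₀ - x₀ * y

      Flat : ℤ × ℤ → Set
      Flat (x , y) = + l ∣ x

      flat? : Decidable Flat
      flat? (x , y) = + l ∣? x

      -- Modulo `l` the conic c x² + b y² = 0 is a pair of lines, spanned by (x₀ , y₀) and by (x₀ ,
      -- - y₀).
      either : ∀ x y → + c * (x * x) + + b * (y * y) ≡ N → + l ∣ x * y₀ - x₀ * y ⊎ + l ∣ x * y₀ + x₀ * y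
      either x y refl = prime-euclid (x * y₀ - x₀ * y) (x * y₀ + x₀ * y) pr
        (Cop-euclid ((x * y₀ - x₀ * y) * (x * y₀ + x₀ * y)) l⊥c (∣-by
        (∣m∣n⇒∣m-n (∣n⇒∣m*n (y₀ * y₀) l∣N) (∣n⇒∣m*n (y * y) l∣₀)) (r (+ c) (+ b) x y x₀ y₀)))
        where
        r : ∀ c b x y x₀ y₀ → y₀ * y₀ * (c * (x * x) + b * (y * y)) - y * y * (c * (x₀ * x₀) + b * (y₀ * y₀))
          ≡ c * ((x * y₀ - x₀ * y) * (x * y₀ + x₀ * y))
        r = solve-∀

      both : ∀ x y → + l ∣ x * y₀ - x₀ * y → + l ∣ x * y₀ + x₀ * y → + l ∣ x
      both x y d d′ = [ (λ h → ⊥-elim (l≢2 h)) , id ]′ (prime-euclid (+ 2) x pr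
        (Cop-euclid (+ 2 * x) l⊥y₀ (∣-by (∣m∣n⇒∣m+n d d′) (r x y x₀ y₀))))
        where
        r : ∀ x y x₀ y₀ → (x * y₀ - x₀ * y) + (x * y₀ + x₀ * y) ≡ y₀ * (+ 2 * x)
        r = solve-∀

      conj : ℤ × ℤ → ℤ × ℤ
      conj (x , y) = x , - y

      conj² : ∀ p → conj (conj p) ≡ p
      conj² (x , y) = cong (x ,_) (ℤP.neg-involutive y)

      conjV : ∀ p → V b c s N p → V b c s N (conj p)
      conjV (x , y) (e , d , d′) = trans (cong (λ t → + c * (x * x) + + b * t) (neg-sq y)) e , d ,
        subst (λ t → + c ∣ t - s) (sym (neg-sq y)) d′

      conj-minus : ∀ x y x₀ y₀ → x * y₀ - x₀ * - y ≡ x * y₀ + x₀ * y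
      conj-minus = solve-∀

      flat-near : ∀ x y → + l ∣ x → + l ∣ y → Near (x , y)
      flat-near x y d d′ = ∣m∣n⇒∣m-n {+ l} {x * y₀} {x₀ * y} (∣m⇒∣m*n {+ l} {x} y₀ d) (∣n⇒∣m*n {+ l} x₀ {y} d′)

      far⇒ : ∀ p → V b c s N p × ¬ Near p → (V b c s N (conj p) × Near (conj p)) × ¬ Flat (conj p)
      far⇒ (x , y) (v , far) with either x y (proj₁ v)
      ... | inj₁ d = ⊥-elim (far d)
      ... | inj₂ d = (conjV (x , y) v , subst (+ l ∣_) (sym (conj-minus x y x₀ y₀)) d) ,
        λ fl → far (flat-near x y fl (l∣x⇒l∣y {s} l∣N x y (proj₁ v) fl))

      far⇐ : ∀ p → (V b c s N p × Near p) × ¬ Flat p → V b c s N (conj p) × ¬ Near (conj p)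
      far⇐ (x , y) ((v , near) , nfl) = conjV (x , y) v ,
        λ near′ → nfl (both x y near (subst (+ l ∣_) (conj-minus x y x₀ y₀) near′))

      arith : ∀ {v t n p q f} → v ≡ t ℕ.+ n → n ≡ q → t ≡ p ℕ.+ q → p ≡ f → v ℕ.+ f ≡ 2 ℕ.* t
      arith {q = q} {f} refl refl refl refl = r f q
        where
        r : ∀ f q → f ℕ.+ q ℕ.+ q ℕ.+ f ≡ 2 ℕ.* (f ℕ.+ q)
        r = solveᴺ-∀

    -- Conjugation matches the solutions outside the class with those inside it that are not
    -- divisible by `l`. The solutions divisible by `l` lie in both classes, which is why they are
    -- added once more on the left.
    card-T : (eV : Enum (V b c s N)) (eT : Enum (T b c l x₀ y₀ s N))
      (eF : Enum (λ p → V b c s N p × + l ∣ proj₁ p)) → card eV ℕ.+ card eF ≡ 2 ℕ.* card eT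
    card-T eV eT eF = arith
      (trans (card-split near? eV) (cong (ℕ._+ card far) (card-⇔ (restrict near? eV) eT id id)))
      (card-≡ (λ p q → conj p ≡ q) far steep
        (λ {p} h → conj p , far⇒ p h , refl) (λ {q} h → conj q , far⇐ q h , conj² q)
        (λ {p} {p′} e e′ → trans (sym (conj² p)) (trans (cong conj (trans e (sym e′))) (conj² p′)))
        (λ e e′ → trans (sym e) e′))
      (card-split flat? eT)
      (card-⇔ (restrict flat? eT) eF (λ { ((v , _) , fl) → v , fl })
        (λ { {x , y} (v , fl) → (v , flat-near x y fl (l∣x⇒l∣y {s} l∣N x y (proj₁ v) fl)) , fl }))
      where
      far = restrict (λ p → ¬? (near? p)) eV
      steep = restrict (λ p → ¬? (flat? p)) eT

  Reference : Set
  Reference = ∃₂ λ x₀ y₀ → ∃ λ g → Cop (+ l) y₀ × + c * (x₀ * x₀) + + b * (y₀ * y₀) ≡ + g * + l ×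
    ℕ.NonZero g × g ℕ.≤ b ℕ.+ c

  -- Thue's lemma finds a multiple of (x₁ , y₁) modulo `l` whose coordinates have squares at most
  -- `l`. Its norm is a multiple g l of `l` and at most (b + c) l, so the bound on `g` does not
  -- involve `l`.
  reference : .{{_ : ℕ.NonZero b}} .{{_ : ℕ.NonZero c}} → ∀ x₁ y₁ → + l ∣ + c * (x₁ * x₁) + + b * (y₁ * y₁) → ¬ (+ l ∣ x₁) →
    Reference
  reference x₁ y₁ l∣₁ l∤x₁ = go (thue l {{prime⇒nonZero pr}} x₁ y₁)
    where
    1<l : 1 ℕ.< l
    1<l = ℕ.nonTrivial⇒n>1 l {{prime⇒nonTrivial pr}}
    l∤y₁ : ¬ (+ l ∣ y₁)
    l∤y₁ d = l∤x₁ (prime-sq x₁ pr (Cop-euclid (x₁ * x₁) l⊥c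
      (∣-by (∣m∣n⇒∣m-n l∣₁ (∣n⇒∣m*n (+ b * y₁) d)) (r (+ c) (+ b) x₁ y₁))))
      where
      r : ∀ c b x y → c * (x * x) + b * (y * y) - b * y * y ≡ c * (x * x)
      r = solve-∀
    l⊥y₁ = prime-Cop pr l∤y₁
    go : (∃₂ λ x y → ¬ (x ≡ 0ℤ × y ≡ 0ℤ) × + l ∣ x * y₁ - x₁ * y × abs x ℕ.* abs x ℕ.≤ l × abs y ℕ.* abs y ℕ.≤ l) →
      Reference
    go (x₀ , y₀ , nz , d , hx , hy) = fin (∣⇒∣ᵤ (subst (+ l ∣_) (form-abs b c x₀ y₀) l∣₀))
      where
      l∤y₀ : ¬ (+ l ∣ y₀)
      l∤y₀ h = nz (small-multiple (sq≤⇒< 1<l hx) (Cop-euclid x₀ l⊥y₁ (∣-by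
        (∣m∣n⇒∣m+n d (∣n⇒∣m*n x₁ h)) (r x₀ y₀ x₁ y₁))) , small-multiple (sq≤⇒< 1<l hy) h)
        where
        r : ∀ x y x₁ y₁ → x * y₁ - x₁ * y + x₁ * y ≡ y₁ * x
        r = solve-∀
      l∣₀ : + l ∣ + c * (x₀ * x₀) + + b * (y₀ * y₀)
      l∣₀ = Cop-euclid (+ c * (x₀ * x₀) + + b * (y₀ * y₀)) (Cop-* l⊥y₁ l⊥y₁) (∣-by
        (∣m∣n⇒∣m+n (∣n⇒∣m*n (+ c * (x₀ * y₁ + x₁ * y₀)) d) (∣n⇒∣m*n (y₀ * y₀) l∣₁))
        (r (+ c) (+ b) x₀ y₀ x₁ y₁))
        where
        r : ∀ c b x y x₁ y₁ → c * (x * y₁ + x₁ * y) * (x * y₁ - x₁ * y) + y * y * (c * (x₁ * x₁) + b * (y₁ * y₁))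
          ≡ y₁ * y₁ * (c * (x * x) + b * (y * y))
        r = solve-∀
      n = c ℕ.* (abs x₀ ℕ.* abs x₀) ℕ.+ b ℕ.* (abs y₀ ℕ.* abs y₀)
      fin : l ℕD.∣ n → Reference
      fin (ℕD.divides g e) = x₀ , y₀ , g , prime-Cop pr l∤y₀ ,
        trans (form-abs b c x₀ y₀) (trans (cong +_ e) (ℤP.pos-* g l)) , ℕ.≢-nonZero g≢0 ,
        ℕP.*-cancelʳ-≤ g (b ℕ.+ c) l {{prime⇒nonZero pr}} (ℕP.≤-trans (ℕP.≤-reflexive (sym e)) (ℕP.≤-trans
          (ℕP.+-mono-≤ (ℕP.*-monoʳ-≤ c hx) (ℕP.*-monoʳ-≤ b hy)) (ℕP.≤-reflexive (r c b l))))
        where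
        r : ∀ c b l → c ℕ.* l ℕ.+ b ℕ.* l ≡ (b ℕ.+ c) ℕ.* l
        r = solveᴺ-∀
        g≢0 : ¬ g ≡ 0
        g≢0 refl = l∤y₀ (subst (+ l ∣_) (sym y₀≡0) (divides 0ℤ refl))
          where
          y₀≡0 : y₀ ≡ 0ℤ
          y₀≡0 = ℤP.∣i∣≡0⇒i≡0 ([ (λ h → ⊥-elim (ℕ.≢-nonZero⁻¹ b h)) ,
            (λ h → [ id , id ]′ (ℕP.m*n≡0⇒m≡0∨n≡0 (abs y₀) h)) ]′
            (ℕP.m*n≡0⇒m≡0∨n≡0 b (ℕP.m+n≡0⇒n≡0 (c ℕ.* (abs x₀ ℕ.* abs x₀)) e)))

-- The parity condition and its passage from one class to another.

SquareClass : (a : ℕ) (s : ℤ) (M : ℕ) → Set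
SquareClass a s M = ∃ λ k → k ℕ.* k ≡ M × + a ∣ + M - s

-- Four times the number of representations, counted without signs, is the number of
-- integral ones, so the parity statement becomes a congruence modulo 8.
Parity : (a b c : ℕ) (s : ℤ) → Set
Parity a b c s = ∀ M → 0 ℕ.< M → (e : Enum (V b c s ((+ b + + c) * + M))) →
  (SquareClass a s M → 8 ℕD.∣ 4 ℕ.+ card e) × (¬ SquareClass a s M → 8 ℕD.∣ card e)

Data : Set
Data = ℕ × ℤ × ℤ × ℤ

Balanced : (b c : ℕ) .{{_ : ℕ.NonZero b}} .{{_ : ℕ.NonZero c}} → Data → ℕ → Set
Balanced b c (g , x₀ , y₀ , s) m = 4 ℕD.∣ card (enumE b c g x₀ y₀ s (+ m))

-- Classically one of the alternatives holds for every large `L`. A failure below `L` is what a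
-- prime l ≥ L can refute, since a positive number less than `l` is not a multiple of `l`.
Detects : (b c : ℕ) .{{_ : ℕ.NonZero b}} .{{_ : ℕ.NonZero c}} → ℕ → Data → Set
Detects b c L d = (∀ m → 0 ℕ.< m → Balanced b c d m) ⊎ (∃ λ m → 0 ℕ.< m × m ℕ.< L × ¬ Balanced b c d m)

-- The classes of 0 and 4 modulo 8 are their own negatives.
flip-parity : ∀ {v w} → 8 ℕD.∣ v ℕ.+ w → (8 ℕD.∣ 4 ℕ.+ v → 8 ℕD.∣ 4 ℕ.+ w) × (8 ℕD.∣ v → 8 ℕD.∣ w)
flip-parity {v} {w} h =
  (λ h′ → ℕD.∣m+n∣m⇒∣n (subst (8 ℕD.∣_) (r v w) (ℕD.∣m∣n⇒∣m+n (ℕD.divides 1 refl) h)) h′) ,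
  ℕD.∣m+n∣m⇒∣n h
  where
  r : ∀ v w → 8 ℕ.+ (v ℕ.+ w) ≡ (4 ℕ.+ v) ℕ.+ (4 ℕ.+ w)
  r = solveᴺ-∀

twice : ∀ n → 4 ℕD.∣ n → 8 ℕD.∣ 2 ℕ.* n
twice n = ℕD.*-monoʳ-∣ 2

8∤4 : ¬ (8 ℕD.∣ 4)
8∤4 h = ℕP.<⇒≱ (s≤s (s≤s (s≤s (s≤s (s≤s z≤n))))) (ℕD.∣⇒≤ h)

∣-bound : ∀ {l n} .{{_ : ℕ.NonZero n}} → n ℕ.< l → ¬ (+ l ∣ + n)
∣-bound h d = ℕP.<⇒≱ h (ℕD.∣⇒≤ (∣⇒∣ᵤ d))

module Dilation (a b c : ℕ) .{{nza : ℕ.NonZero a}} .{{nzb : ℕ.NonZero b}} .{{nzc : ℕ.NonZero c}}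
  (harmonic : b ℕ.* c ≡ a ℕ.* (b ℕ.+ c)) where

  private
    n₀ = + b + + c

  a∣bc : + a ∣ + b * + c
  a∣bc = divides (+ b + + c) (trans (sym (ℤP.pos-* b c)) (trans (cong +_ harmonic)
    (trans (ℤP.pos-* a (b ℕ.+ c)) (ℤP.*-comm (+ a) (+ b + + c)))))

  at : ∀ {s} → Parity a b c s → ∀ M {N} → N ≡ (+ b + + c) * + M → 0 ℕ.< M → (e : Enum (V b c s N)) →
    (SquareClass a s M → 8 ℕD.∣ 4 ℕ.+ card e) × (¬ SquareClass a s M → 8 ℕD.∣ card e)
  at par M refl = par M

  module Step {l : ℕ} (pr : Prime l) (2<l : 2 ℕ.< l) (b<l : b ℕ.< l) (c<l : c ℕ.< l) (n₀<l : b ℕ.+ c ℕ.< l)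
    (detects : ∀ g x₀ y₀ s → ℕ.NonZero g → g ℕ.≤ b ℕ.+ c → Detects b c l (g , x₀ , y₀ , s)) where

    private
      instance
        nzl : ℕ.NonZero l
        nzl = prime⇒nonZero pr

      l≢0 = nonZero l

      l⊥b : Cop (+ l) (+ b)
      l⊥b = prime-Cop pr (∣-bound b<l)
      l⊥c : Cop (+ l) (+ c)
      l⊥c = prime-Cop pr (∣-bound c<l)
      l⊥n₀ : Cop (+ l) n₀
      l⊥n₀ = prime-Cop pr (∣-bound {{ℕ.>-nonZero (ℕP.<-≤-trans (ℕ.>-nonZero⁻¹ b) (ℕP.m≤m+n b c))}} n₀<l)
      l⊥a : Cop (+ l) (+ a)
      l⊥a = Cop-∣ʳ (Cop-* l⊥b l⊥c) a∣bc

      open Counting {b} {c} pr (∣-bound 2<l) l⊥b l⊥c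

      flat-norm : ∀ c b n l x y z → l ≢ 0ℤ →
        c * ((x * l) * (x * l)) + b * ((y * l) * (y * l)) ≡ n * (l * z) → l * (c * (x * x) + b * (y * y)) ≡ n * z
      flat-norm c b n l x y z l≢0 e = cancelˡ l l≢0 (lin 1ℤ e (solve (c ∷ b ∷ n ∷ l ∷ x ∷ y ∷ z ∷ [])))

      -- If `l` divides x it also divides y, so l² divides (b + c) l m; as `l` is prime to b + c, it
      -- divides `m`.
      no-flat : ∀ {s m} → ¬ (+ l ∣ m) → ∀ {p} → ¬ (V b c s (n₀ * (+ l * m)) p × + l ∣ proj₁ p)
      no-flat {s} {m} l∤m {x , y} ((e , _) , d) = go d (l∣x⇒l∣y {s} (∣n⇒∣m*n n₀ (∣m⇒∣m*n {+ l} {+ l} m ∣-refl)) x y e d)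
        where
        go : + l ∣ x → + l ∣ y → ⊥
        go (divides x′ ex) (divides y′ ey) = l∤m (Cop-euclid m l⊥n₀ (divides (+ c * (x′ * x′) + + b * (y′ * y′))
          (trans (sym (flat-norm (+ c) (+ b) n₀ (+ l) x′ y′ m l≢0
            (trans (cong₂ (λ u v → + c * (u * u) + + b * (v * v)) (sym ex) (sym ey)) e)))
            (ℤP.*-comm (+ l) _))))

      nonsquare : ∀ {s m} → ¬ (+ l ∣ + m) → ¬ SquareClass a s (l ℕ.* m)
      nonsquare {s} {m} l∤m (k , e , _) = l∤m (go (prime-sq (+ k) pr (∣ᵤ⇒∣′ (ℕD.divides m (trans e (ℕP.*-comm l m))))))
        where
        ∣ᵤ⇒∣′ : l ℕD.∣ k ℕ.* k → + l ∣ + k * + k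
        ∣ᵤ⇒∣′ h = subst (+ l ∣_) (ℤP.pos-* k k) (∣ᵤ⇒∣ {+ l} {+ (k ℕ.* k)} h)
        go : + l ∣ + k → + l ∣ + m
        go h with ∣⇒∣ᵤ h
        ... | ℕD.divides q refl = ∣ᵤ⇒∣ (ℕD.divides (q ℕ.* q) (ℕP.*-cancelˡ-≡ m _ l (trans (sym e) (r q l))))
          where
          r : ∀ q l → q ℕ.* l ℕ.* (q ℕ.* l) ≡ l ℕ.* (q ℕ.* q ℕ.* l)
          r = solveᴺ-∀

      zero-of : ∀ {v t f} → v ℕ.+ f ≡ 2 ℕ.* t → f ≡ 0 → 8 ℕD.∣ v → 4 ℕD.∣ t
      zero-of {v} {t} e refl h = ℕD.*-cancelˡ-∣ 2 (subst (8 ℕD.∣_) (trans (sym (ℕP.+-identityʳ v)) e) h)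

      -- The count over T is divisible by 4 off the multiples of l, hence always, since a failure
      -- would be detected below l.
      balanced : ∀ {s x₀ y₀ g} → Parity a b c s → Cop (+ l) y₀ → + c * (x₀ * x₀) + + b * (y₀ * y₀) ≡ + g * + l →
        ℕ.NonZero g → g ℕ.≤ b ℕ.+ c → ∀ m → 0 ℕ.< m → (eT : Enum (T b c l x₀ y₀ s (n₀ * (+ l * + m)))) →
        4 ℕD.∣ card eT
      balanced {s} {x₀} {y₀} {g} par l⊥y₀ eg nzg g≤ m 0<m eT =
        subst (4 ℕD.∣_) (sym (card-T≡card-E b c g l {{nzg}} x₀ y₀ s (+ m) eg l⊥y₀ eT
          (enumE b c g x₀ y₀ s (+ m)))) (all m 0<m)
        where
        off : ∀ m → 0 ℕ.< m → ¬ (+ l ∣ + m) → Balanced b c (g , x₀ , y₀ , s) m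
        off m 0<m l∤m = subst (4 ℕD.∣_)
          (card-T≡card-E b c g l {{nzg}} x₀ y₀ s (+ m) eg l⊥y₀ eT′ (enumE b c g x₀ y₀ s (+ m)))
          (zero-of {card eV} (card-T {x₀} {y₀} l⊥y₀ (divides (+ g) eg) {s} (∣n⇒∣m*n n₀ (∣m⇒∣m*n {+ l} {+ l} (+ m) ∣-refl)) eV eT′ eF)
            (card-zero eF (λ {p} → no-flat {s} {+ m} l∤m {p}))
            (proj₂ (at par (l ℕ.* m) (cong (n₀ *_) (sym (ℤP.pos-* l m)))
               (ℕP.<-≤-trans 0<m (ℕP.m≤n*m m l)) eV) (nonsquare {s} {m} l∤m)))
          where
          eV = enumV b c s (n₀ * (+ l * + m))
          eT′ : Enum (T b c l x₀ y₀ s (n₀ * (+ l * + m)))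
          eT′ = restrict (λ { (x , y) → + l ∣? x * y₀ - x₀ * y }) eV
          eF = restrict (λ p → + l ∣? proj₁ p) eV
        all : ∀ m → 0 ℕ.< m → Balanced b c (g , x₀ , y₀ , s) m
        all m 0<m = [ (λ h → h m 0<m) , (λ { (m′ , 0<m′ , m′<l , bad) →
          ⊥-elim (bad (off m′ 0<m′ (∣-bound {{ℕ.>-nonZero 0<m′}} m′<l))) }) ]′ (detects g x₀ y₀ s nzg g≤)

      module _ (s s′ : ℤ) (cg : + b * + c ∣ s - + l * + l * s′) (M : ℕ) where

        N = n₀ * (+ l * + (l ℕ.* M))

        l∣N : + l ∣ N
        l∣N = ∣n⇒∣m*n n₀ (∣m⇒∣m*n {+ l} {+ l} (+ (l ℕ.* M)) ∣-refl)

        Scaled : ℤ × ℤ → ℤ × ℤ → Set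
        Scaled (x , y) (x′ , y′) = x ≡ x′ * + l × y ≡ y′ * + l

        down : ∀ {d} x → Cop (+ l) d → d ∣ + b * + c → d ∣ (x * + l) * (x * + l) - s → d ∣ x * x - s′
        down x l⊥d dbc h = Cop-euclid (x * x - s′) (Cop-* (Cop-sym l⊥d) (Cop-sym l⊥d))
          (∣-by (∣m∣n⇒∣m+n h (∣-trans dbc cg)) (r x (+ l) s s′))
          where
          r : ∀ x l s s′ → (x * l) * (x * l) - s + (s - l * l * s′) ≡ l * l * (x * x - s′)
          r = solve-∀

        up : ∀ {d} x → d ∣ + b * + c → d ∣ x * x - s′ → d ∣ (x * + l) * (x * + l) - s
        up x dbc h = ∣-by (∣m∣n⇒∣m-n (∣n⇒∣m*n (+ l * + l) h) (∣-trans dbc cg)) (r x (+ l) s s′)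
          where
          r : ∀ x l s s′ → l * l * (x * x - s′) - (s - l * l * s′) ≡ (x * l) * (x * l) - s
          r = solve-∀

        b∣bc : + b ∣ + b * + c
        b∣bc = divides (+ c) (ℤP.*-comm (+ b) (+ c))
        c∣bc : + c ∣ + b * + c
        c∣bc = divides (+ b) refl

        downV : ∀ x y → V b c s N (x * + l , y * + l) → V b c s′ (n₀ * + M) (x , y)
        downV x y (e , d , d′) =
          cancelˡ (+ l) l≢0 (trans (flat-norm (+ c) (+ b) n₀ (+ l) x y (+ (l ℕ.* M)) l≢0 e)
            (trans (cong (n₀ *_) (ℤP.pos-* l M)) (r n₀ (+ l) (+ M))))
          , down x l⊥b b∣bc d , down y l⊥c c∣bc d′
          where
          r : ∀ n l m → n * (l * m) ≡ l * (n * m)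
          r = solve-∀

        upV : ∀ x y → V b c s′ (n₀ * + M) (x , y) → V b c s N (x * + l , y * + l)
        upV x y (e , d , d′) =
          trans (r (+ c) (+ b) x y (+ l)) (trans (cong (+ l * + l *_) e) (trans (r′ n₀ (+ l) (+ M))
            (cong (λ t → n₀ * (+ l * t)) (sym (ℤP.pos-* l M)))))
          , up x b∣bc d , up y c∣bc d′
          where
          r : ∀ c b x y l → c * ((x * l) * (x * l)) + b * ((y * l) * (y * l)) ≡ l * l * (c * (x * x) + b * (y * y))
          r = solve-∀
          r′ : ∀ n l m → l * l * (n * m) ≡ n * (l * (l * m))
          r′ = solve-∀

        to : ∀ {p} → V b c s N p × + l ∣ proj₁ p → ∃ λ q → V b c s′ (n₀ * + M) q × Scaled p q
        to {x , y} (v , d) = go d (l∣x⇒l∣y {s} l∣N x y (proj₁ v) d) v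
          where
          go : + l ∣ x → + l ∣ y → V b c s N (x , y) → ∃ λ q → V b c s′ (n₀ * + M) q × Scaled (x , y) q
          go (divides x′ refl) (divides y′ refl) v = (x′ , y′) , downV x′ y′ v , refl , refl

        from : ∀ {q} → V b c s′ (n₀ * + M) q → ∃ λ p → (V b c s N p × + l ∣ proj₁ p) × Scaled p q
        from {x , y} v = (x * + l , y * + l) , (upV x y v , divides x refl) , refl , refl

        inj : ∀ {p p′ q} → Scaled p q → Scaled p′ q → p ≡ p′
        inj (e , e′) (h , h′) = cong₂ _,_ (trans e (sym h)) (trans e′ (sym h′))

        cancelʳ : ∀ x y → x * + l ≡ y * + l → x ≡ y
        cancelʳ x y h = cancelˡ (+ l) l≢0 (trans (ℤP.*-comm (+ l) x) (trans h (ℤP.*-comm y (+ l))))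

        fun : ∀ {p q q′} → Scaled p q → Scaled p q′ → q ≡ q′
        fun {q = x , y} {x′ , y′} (e , e′) (h , h′) =
          cong₂ _,_ (cancelʳ x x′ (trans (sym e) h)) (cancelʳ y y′ (trans (sym e′) h′))

        a∣ : + a ∣ s - + l * + l * s′
        a∣ = ∣-trans a∣bc cg

        M″ : + (l ℕ.* (l ℕ.* M)) ≡ + l * (+ l * + M)
        M″ = trans (ℤP.pos-* l (l ℕ.* M)) (cong (+ l *_) (ℤP.pos-* l M))

        square-up : SquareClass a s′ M → SquareClass a s (l ℕ.* (l ℕ.* M))
        square-up (k , e , d) = l ℕ.* k , trans (r₁ l k) (cong (λ t → l ℕ.* (l ℕ.* t)) e) ,
          subst (λ t → + a ∣ t - s) (sym M″)
            (∣-by (∣m∣n⇒∣m-n (∣n⇒∣m*n (+ l * + l) d) a∣) (r₂ (+ l) (+ M) s s′))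
          where
          r₁ : ∀ l k → l ℕ.* k ℕ.* (l ℕ.* k) ≡ l ℕ.* (l ℕ.* (k ℕ.* k))
          r₁ = solveᴺ-∀
          r₂ : ∀ l m s s′ → l * l * (m - s′) - (s - l * l * s′) ≡ l * (l * m) - s
          r₂ = solve-∀

        square-down : SquareClass a s (l ℕ.* (l ℕ.* M)) → SquareClass a s′ M
        square-down (k , e , d) = proj₁ root , proj₂ root ,
          Cop-euclid (+ M - s′) (Cop-* (Cop-sym l⊥a) (Cop-sym l⊥a)) (∣-by
            (∣m∣n⇒∣m+n (subst (λ t → + a ∣ t - s) M″ d) a∣) (r₂ (+ l) (+ M) s s′))
          where
          r₂ : ∀ l m s s′ → l * (l * m) - s + (s - l * l * s′) ≡ l * l * (m - s′)
          r₂ = solve-∀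
          go : l ℕD.∣ k → ∃ λ k′ → k′ ℕ.* k′ ≡ M
          go (ℕD.divides q refl) = q , ℕP.*-cancelˡ-≡ _ M l (ℕP.*-cancelˡ-≡ _ _ l (trans (r q l) e))
            where
            r : ∀ q l → l ℕ.* (l ℕ.* (q ℕ.* q)) ≡ q ℕ.* l ℕ.* (q ℕ.* l)
            r = solveᴺ-∀
          root = go (∣⇒∣ᵤ (prime-sq (+ k) pr (subst (+ l ∣_) (ℤP.pos-* k k)
            (∣ᵤ⇒∣ {+ l} {+ (k ℕ.* k)} (ℕD.divides (l ℕ.* M) (trans e (ℕP.*-comm l (l ℕ.* M))))))))

    -- The solutions for `s` and l² M that are divisible by `l` are `l` times the solutions for `s′`
    -- and `M`. By `card-T` the two counts, for l² M and for M, add up to twice the size of a class;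
    -- that size is a multiple of 4, so the sum is a multiple of 8.
    step : ∀ {s s′} → Parity a b c s → + b * + c ∣ s - + l * + l * s′ → Parity a b c s′
    step {s} {s′} par cg M 0<M e′ = conclude (card eS ℕ.≟ 0)
      where
      0<lM : 0 ℕ.< l ℕ.* M
      0<lM = ℕP.<-≤-trans 0<M (ℕP.m≤n*m M l)
      eV = enumV b c s (N s s′ cg M)
      eF = restrict (λ p → + l ∣? proj₁ p) eV
      eS = restrict (λ p → ¬? (+ l ∣? proj₁ p)) eV
      eF≡e′ : card eF ≡ card e′
      eF≡e′ = card-≡ (Scaled s s′ cg M) eF e′ (λ {p} → to s s′ cg M {p}) (λ {q} → from s s′ cg M {q})
        (λ {p} {p′} {q} → inj s s′ cg M {p} {p′} {q}) (λ {p} {q} {q′} → fun s s′ cg M {p} {q} {q′})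
      old = at par (l ℕ.* (l ℕ.* M)) (cong (n₀ *_) (sym (ℤP.pos-* l (l ℕ.* M))))
        (ℕP.<-≤-trans 0<lM (ℕP.m≤n*m (l ℕ.* M) l)) eV
      Goal = (SquareClass a s′ M → 8 ℕD.∣ 4 ℕ.+ card e′) × (¬ SquareClass a s′ M → 8 ℕD.∣ card e′)
      flipped : 8 ℕD.∣ card eV ℕ.+ card eF → Goal
      flipped h = (λ sq → proj₁ fl (proj₁ old (square-up s s′ cg M sq))) ,
                  (λ ns → proj₂ fl (proj₂ old (ns ∘ square-down s s′ cg M)))
        where fl = flip-parity {card eV} {card e′} (subst (λ t → 8 ℕD.∣ card eV ℕ.+ t) eF≡e′ h)
      same : card eV ≡ card e′ → Goal
      same h = (λ sq → subst (λ t → 8 ℕD.∣ 4 ℕ.+ t) h (proj₁ old (square-up s s′ cg M sq))) ,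
               (λ ns → subst (8 ℕD.∣_) h (proj₂ old (ns ∘ square-down s s′ cg M)))
      conclude : Dec (card eS ≡ 0) → Goal
      -- Without a solution prime to `l` there is no reference point, but then the two counts are
      -- simply equal.
      conclude (yes z) = same (trans (card-split (λ p → + l ∣? proj₁ p) eV)
        (trans (cong (card eF ℕ.+_) z) (trans (ℕP.+-identityʳ (card eF)) eF≡e′)))
      conclude (no nz) = steep (card-inhabited eS nz)
        where
        steep : (∃ λ p → V b c s (N s s′ cg M) p × ¬ (+ l ∣ proj₁ p)) → Goal
        steep ((x₁ , y₁) , (e , _) , l∤x₁) =
          use (reference x₁ y₁ (subst (+ l ∣_) (sym e) (l∣N s s′ cg M)) l∤x₁)
          where
          use : Reference → Goal
          use (x₀ , y₀ , g , l⊥y₀ , eg , nzg , g≤) = flipped (subst (8 ℕD.∣_)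
            (sym (card-T {x₀} {y₀} l⊥y₀ (divides (+ g) eg) {s} (l∣N s s′ cg M) eV eT eF))
            (twice (card eT) (balanced {s} {x₀} {y₀} {g} par l⊥y₀ eg nzg g≤ (l ℕ.* M) 0<lM eT)))
            where
            eT : Enum (T b c l x₀ y₀ s (N s s′ cg M))
            eT = restrict (λ { (x , y) → + l ∣? x * y₀ - x₀ * y }) eV

-- A uniform bound for the primes, and the classes of all squares of units.

eventually : ∀ {D : Set} (Q : D → ℕ → Set) → (∀ d {m n} → m ℕ.≤ n → Q d m → Q d n) →
  (∀ d → ¬ ¬ ∃ (Q d)) → ∀ xs → ¬ ¬ ∃ λ n → ∀ {d} → d ∈ xs → Q d n
eventually Q mono h [] k = k (0 , λ ())
eventually Q mono h (x ∷ xs) k = eventually Q mono h xs λ { (n , rest) → h x λ { (m , qx) →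
  k (m ℕ.+ n , λ { (here refl) → mono x (ℕP.m≤m+n m n) qx
                 ; (there {xs = _} i) → mono _ (ℕP.m≤n+m n m) (rest i) }) } }

-- The shift t is the product of the primes up to X that do not divide r.
avoid-primes : ∀ r n X → (∀ {p} → Prime p → p ℕD.∣ r → p ℕD.∣ n → ⊥) →
  ∃ λ t → ∀ {p} → Prime p → p ℕ.≤ X → ¬ (p ℕD.∣ r ℕ.+ n ℕ.* t)
avoid-primes r n X cop = product ps , avoid
  where
  good? = λ i → prime? i ×-dec ¬? (i ℕD.∣? r)
  ps = filter good? (upTo (suc X))
  primes : All Prime ps
  primes = All.tabulate (λ i → proj₁ (proj₂ (∈-filter⁻ good? {xs = upTo (suc X)} i)))
  avoid : ∀ {p} → Prime p → p ℕ.≤ X → ¬ (p ℕD.∣ r ℕ.+ n ℕ.* product ps)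
  avoid {p} pr p≤X d with p ℕD.∣? r
  ... | no p∤r = p∤r (ℕD.∣m+n∣m⇒∣n (subst (p ℕD.∣_) (ℕP.+-comm r (n ℕ.* product ps)) d) (ℕD.∣n⇒∣m*n n (∈⇒∣product
    (∈-filter⁺ good? (∈-upTo⁺ (s≤s p≤X)) (pr , p∤r)))))
  ... | yes p∣r with euclidsLemma n (product ps) pr (ℕD.∣m+n∣m⇒∣n d p∣r)
  ...   | inj₁ p∣n = cop pr p∣r p∣n
  ...   | inj₂ p∣t = proj₂ (proj₂ (∈-filter⁻ good? {xs = upTo (suc X)}
    (factorisationHasAllPrimeFactors pr p∣t primes))) p∣r

∣-flip : ∀ {d x y} → d ∣ x - y → d ∣ y - x
∣-flip {d} {x} {y} (divides q e) = divides (- q) (lin (- 1ℤ) e (r x y q d))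
  where
  r : ∀ x y q d → y - x - - q * d ≡ - 1ℤ * (x - y - q * d)
  r = solve-∀

module Classes (a b c : ℕ) .{{nza : ℕ.NonZero a}} .{{nzb : ℕ.NonZero b}} .{{nzc : ℕ.NonZero c}}
  (harmonic : b ℕ.* c ≡ a ℕ.* (b ℕ.+ c)) where

  open Dilation a b c harmonic

  private
    n₀ = b ℕ.+ c
    K₀ = n₀ ℕ.* n₀ ℕ.* (b ℕ.* c)

    balanced? : ∀ d m → Dec (Balanced b c d m)
    balanced? (g , x₀ , y₀ , s) m = 4 ℕD.∣? card (enumE b c g x₀ y₀ s (+ m))

    detects-mono : ∀ d {m n} → m ℕ.≤ n → Detects b c m d → Detects b c n d
    detects-mono d h (inj₁ p) = inj₁ p
    detects-mono d h (inj₂ (m , 0<m , m< , bad)) = inj₂ (m , 0<m , ℕP.<-≤-trans m< h , bad)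

    -- Excluded middle for "balanced at every `m`", in its double-negated form: if no bound works,
    -- then no `m` can be a failure, so the first alternative holds with bound 0.
    detects-some : ∀ d → ¬ ¬ ∃ λ n → Detects b c n d
    detects-some d k = k (0 , inj₁ λ m 0<m → decidable-stable (balanced? d m)
      λ bad → k (suc m , inj₂ (m , 0<m , ℕP.n<1+n m , bad)))

    -- `K₀` is the modulus belonging to the largest admissible `g`, so these residues serve for all
    -- `g` at once.
    reduced : List ℤ
    reduced = map +_ (upTo K₀)

    data₀ : List Data
    data₀ = cartesianProduct (upTo (suc n₀)) (cartesianProduct reduced (cartesianProduct reduced reduced))

    modulus : ℕ → ℕ
    modulus g = g ℕ.* g ℕ.* (b ℕ.* c)

    modulus≢0 : ∀ g → .{{ℕ.NonZero g}} → ℕ.NonZero (modulus g)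
    modulus≢0 g = ℕP.m*n≢0 (g ℕ.* g) (b ℕ.* c) {{ℕP.m*n≢0 g g}} {{ℕP.m*n≢0 b c}}

    rem : ∀ g → ℕ.NonZero g → g ℕ.≤ n₀ → ∀ z → ∃ λ t → t ∈ reduced × + modulus g ∣ z - t
    rem g nzg g≤ z = let i , d = residue (modulus g) {{modulus≢0 g {{nzg}}}} z in
      + toℕ i , ∈-map⁺ +_ (∈-upTo⁺ (ℕP.<-≤-trans (toℕ<n i)
        (ℕP.*-monoˡ-≤ (b ℕ.* c) (ℕP.*-mono-≤ g≤ g≤)))) , d

    balanced-cong : ∀ g {x₀ x₁ y₀ y₁ s t} → + modulus g ∣ x₀ - x₁ → + modulus g ∣ y₀ - y₁ →
      + modulus g ∣ s - t → ∀ m → Balanced b c (g , x₁ , y₁ , t) m → Balanced b c (g , x₀ , y₀ , s) m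
    balanced-cong g {x₀} {x₁} {y₀} {y₁} {s} {t} hx hy hs m = subst (4 ℕD.∣_)
      (card-⇔ (enumE b c g x₁ y₁ t (+ m)) (enumE b c g x₀ y₀ s (+ m))
        (λ { {z , w} → E-cong b c g z w (+ m) {x₁} {x₀} {y₁} {y₀} {t} {s}
               (∣-flip {x = x₀} {x₁} hx) (∣-flip {x = y₀} {y₁} hy) (∣-flip {x = s} {t} hs) })
        (λ { {z , w} → E-cong b c g z w (+ m) {x₀} {x₁} {y₀} {y₁} {s} {t} hx hy hs }))

    AllDetected : ℕ → Set
    AllDetected n = ∀ g x₀ y₀ s → ℕ.NonZero g → g ℕ.≤ n₀ → Detects b c n (g , x₀ , y₀ , s)

    -- The sets `E` depend on their data only modulo g² b c with g ≤ b + c, which leaves finitely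
    -- many cases; their bounds can be added up.
    all-detected : ¬ ¬ ∃ AllDetected
    all-detected k = eventually (λ d n → Detects b c n d) detects-mono detects-some data₀ λ { (n , h) →
      k (n , λ g x₀ y₀ s nzg g≤ → transfer n g x₀ y₀ s
        (rem g nzg g≤ x₀) (rem g nzg g≤ y₀) (rem g nzg g≤ s) (s≤s g≤) h) }
      where
      transfer : ∀ n g x₀ y₀ s →
        (∃ λ t → t ∈ reduced × + modulus g ∣ x₀ - t) → (∃ λ t → t ∈ reduced × + modulus g ∣ y₀ - t) →
        (∃ λ t → t ∈ reduced × + modulus g ∣ s - t) → g ℕ.< suc n₀ →
        (∀ {d} → d ∈ data₀ → Detects b c n d) → Detects b c n (g , x₀ , y₀ , s)
      transfer n g x₀ y₀ s (x₁ , ix , hx) (y₁ , iy , hy) (t , it , ht) g< h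
        with h (∈-cartesianProduct⁺ (∈-upTo⁺ g<) (∈-cartesianProduct⁺ ix (∈-cartesianProduct⁺ iy it)))
      ... | inj₁ bal = inj₁ λ m 0<m → balanced-cong g {x₀} {x₁} {y₀} {y₁} {s} {t} hx hy ht m (bal m 0<m)
      ... | inj₂ (m , 0<m , m<n , bad) = inj₂ (m , 0<m , m<n , λ bal → bad
        (balanced-cong g {x₁} {x₀} {y₁} {y₀} {t} {s} (∣-flip {x = x₀} {x₁} hx) (∣-flip {x = y₀} {y₁} hy)
          (∣-flip {x = s} {t} ht) m bal))

    parity-cong : ∀ {s s′} → + b * + c ∣ s - s′ → Parity a b c s → Parity a b c s′
    parity-cong {s} {s′} h par M 0<M e =
      (λ { (k , ek , d) → subst (λ t → 8 ℕD.∣ 4 ℕ.+ t) same (proj₁ old (k , ek , move {u = s′} {s} (+ M) (∣-flip {x = s} {s′} (∣-trans a∣bc h)) d)) }) ,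
      (λ ns → subst (8 ℕD.∣_) same (proj₂ old λ { (k , ek , d) → ns (k , ek , move {u = s} {s′} (+ M) (∣-trans a∣bc h) d) }))
      where
      move : ∀ {d u v} z → d ∣ u - v → d ∣ z - u → d ∣ z - v
      move {d} {u} {v} z h h′ = ∣-by (∣m∣n⇒∣m+n h′ h) (r z u v)
        where
        r : ∀ z u v → z - u + (u - v) ≡ z - v
        r = solve-∀
      hb : + b ∣ s - s′
      hb = ∣-trans (divides (+ c) (ℤP.*-comm (+ b) (+ c))) h
      hc : + c ∣ s - s′
      hc = ∣-trans (divides (+ b) refl) h
      eV = enumV b c s ((+ b + + c) * + M)
      old = par M 0<M eV
      same : card eV ≡ card e
      same = card-⇔ eV e
        (λ { {x , y} (e , d , d′) → e , move {u = s} {s′} (x * x) hb d , move {u = s} {s′} (y * y) hc d′ })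
        (λ { {x , y} (e , d , d′) → e , move {u = s′} {s} (x * x) (∣-flip {x = s} {s′} hb) d , move {u = s′} {s} (y * y) (∣-flip {x = s} {s′} hc) d′ })

    -- The primes are removed one at a time; the intermediate class is the square of the product of
    -- the remaining primes times `s′`. The size condition on the primes contains everything that
    -- `Step` asks of `l`.
    chain : ∀ {n} → AllDetected n → ∀ ps → All (λ p → Prime p × n ℕ.+ (2 ℕ.+ (b ℕ.+ c)) ℕ.< p) ps →
      ∀ {s s′} → + b * + c ∣ s - + product ps * + product ps * s′ → Parity a b c s → Parity a b c s′
    chain det [] _ {s} {s′} cg = parity-cong (∣-by cg (cong (λ t → s - t) (ℤP.*-identityˡ s′)))
    chain {n} det (p ∷ ps) ((pr , big) All.∷ ok) {s} {s′} cg par =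
      chain det ps ok {+ product ps * + product ps * s′} {s′}
        (divides 0ℤ (ℤP.+-inverseʳ (+ product ps * + product ps * s′)))
        (Step.step pr (bound (ℕP.≤-trans (ℕP.m≤m+n 2 (b ℕ.+ c)) (ℕP.m≤n+m _ n)))
          (bound (ℕP.≤-trans (ℕP.m≤m+n b c) rest)) (bound (ℕP.≤-trans (ℕP.m≤n+m c b) rest)) (bound rest)
          (λ g x₀ y₀ s nzg g≤ → detects-mono (g , x₀ , y₀ , s) (ℕP.<⇒≤ (bound (ℕP.m≤m+n n _))) (det g x₀ y₀ s nzg g≤))
          {s} {+ product ps * + product ps * s′} par
          (∣-by cg (trans (cong (λ t → s - t * t * s′) (ℤP.pos-* p (product ps))) (r s (+ p) (+ product ps) s′))))
      where
      r : ∀ s p q s′ → s - p * q * (p * q) * s′ ≡ s - p * p * (q * q * s′)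
      r = solve-∀
      bound : ∀ {m} → m ℕ.≤ n ℕ.+ (2 ℕ.+ (b ℕ.+ c)) → m ℕ.< p
      bound h = ℕP.≤-<-trans h big
      rest : b ℕ.+ c ℕ.≤ n ℕ.+ (2 ℕ.+ (b ℕ.+ c))
      rest = ℕP.≤-trans (ℕP.m≤n+m (b ℕ.+ c) 2) (ℕP.m≤n+m _ n)

    instance
      nzbc : ℕ.NonZero (b ℕ.* c)
      nzbc = ℕP.m*n≢0 b c

    -- A residue that inverts `ρ` modulo bc is prime to bc, so it can be shifted by a multiple of bc
    -- to a number without prime factors up to `X`. Its prime factorisation is the list: a product
    -- of large primes does the work that a single prime in a progression would do.
    rough-inverse : ∀ {ρ} → Cop ρ (+ b * + c) → ∀ X → 2 ℕ.≤ X →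
      ∃ λ ps → All (λ p → Prime p × X ℕ.< p) ps × + b * + c ∣ 1ℤ - + product ps * + product ps * (ρ * ρ)
    rough-inverse {ρ} (u , v , e) X 2≤X = fin (residue (b ℕ.* c) u)
      where
      Goal = ∃ λ ps → All (λ p → Prime p × X ℕ.< p) ps × + b * + c ∣ 1ℤ - + product ps * + product ps * (ρ * ρ)
      fin : (∃ λ (i : Fin (b ℕ.* c)) → + (b ℕ.* c) ∣ u - + toℕ i) → Goal
      fin (i , d) = found (avoid-primes r (b ℕ.* c) X cop)
        where
        r = toℕ i
        d′ : + b * + c ∣ u - + r
        d′ = subst (_∣ u - + r) (ℤP.pos-* b c) d
        unit : + b * + c ∣ 1ℤ - + r * ρ
        unit = ∣-by (∣m∣n⇒∣m+n (∣n⇒∣m*n ρ d′) (∣n⇒∣m*n v ∣-refl))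
          (lin 1ℤ e (h u v ρ (+ r) (+ b * + c)))
          where
          h : ∀ u v ρ r n → ρ * (u - r) + v * n - (1ℤ - r * ρ) ≡ 1ℤ * (u * ρ + v * n - 1ℤ)
          h = solve-∀
        cop : ∀ {p} → Prime p → p ℕD.∣ r → p ℕD.∣ b ℕ.* c → ⊥
        cop {p} pr p∣r p∣bc = ¬prime[1] (subst Prime (∣1⇒ (∣-by
          (∣m∣n⇒∣m+n (∣-trans (subst (+ p ∣_) (ℤP.pos-* b c) (∣ᵤ⇒∣ {+ p} {+ (b ℕ.* c)} p∣bc)) unit)
            (∣n⇒∣m*n ρ (∣ᵤ⇒∣ {+ p} {+ r} p∣r))) (h ρ (+ r)))) pr)
          where
          h : ∀ ρ r → 1ℤ - r * ρ + ρ * r ≡ 1ℤ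
          h = solve-∀
        found : (∃ λ t → ∀ {p} → Prime p → p ℕ.≤ X → ¬ (p ℕD.∣ r ℕ.+ b ℕ.* c ℕ.* t)) → Goal
        found (t , avoid) = factors , large , cong-unit
          where
          m = r ℕ.+ b ℕ.* c ℕ.* t
          -- Zero would be divisible by the prime 2, which 2 ≤ X excludes.
          m≢0 : ¬ m ≡ 0
          m≢0 h = avoid prime[2] 2≤X (subst (2 ℕD.∣_) (sym h) (ℕD.divides 0 refl))
          open PrimeFactorisation (factorise m {{ℕ.≢-nonZero m≢0}})
          large : All (λ p → Prime p × X ℕ.< p) factors
          large = All.tabulate λ {p} p∈ → All.lookup factorsPrime p∈ ,
            ℕP.≰⇒> (λ p≤X → avoid (All.lookup factorsPrime p∈) p≤X
              (subst (p ℕD.∣_) (sym isFactorisation) (∈⇒∣product p∈)))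
          m-int : + product factors ≡ + r + + b * + c * + t
          m-int = trans (cong +_ (sym isFactorisation)) (cong (λ z → + r + z)
            (trans (ℤP.pos-* (b ℕ.* c) t) (cong (_* + t) (ℤP.pos-* b c))))
          cong-unit : + b * + c ∣ 1ℤ - + product factors * + product factors * (ρ * ρ)
          cong-unit = subst (λ z → + b * + c ∣ 1ℤ - z * z * (ρ * ρ)) (sym m-int)
            (∣-by (∣n⇒∣m*n (1ℤ + (+ r + + b * + c * + t) * ρ) (∣m∣n⇒∣m-n unit (∣n⇒∣m*n (+ t * ρ) ∣-refl)))
              (h (+ r) (+ b * + c) (+ t) ρ))
            where
            h : ∀ r n t ρ → (1ℤ + (r + n * t) * ρ) * (1ℤ - r * ρ - t * ρ * n) ≡ 1ℤ - (r + n * t) * (r + n * t) * (ρ * ρ)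
            h = solve-∀

  parity-class : Parity a b c 1ℤ → ∀ {ρ} → Cop ρ (+ b * + c) → ¬ ¬ Parity a b c (ρ * ρ)
  parity-class par {ρ} cop k = all-detected λ { (n , det) →
    let ps , ok , cg = rough-inverse {ρ} cop (n ℕ.+ (2 ℕ.+ (b ℕ.+ c)))
                         (ℕP.≤-trans (ℕP.m≤m+n 2 (b ℕ.+ c)) (ℕP.m≤n+m (2 ℕ.+ (b ℕ.+ c)) n))
    in k (chain det ps ok {1ℤ} {ρ * ρ} cg par) }

  -- The number of solutions is 4 modulo 8, hence not zero. Divisibility by 8 is decidable, so the
  -- double negation ends here.
  represented : Parity a b c 1ℤ → ∀ {ρ} → Cop ρ (+ b * + c) → ∀ k → 0 ℕ.< k → + a ∣ + k * + k - ρ * ρ →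
    ∃₂ λ x y → V b c (ρ * ρ) ((+ b + + c) * (+ k * + k)) (x , y)
  represented par {ρ} cop k 0<k d = out (card-inhabited e (λ z → 8∤4 (subst (λ t → 8 ℕD.∣ 4 ℕ.+ t) z eight)))
    where
    e = enumV b c (ρ * ρ) ((+ b + + c) * (+ k * + k))
    eight : 8 ℕD.∣ 4 ℕ.+ card e
    eight = decidable-stable (8 ℕD.∣? (4 ℕ.+ card e)) λ no → parity-class par {ρ} cop λ p → no
      (proj₁ (at p (k ℕ.* k) (cong ((+ b + + c) *_) (sym (ℤP.pos-* k k))) (ℕP.*-mono-< 0<k 0<k) e)
        (k , refl , subst (λ t → + a ∣ t - ρ * ρ) (sym (ℤP.pos-* k k)) d))
    out : (∃ λ p → V b c (ρ * ρ) ((+ b + + c) * (+ k * + k)) p) → _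
    out ((x , y) , v) = x , y , v

-- The equation bc = a (b + c).

-- Descent: an even residue e with m ∣ e² + 1 has a smaller cofactor, again 3 modulo 4.
no-root : ∀ m → + 4 ∣ + m - + 3 → ∀ z → ¬ (+ m ∣ z * z + 1ℤ)
no-root = <-rec _ λ m rec m≡3 z d → body m (λ {k} → rec {k}) m≡3 z d
  where
  Claim : ℕ → Set
  Claim m = + 4 ∣ + m - + 3 → ∀ z → ¬ (+ m ∣ z * z + 1ℤ)
  1<m : ∀ m → + 4 ∣ + m - + 3 → 1 ℕ.< m
  1<m 0 h = ⊥-elim (ℕP.<⇒≱ (s≤s (s≤s (s≤s (s≤s z≤n)))) (ℕD.∣⇒≤ (∣⇒∣ᵤ h)))
  1<m 1 h = ⊥-elim (ℕP.<⇒≱ (s≤s (s≤s (s≤s z≤n))) (ℕD.∣⇒≤ (∣⇒∣ᵤ h)))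
  1<m (suc (suc m)) h = s≤s (s≤s z≤n)
  even : ∀ m → (∀ {k} → k ℕ.< m → Claim k) → + 4 ∣ + m - + 3 → ∀ e → e ℕ.< m → + 2 ∣ + e → ¬ (+ m ∣ + e * + e + 1ℤ)
  even m rec m≡3 e e<m 2∣e d = go (∣⇒∣ᵤ (subst (+ m ∣_) (cong (_+ 1ℤ) (sym (ℤP.pos-* e e))) d))
    where
    go : m ℕD.∣ e ℕ.* e ℕ.+ 1 → ⊥
    go (ℕD.divides k eq) = rec k<m k≡3 (+ e) (divides (+ m) eq′)
      where
      eq′ : + e * + e + 1ℤ ≡ + m * + k
      eq′ = trans (cong (_+ 1ℤ) (sym (ℤP.pos-* e e))) (trans (cong +_ (trans eq (ℕP.*-comm k m))) (ℤP.pos-* m k))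
      four : ∀ x y → + 2 ∣ x → + 4 ∣ x * x + 1ℤ - 1ℤ
      four = decide 4 (dv 2 𝕩 ⇒ dv 4 (𝕩 ⊗ 𝕩 ⊕ κ 1ℤ ⊖ κ 1ℤ))
      cofactor : ∀ x y → + 4 ∣ x - + 3 → + 4 ∣ x * y - 1ℤ → + 4 ∣ y - + 3
      cofactor = decide 4 (dv 4 (𝕩 ⊖ κ (+ 3)) ⇒ dv 4 (𝕩 ⊗ 𝕪 ⊖ κ 1ℤ) ⇒ dv 4 (𝕪 ⊖ κ (+ 3)))
      k≡3 : + 4 ∣ + k - + 3
      k≡3 = cofactor (+ m) (+ k) m≡3 (subst (λ t → + 4 ∣ t - 1ℤ) eq′ (four (+ e) 0ℤ 2∣e))
      k<m : k ℕ.< m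
      k<m = ℕP.*-cancelʳ-< m k m (ℕP.≤-<-trans (ℕP.≤-reflexive (sym eq)) (bound e m e<m (1<m m m≡3)))
        where
        bound : ∀ e m → e ℕ.< m → 1 ℕ.< m → e ℕ.* e ℕ.+ 1 ℕ.< m ℕ.* m
        bound zero m _ 1<m = ℕP.<-≤-trans 1<m (ℕP.m≤m*n m m {{ℕ.>-nonZero (ℕP.<-trans (s≤s z≤n) 1<m)}})
        bound (suc e) m e<m _ = ℕP.<-≤-trans (subst (suc e ℕ.* suc e ℕ.+ 1 ℕ.<_) (sym (r e))
          (ℕP.+-monoʳ-< (suc e ℕ.* suc e) (s≤s (s≤s z≤n)))) (ℕP.*-mono-≤ e<m e<m)
          where
          r : ∀ e → suc (suc e) ℕ.* suc (suc e) ≡ suc e ℕ.* suc e ℕ.+ (3 ℕ.+ 2 ℕ.* e)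
          r = solveᴺ-∀
  body : ∀ m → (∀ {k} → k ℕ.< m → Claim k) → Claim m
  body m rec m≡3 z d = go (residue m {{ℕ.>-nonZero (ℕP.<-trans (s≤s z≤n) (1<m m m≡3))}} z)
    where
    go : (∃ λ (i : Fin m) → + m ∣ z - + toℕ i) → ⊥
    go (i , h) = pick (+ 2 ∣? + r)
      where
      r = toℕ i
      ring₁ : ∀ z r → z * z + 1ℤ - (z + r) * (z - r) ≡ r * r + 1ℤ
      ring₁ = solve-∀
      ring₂ : ∀ m r → r * r + 1ℤ + m * (m - + 2 * r) ≡ (m - r) * (m - r) + 1ℤ
      ring₂ = solve-∀
      dr : + m ∣ + r * + r + 1ℤ
      dr = ∣-by (∣m∣n⇒∣m-n d (∣n⇒∣m*n (z + + r) h)) (ring₁ z (+ r))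
      other : ∀ x y → + 4 ∣ x - + 3 → ¬ (+ 2 ∣ y) → + 2 ∣ x - y
      other = decide 4 (dv 4 (𝕩 ⊖ κ (+ 3)) ⇒ ndv 2 𝕪 ⇒ dv 2 (𝕩 ⊖ 𝕪))
      pick : Dec (+ 2 ∣ + r) → ⊥
      pick (yes p) = even m rec m≡3 r (toℕ<n i) p dr
      -- As `m` is odd, m - r is even when `r` is odd, and it has the same square modulo `m`.
      pick (no p) = even m rec m≡3 (m ∸ r) lt (subst (+ 2 ∣_) sub (other (+ m) (+ r) m≡3 p))
        (subst (λ t → + m ∣ t * t + 1ℤ) sub (∣-by (∣m∣n⇒∣m+n dr (∣m⇒∣m*n {+ m} {+ m} (+ m - + 2 * + r) ∣-refl)) (ring₂ (+ m) (+ r))))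
        where
        sub : + m - + r ≡ + (m ∸ r)
        sub = trans (ℤP.m-n≡m⊖n m r) (ℤP.⊖-≥ (ℕP.<⇒≤ (toℕ<n i)))
        lt : m ∸ r ℕ.< m
        lt = ℕP.∸-monoʳ-< {m} {r} {0} (ℕP.n≢0⇒n>0 λ h → p (divides 0ℤ (cong +_ h))) (ℕP.<⇒≤ (toℕ<n i))

prime-3-mod-4 : ∀ ps → All Prime ps → + 4 ∣ + product ps - + 3 → ∃ λ p → Prime p × p ℕD.∣ product ps × + 4 ∣ + p - + 3
prime-3-mod-4 [] _ h = ⊥-elim (ℕP.<⇒≱ (s≤s (s≤s (s≤s z≤n))) (ℕD.∣⇒≤ (∣⇒∣ᵤ h)))
prime-3-mod-4 (p ∷ ps) (pr All.∷ prs) h = [ (λ h₁ → p , pr , ℕD.m∣m*n (product ps) , h₁) , lift ]′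
  (factor (+ p) (+ product ps) (subst (λ t → + 4 ∣ t - + 3) (ℤP.pos-* p (product ps)) h))
  where
  factor : ∀ x y → + 4 ∣ x * y - + 3 → + 4 ∣ x - + 3 ⊎ + 4 ∣ y - + 3
  factor = decide 4 (dv 4 (𝕩 ⊗ 𝕪 ⊖ κ (+ 3)) ⇒ dv 4 (𝕩 ⊖ κ (+ 3)) ∨ᶠ dv 4 (𝕪 ⊖ κ (+ 3)))
  lift : + 4 ∣ + product ps - + 3 → ∃ λ q → Prime q × q ℕD.∣ p ℕ.* product ps × + 4 ∣ + q - + 3
  lift h₂ = let q , prq , d , q≡3 = prime-3-mod-4 ps prs h₂ in q , prq , ℕD.∣n⇒∣m*n p d , q≡3

least : ∀ {Q : ℕ → Set} → Decidable Q → ∀ i → Q i → ∃ λ j → Q j × ∀ {k} → Q k → j ℕ.≤ k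
least {Q} Q? = <-rec _ λ i rec q → search i rec q
  where
  search : ∀ i → (∀ {k} → k ℕ.< i → Q k → ∃ λ j → Q j × ∀ {k} → Q k → j ℕ.≤ k) → Q i → ∃ λ j → Q j × ∀ {k} → Q k → j ℕ.≤ k
  search i rec q with ℕP.anyUpTo? Q? i
  ... | yes (k , k<i , qk) = rec k<i qk
  ... | no none = i , q , λ {k} qk → ℕP.≮⇒≥ λ k<i → none (k , k<i , qk)

f-square : ∀ {a n} → IsSquare (a ℕ.* n ℕ.+ 1) → f a n ≡ 1
f-square {a} {n} h with isSquare? (a ℕ.* n ℕ.+ 1)
... | yes _ = refl
... | no no-h = ⊥-elim (no-h h)

f-nonsquare : ∀ {a n} → ¬ IsSquare (a ℕ.* n ℕ.+ 1) → f a n ≡ 0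
f-nonsquare {a} {n} h with isSquare? (a ℕ.* n ℕ.+ 1)
... | yes s = ⊥-elim (h s)
... | no _ = refl

odd-f : ∀ {a n} → f a n % 2 ≡ 1 → IsSquare (a ℕ.* n ℕ.+ 1)
odd-f {a} {n} h with isSquare? (a ℕ.* n ℕ.+ 1)
... | yes s = s
odd-f {a} {n} () | no _

square-unique : ∀ {k l} → k ℕ.* k ≡ l ℕ.* l → k ≡ l
square-unique {k} {l} e = go (ℕP.<-cmp k l)
  where
  open import Relation.Binary.Definitions using (tri<; tri≈; tri>; Tri)
  go : Tri (k ℕ.< l) (k ≡ l) (l ℕ.< k) → k ≡ l
  go (tri≈ _ h _) = h
  go (tri< h _ _) = ⊥-elim (ℕP.<⇒≢ (ℕP.*-mono-< h h) e)
  go (tri> _ _ h) = ⊥-elim (ℕP.<⇒≢ (ℕP.*-mono-< h h) (sym e))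

module Harmonic (a b c : ℕ) .{{nza : ℕ.NonZero a}} .{{nzb : ℕ.NonZero b}} .{{nzc : ℕ.NonZero c}}
  (H : f a ≡₂ (f b ⊛ f c)) where

  private
    norm-split : ∀ {n} i j k l → i ℕ.+ j ≡ n → k ℕ.* k ≡ b ℕ.* i ℕ.+ 1 → l ℕ.* l ≡ c ℕ.* j ℕ.+ 1 →
      + c * (+ k * + k) + + b * (+ l * + l) ≡ norm₁ b c n
    norm-split i j k l refl ek el = trans
      (cong₂ (λ u v → + c * u + + b * v) (lift b i k ek) (lift c j l el)) (r (+ b) (+ c) (+ i) (+ j))
      where
      lift : ∀ b i k → k ℕ.* k ≡ b ℕ.* i ℕ.+ 1 → + k * + k ≡ + b * + i + 1ℤ
      lift b i k e = trans (sym (ℤP.pos-* k k)) (trans (cong +_ e) (cast b i))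
      r : ∀ b c i j → c * (b * i + 1ℤ) + b * (c * j + 1ℤ) ≡ b * c * (i + j) + (b + c)
      r = solve-∀

  -- The congruence 4bcD² ≡ 1 (mod p) has two effects: `p` divides none of 2, b, c, D, and bc is a
  -- square modulo `p`. Since -1 is not a square, a norm divisible by `p` comes from coordinates
  -- divisible by `p`.
  module Obstruction {p : ℕ} (pr : Prime p) (p≡3 : + 4 ∣ + p - + 3)
    (D : ℤ) (D≡ : D ≡ + b * + c - + a * (+ b + + c)) (p∣ : + p ∣ + 4 * (+ b * + c) * (D * D) - 1ℤ) where

    private
      p∤1 : ∀ {z} → + p ∣ z * (+ 4 * (+ b * + c) * (D * D)) → + p ∣ z
      p∤1 {z} h = ∣-by (∣m∣n⇒∣m-n h (∣n⇒∣m*n z p∣)) (r z (+ 4 * (+ b * + c) * (D * D)))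
        where
        r : ∀ z t → z * t - z * (t - 1ℤ) ≡ z
        r = solve-∀

      p-unit : ∀ {z} → + p ∣ z → (∃ λ q → q * z ≡ + 4 * (+ b * + c) * (D * D)) → ⊥
      p-unit {z} h (q , e) = ¬prime[1] (subst Prime (∣1⇒ (p∤1 {1ℤ} (subst (+ p ∣_)
        (trans e (sym (ℤP.*-identityˡ _))) (∣n⇒∣m*n q h)))) pr)

      p⊥b : Cop (+ p) (+ b)
      p⊥b = prime-Cop pr λ h → p-unit h (+ 4 * + c * (D * D) , r (+ b) (+ c) D)
        where
        r : ∀ b c D → + 4 * c * (D * D) * b ≡ + 4 * (b * c) * (D * D)
        r = solve-∀
      p⊥c : Cop (+ p) (+ c)
      p⊥c = prime-Cop pr λ h → p-unit h (+ 4 * + b * (D * D) , r (+ b) (+ c) D)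
        where
        r : ∀ b c D → + 4 * b * (D * D) * c ≡ + 4 * (b * c) * (D * D)
        r = solve-∀
      p∤D : ¬ (+ p ∣ D)
      p∤D h = p-unit h (+ 4 * (+ b * + c) * D , r (+ b) (+ c) D)
        where
        r : ∀ b c D → + 4 * (b * c) * D * D ≡ + 4 * (b * c) * (D * D)
        r = solve-∀
      p∤2 : ¬ (+ p ∣ + 2)
      p∤2 h = p-unit h (+ 2 * (+ b * + c) * (D * D) , r (+ b) (+ c) D)
        where
        r : ∀ b c D → + 2 * (b * c) * (D * D) * + 2 ≡ + 4 * (b * c) * (D * D)
        r = solve-∀

      -- Modulo p the form is (2Dcx)² + y² up to a unit, hence anisotropic.
      p∣y : ∀ x y → + p ∣ + c * (x * x) + + b * (y * y) → + p ∣ y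
      p∣y x y h = decidable-stable (+ p ∣? y) λ p∤y → go (prime-Cop pr p∤y)
        where
        go : Cop (+ p) y → ⊥
        go (u , v , e) = no-root p p≡3 (+ 2 * D * + c * x * v) (∣-by
          (∣m∣n⇒∣m-n (∣m∣n⇒∣m-n (∣n⇒∣m*n (v * v * + 4 * (D * D) * + c) h) (∣n⇒∣m*n (v * v * (y * y)) p∣))
            (∣n⇒∣m*n (- (u * (1ℤ + v * y))) ∣-refl))
          (lin (1ℤ + v * y) e (r (+ b) (+ c) D x y u v (+ p))))
          where
          r : ∀ b c D x y u v p →
            v * v * + 4 * (D * D) * c * (c * (x * x) + b * (y * y)) - v * v * (y * y) * (+ 4 * (b * c) * (D * D) - 1ℤ)
              - - (u * (1ℤ + v * y)) * p - (+ 2 * D * c * x * v * (+ 2 * D * c * x * v) + 1ℤ)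
            ≡ (1ℤ + v * y) * (u * p + v * y - 1ℤ)
          r = solve-∀

      p∣x : ∀ x y → + p ∣ + c * (x * x) + + b * (y * y) → + p ∣ x
      p∣x x y h = prime-sq x pr (Cop-euclid (x * x) p⊥c (∣-by
        (∣m∣n⇒∣m-n h (∣n⇒∣m*n (+ b * y) (p∣y x y h))) (r (+ b) (+ c) x y)))
        where
        r : ∀ b c x y → c * (x * x) + b * (y * y) - b * y * y ≡ c * (x * x)
        r = solve-∀

      Low : ℕ → ℕ → Set
      Low d i = ∃ λ k → k ℕ.* k ≡ d ℕ.* i ℕ.+ 1 × + p ∣ + k

      low? : ∀ d → Decidable (Low d)
      low? d i = check (isSquare? (d ℕ.* i ℕ.+ 1))
        where
        check : Dec (IsSquare (d ℕ.* i ℕ.+ 1)) → Dec (Low d i)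
        check (no h) = no λ { (k , e , _) → h (k , e) }
        check (yes (k , e)) = root (+ p ∣? + k)
          where
          root : Dec (+ p ∣ + k) → Dec (Low d i)
          root (yes h) = yes (k , e , h)
          root (no h) = no λ { (l , e′ , h′) → h (subst (λ t → + p ∣ + t) (square-unique {l} {k} (trans e′ (sym e))) h′) }

      -- With u p ≡ 1 (mod d), the number |u| p is a multiple of `p` and a square root of 1 modulo
      -- `d`. The summand d p only makes it positive.
      low : ∀ d .{{_ : ℕ.NonZero d}} → Cop (+ p) (+ d) → ∃ (Low d)
      low d (u , v , e) = found (pos-square d {+ k} (+<+ 0<k) d∣)
        where
        k = abs u ℕ.* p ℕ.+ d ℕ.* p
        0<k : 0 ℕ.< k
        0<k = ℕP.<-≤-trans (ℕP.*-mono-< (ℕ.>-nonZero⁻¹ d) (ℕ.>-nonZero⁻¹ p {{prime⇒nonZero pr}})) (ℕP.m≤n+m (d ℕ.* p) (abs u ℕ.* p))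
        k≡ : + k ≡ + abs u * + p + + d * + p
        k≡ = cong₂ _+_ (ℤP.pos-* (abs u) p) (ℤP.pos-* d p)
        d∣ : + d ∣ + k * + k - 1ℤ
        d∣ = subst (λ t → + d ∣ t * t - 1ℤ) (sym k≡) (divides
          (+ p * + p * (+ 2 * + abs u + + d) - v * (u * + p + 1ℤ))
          (lin₂ (u * + p + 1ℤ) (+ p * + p) e (trans (sq-abs′ (+ abs u) (abs u) refl) (sym (sq-abs u)))
            (r u v (+ p) (+ d) (+ abs u))))
          where
          sq-abs′ : ∀ z n → z ≡ + n → z * z ≡ + (n ℕ.* n)
          sq-abs′ _ n refl = sym (ℤP.pos-* n n)
          r : ∀ u v p d w → (w * p + d * p) * (w * p + d * p) - 1ℤ - (p * p * (+ 2 * w + d) - v * (u * p + 1ℤ)) * d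
            ≡ (u * p + 1ℤ) * (u * p + v * d - 1ℤ) + p * p * (w * w - u * u)
          r = solve-∀
        found : (∃ λ i → + k * + k ≡ + (d ℕ.* i ℕ.+ 1)) → ∃ (Low d)
        found (i , ek) = i , k , ℤP.+-injective (trans (ℤP.pos-* k k) ek) ,
          subst (+ p ∣_) (sym k≡) (∣m∣n⇒∣m+n (∣n⇒∣m*n (+ abs u) ∣-refl) (∣n⇒∣m*n (+ d) ∣-refl))

      minimal-b = let i , h = low b p⊥b in least (low? b) i h
      minimal-c = let j , h = low c p⊥c in least (low? c) j h

      i₀ = proj₁ minimal-b
      j₀ = proj₁ minimal-c
      n₀ = i₀ ℕ.+ j₀

      p²∣norm : ∀ x y → + p ∣ + c * (x * x) + + b * (y * y) → + p * + p ∣ + c * (x * x) + + b * (y * y)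
      p²∣norm x y h = go (p∣x x y h) (p∣y x y h)
        where
        go : + p ∣ x → + p ∣ y → + p * + p ∣ + c * (x * x) + + b * (y * y)
        go (divides u refl) (divides v refl) = divides (+ c * (u * u) + + b * (v * v)) (r (+ b) (+ c) u v (+ p))
          where
          r : ∀ b c u v p → c * (u * p * (u * p)) + b * (v * p * (v * p)) ≡ (c * (u * u) + b * (v * v)) * (p * p)
          r = solve-∀

      norm₀ : + p ∣ norm₁ b c n₀
      norm₀ = let _ , (k , ek , pk) , _ = minimal-b ; _ , (l , el , pl) , _ = minimal-c in
        subst (+ p ∣_) (norm-split i₀ j₀ k l refl ek el)
          (∣m∣n⇒∣m+n (∣n⇒∣m*n (+ c) (∣n⇒∣m*n (+ k) pk)) (∣n⇒∣m*n (+ b) (∣n⇒∣m*n (+ l) pl)))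

      -- The norm at `n₀` is divisible by `p`, so every representation has both roots divisible by
      -- `p`. Its exponents are then at least `i₀` and `j₀`, while their sum is i₀ + j₀.
      coefficient : (f b ⊛ f c) n₀ ≡ 1
      coefficient = trans (sym (card-enumSplit b c n₀)) (card-one (enumSplit b c n₀) i₀
        (ℕP.m≤m+n i₀ j₀ , here₀) only)
        where
        here₀ : Split b c n₀ i₀
        here₀ = let _ , (k , ek , _) , _ = minimal-b ; _ , (l , el , _) , _ = minimal-c in
          (k , ek) , (l , trans el (cong (λ t → c ℕ.* t ℕ.+ 1) (sym (ℕP.m+n∸m≡n i₀ j₀))))
        only : ∀ {i} → i ℕ.≤ n₀ × Split b c n₀ i → i ≡ i₀
        only {i} (i≤ , (k , ek) , (l , el)) = ℕP.≤-antisym upper lower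
          where
          h : + p ∣ + c * (+ k * + k) + + b * (+ l * + l)
          h = subst (+ p ∣_) (sym (norm-split i (n₀ ∸ i) k l (ℕP.m+[n∸m]≡n i≤) ek el)) norm₀
          lower : i₀ ℕ.≤ i
          lower = proj₂ (proj₂ minimal-b) (k , ek , p∣x (+ k) (+ l) h)
          j₀≤ : j₀ ℕ.≤ n₀ ∸ i
          j₀≤ = proj₂ (proj₂ minimal-c) (l , el , p∣y (+ k) (+ l) h)
          upper : i ℕ.≤ i₀
          upper = ℕP.+-cancelʳ-≤ j₀ i i₀ (ℕP.≤-trans (ℕP.+-monoʳ-≤ i j₀≤) (ℕP.≤-reflexive (ℕP.m+[n∸m]≡n i≤)))

      -- At a square the coefficient of the product is odd, so the norm is represented; by
      -- anisotropy a factor `p` of a represented norm occurs twice.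
      p²∣ : ∀ n → IsSquare (a ℕ.* n ℕ.+ 1) → + p ∣ norm₁ b c n → + p * + p ∣ norm₁ b c n
      p²∣ n sq h = use (card-inhabited (enumSplit b c n) nonzero)
        where
        nonzero : ¬ card (enumSplit b c n) ≡ 0
        nonzero z = 1≢0 (trans (sym (cong (_% 2) (f-square {a} {n} sq))) (trans (H n)
          (cong (_% 2) (trans (sym (card-enumSplit b c n)) z))))
          where
          1≢0 : ¬ 1 ≡ 0
          1≢0 ()
        use : (∃ λ i → i ℕ.≤ n × Split b c n i) → + p * + p ∣ norm₁ b c n
        use (i , i≤ , (k , ek) , (l , el)) = subst (+ p * + p ∣_) eq (p²∣norm (+ k) (+ l) (subst (+ p ∣_) (sym eq) h))
          where eq = norm-split i (n ∸ i) k l (ℕP.m+[n∸m]≡n i≤) ek el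

    contradictory : ⊥
    contradictory = go (odd-f {a} {n₀} (trans (H n₀) (cong (_% 2) coefficient)))
      where
      go : IsSquare (a ℕ.* n₀ ℕ.+ 1) → ⊥
      -- With k² = a n₀ + 1, the combination bc k² - a (bc n₀ + b + c) equals bc - a (b + c) = D,
      -- and `p` divides both of its terms.
      go (k , ek) = p∤D (subst (+ p ∣_) (sym D≡) (∣-by
        (∣m∣n⇒∣m-n (∣n⇒∣m*n (+ b * + c) (∣n⇒∣m*n (+ k) p∣k)) (∣n⇒∣m*n (+ a) norm₀))
        (fin (+ a) (+ b) (+ c) (+ n₀) (+ k) (trans (sym (ℤP.pos-* k k)) (trans (cong +_ ek) (cast a n₀))))))
        where
        fin : ∀ a b c n k → k * k ≡ a * n + 1ℤ → b * c * (k * k) - a * (b * c * n + (b + c)) ≡ b * c - a * (b + c)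
        fin a b c n k e = lin (b * c) e (solve (a ∷ b ∷ c ∷ n ∷ k ∷ []))
        -- Chosen so that a n₁ + 1 = (k + a p)². The norm grows by p bc (2k + a p); since p² divides
        -- both norms, `p` divides 2k and therefore k.
        n₁ = n₀ ℕ.+ p ℕ.* (2 ℕ.* k ℕ.+ a ℕ.* p)
        square₁ : IsSquare (a ℕ.* n₁ ℕ.+ 1)
        square₁ = k ℕ.+ a ℕ.* p , trans (r₁ k a p) (trans (cong (ℕ._+ a ℕ.* (p ℕ.* (2 ℕ.* k ℕ.+ a ℕ.* p))) ek) (r₂ a n₀ (p ℕ.* (2 ℕ.* k ℕ.+ a ℕ.* p))))
          where
          r₁ : ∀ k a p → (k ℕ.+ a ℕ.* p) ℕ.* (k ℕ.+ a ℕ.* p) ≡ k ℕ.* k ℕ.+ a ℕ.* (p ℕ.* (2 ℕ.* k ℕ.+ a ℕ.* p))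
          r₁ = solveᴺ-∀
          r₂ : ∀ a n t → a ℕ.* n ℕ.+ 1 ℕ.+ a ℕ.* t ≡ a ℕ.* (n ℕ.+ t) ℕ.+ 1
          r₂ = solveᴺ-∀
        n₁≡ : + n₁ ≡ + n₀ + + p * (+ 2 * + k + + a * + p)
        n₁≡ = cong (λ t → + n₀ + t) (trans (ℤP.pos-* p (2 ℕ.* k ℕ.+ a ℕ.* p))
          (cong (+ p *_) (cong₂ _+_ (ℤP.pos-* 2 k) (ℤP.pos-* a p))))
        norm-shift : norm₁ b c n₁ ≡ norm₁ b c n₀ + + p * (+ b * + c * (+ 2 * + k + + a * + p))
        norm-shift = trans (cong (λ t → + b * + c * t + (+ b + + c)) n₁≡) (r (+ a) (+ b) (+ c) (+ n₀) (+ k) (+ p))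
          where
          r : ∀ a b c n k p → b * c * (n + p * (+ 2 * k + a * p)) + (b + c)
            ≡ b * c * n + (b + c) + p * (b * c * (+ 2 * k + a * p))
          r = solve-∀
        p²∣diff : + p * + p ∣ + p * (+ b * + c * (+ 2 * + k + + a * + p))
        p²∣diff = ∣-by (∣m∣n⇒∣m-n
          (p²∣ n₁ square₁ (subst (+ p ∣_) (sym norm-shift) (∣m∣n⇒∣m+n norm₀ (∣m⇒∣m*n {+ p} {+ p} (+ b * + c * (+ 2 * + k + + a * + p)) ∣-refl))))
          (p²∣ n₀ (k , ek) norm₀))
          (trans (cong (_- norm₁ b c n₀) norm-shift) (r (norm₁ b c n₀) _))
          where
          r : ∀ x y → x + y - x ≡ y
          r = solve-∀
        p∣k : + p ∣ + k
        p∣k = Cop-euclid (+ k) (prime-Cop pr p∤2) (∣-by (∣m∣n⇒∣m-n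
          (Cop-euclid (+ 2 * + k + + a * + p) (Cop-* p⊥b p⊥c) (*-cancelˡ-∣ (+ p) {{prime⇒nonZero pr}} p²∣diff))
          (∣n⇒∣m*n (+ a) ∣-refl)) (r (+ 2 * + k) (+ a * + p)))
          where
          r : ∀ x y → x + y - y ≡ x
          r = solve-∀

  harmonic : b ℕ.* c ≡ a ℕ.* (b ℕ.+ c)
  harmonic = decidable-stable (b ℕ.* c ℕ.≟ a ℕ.* (b ℕ.+ c)) λ ne → go (abs D) refl ne
    where
    D = + b * + c - + a * (+ b + + c)
    go : ∀ n → abs D ≡ n → ¬ (b ℕ.* c ≡ a ℕ.* (b ℕ.+ c)) → ⊥
    go zero e ne = ne (ℤP.+-injective (trans (ℤP.pos-* b c) (trans
      (ℤP.i-j≡0⇒i≡j (+ b * + c) (+ a * (+ b + + c)) (ℤP.∣i∣≡0⇒i≡0 e)) (sym (ℤP.pos-* a (b ℕ.+ c))))))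
    go (suc n) e _ = big (b ℕ.* c ℕ.* (suc n ℕ.* suc n)) refl
      where
      big : ∀ t → b ℕ.* c ℕ.* (suc n ℕ.* suc n) ≡ t → ⊥
      big zero h = ℕ.≢-nonZero⁻¹ (b ℕ.* c ℕ.* (suc n ℕ.* suc n)) {{ℕP.m*n≢0 (b ℕ.* c) (suc n ℕ.* suc n) {{ℕP.m*n≢0 b c}}}} h
      big (suc t) h = found (prime-3-mod-4 factors factorsPrime (subst (λ m → + 4 ∣ + m - + 3) isFactorisation m≡3))
        where
        -- This is 4bcD² - 1, with bcD² written as `suc t`.
        m = 3 ℕ.+ 4 ℕ.* t
        m≡3 : + 4 ∣ + m - + 3
        m≡3 = divides (+ t) (trans (cong (λ z → + 3 + z - + 3) (ℤP.pos-* 4 t)) (r (+ t)))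
          where
          r : ∀ t → + 3 + + 4 * t - + 3 ≡ t * + 4
          r = solve-∀
        open PrimeFactorisation (factorise m)
        value : + 4 * (+ b * + c) * (D * D) - 1ℤ ≡ + m
        value = trans (cong (λ z → + 4 * (+ b * + c) * z - 1ℤ) (trans (sq-abs D) (cong (λ z → + (z ℕ.* z)) e)))
          (trans (r (+ b * + c) (+ (suc n ℕ.* suc n))) (trans (cong (λ z → + 4 * z - 1ℤ)
            (trans (cong (_* + (suc n ℕ.* suc n)) (sym (ℤP.pos-* b c)))
              (trans (sym (ℤP.pos-* (b ℕ.* c) (suc n ℕ.* suc n))) (cong +_ h))))
            (trans (r′ (+ t)) (cong (λ z → + 3 + z) (sym (ℤP.pos-* 4 t))))))
          where
          r : ∀ x y → + 4 * x * y - 1ℤ ≡ + 4 * (x * y) - 1ℤ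
          r = solve-∀
          r′ : ∀ t → + 4 * (+ 1 + t) - 1ℤ ≡ + 3 + + 4 * t
          r′ = solve-∀
        found : (∃ λ p → Prime p × p ℕD.∣ product factors × + 4 ∣ + p - + 3) → ⊥
        found (p , pr , d , p≡3) = Obstruction.contradictory pr p≡3 D refl
          (subst (+ p ∣_) (sym value) (∣ᵤ⇒∣ {+ p} {+ m} (subst (p ℕD.∣_) (sym isFactorisation) d)))

-- Parities of coefficients as counts modulo 8.

even-or-odd : ∀ n → (∃ λ q → n ≡ q ℕ.* 2) ⊎ (∃ λ q → n ≡ 1 ℕ.+ q ℕ.* 2)
even-or-odd zero = inj₁ (0 , refl)
even-or-odd (suc n) with even-or-odd n
... | inj₁ (q , refl) = inj₂ (q , refl)
... | inj₂ (q , refl) = inj₁ (suc q , refl)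

odd%2 : ∀ q → (1 ℕ.+ q ℕ.* 2) % 2 ≡ 1
odd%2 q = [m+kn]%n≡m%n 1 q 2

0≢1 : ¬ 0 ≡ 1
0≢1 ()

odd⇒8∣ : ∀ n → n % 2 ≡ 1 → 8 ℕD.∣ 4 ℕ.+ 4 ℕ.* n
odd⇒8∣ n h with even-or-odd n
... | inj₁ (q , refl) = ⊥-elim (0≢1 (trans (sym (m*n%n≡0 q 2)) h))
... | inj₂ (q , refl) = ℕD.divides (suc q) (r q)
  where
  r : ∀ q → 4 ℕ.+ 4 ℕ.* (1 ℕ.+ q ℕ.* 2) ≡ suc q ℕ.* 8
  r = solveᴺ-∀

even⇒8∣ : ∀ n → n % 2 ≡ 0 → 8 ℕD.∣ 4 ℕ.* n
even⇒8∣ n h with even-or-odd n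
... | inj₁ (q , refl) = ℕD.divides q (r q)
  where
  r : ∀ q → 4 ℕ.* (q ℕ.* 2) ≡ q ℕ.* 8
  r = solveᴺ-∀
... | inj₂ (q , refl) = ⊥-elim (0≢1 (trans (sym h) (odd%2 q)))

8∣⇒odd : ∀ n → 8 ℕD.∣ 4 ℕ.+ 4 ℕ.* n → n % 2 ≡ 1
8∣⇒odd n h with even-or-odd n
... | inj₂ (q , refl) = odd%2 q
... | inj₁ (q , refl) = ⊥-elim (8∤4 (ℕD.∣m+n∣m⇒∣n (subst (8 ℕD.∣_) (ℕP.+-comm 4 (4 ℕ.* (q ℕ.* 2))) h) (even⇒8∣ (q ℕ.* 2) (m*n%n≡0 q 2))))

8∣⇒even : ∀ n → 8 ℕD.∣ 4 ℕ.* n → n % 2 ≡ 0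
8∣⇒even n h with even-or-odd n
... | inj₁ (q , refl) = m*n%n≡0 q 2
... | inj₂ (q , refl) = ⊥-elim (8∤4 (ℕD.∣m+n∣m⇒∣n (subst (8 ℕD.∣_) (r q) h) (ℕD.divides q refl)))
  where
  r : ∀ q → 4 ℕ.* (1 ℕ.+ q ℕ.* 2) ≡ q ℕ.* 8 ℕ.+ 4
  r = solveᴺ-∀

Counts : Set → ℕ → Set
Counts S n = (S → 8 ℕD.∣ 4 ℕ.+ n) × (¬ S → 8 ℕD.∣ n)

2≤harmonic : ∀ {a b c} .{{_ : ℕ.NonZero a}} .{{_ : ℕ.NonZero b}} → b ℕ.* c ≡ a ℕ.* (b ℕ.+ c) → 2 ℕ.≤ b
2≤harmonic {a} {suc (suc b)} _ = s≤s (s≤s z≤n)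
2≤harmonic {suc a} {suc zero} {c} h = ⊥-elim (ℕP.<⇒≱ (ℕP.n<1+n c)
  (ℕP.≤-trans (ℕP.m≤m+n (suc c) (a ℕ.* suc c)) (ℕP.≤-reflexive (trans (sym h) (ℕP.*-identityˡ c)))))

harmonic-comm : ∀ {a b c} → b ℕ.* c ≡ a ℕ.* (b ℕ.+ c) → c ℕ.* b ≡ a ℕ.* (c ℕ.+ b)
harmonic-comm {a} {b} {c} h = trans (ℕP.*-comm c b) (trans h (cong (a ℕ.*_) (ℕP.+-comm b c)))

module Bridge (a b c : ℕ) .{{nza : ℕ.NonZero a}} .{{nzb : ℕ.NonZero b}} .{{nzc : ℕ.NonZero c}}
  (harmonic : b ℕ.* c ≡ a ℕ.* (b ℕ.+ c)) where

  private
    harmonicᶻ : + b * + c ≡ + a * (+ b + + c)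
    harmonicᶻ = trans (sym (ℤP.pos-* b c)) (trans (cong +_ harmonic) (ℤP.pos-* a (b ℕ.+ c)))

    norm≡ : ∀ n → norm₁ b c n ≡ (+ b + + c) * + (a ℕ.* n ℕ.+ 1)
    norm≡ n = trans (cong (λ t → t * + n + (+ b + + c)) harmonicᶻ)
      (trans (r (+ a) (+ b) (+ c) (+ n)) (cong ((+ b + + c) *_) (sym (cast a n))))
      where
      r : ∀ a b c n → a * (b + c) * n + (b + c) ≡ (b + c) * (a * n + 1ℤ)
      r = solve-∀

    card-V′ : ∀ n (e : Enum (V b c 1ℤ ((+ b + + c) * + (a ℕ.* n ℕ.+ 1)))) → card e ≡ 4 ℕ.* (f b ⊛ f c) n
    card-V′ n e = at (norm≡ n) e
      where
      at : ∀ {N} → norm₁ b c n ≡ N → (e : Enum (V b c 1ℤ N)) → card e ≡ 4 ℕ.* (f b ⊛ f c) n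
      at refl e = card-V b c n (2≤harmonic {a} {b} {c} harmonic)
        (2≤harmonic {a} {c} {b} (harmonic-comm {a} {b} {c} harmonic)) e

    a∣self : ∀ n → + a ∣ + (a ℕ.* n ℕ.+ 1) - 1ℤ
    a∣self n = divides (+ n) (trans (cong (_- 1ℤ) (cast a n)) (r (+ a) (+ n)))
      where
      r : ∀ a n → a * n + 1ℤ - 1ℤ ≡ n * a
      r = solve-∀

    -- Subtracting b + c from the norm equation gives c (x² - 1) + b (y² - 1) = (b + c) (M - 1). The
    -- left side is a multiple of bc = a (b + c), and b + c cancels.
    empty : ∀ {M xy} → V b c 1ℤ ((+ b + + c) * + M) xy → + a ∣ + M - 1ℤ
    empty {M} {x , y} (e , divides i ei , divides j ej) = divides (i + j)
      (cancelˡ (+ b + + c) (nonZero (b ℕ.+ c) {{ℕ.>-nonZero (ℕP.<-≤-trans (ℕ.>-nonZero⁻¹ b) (ℕP.m≤m+n b c))}})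
        (go (+ a) (+ b) (+ c) (x * x) (y * y) i j (+ M) harmonicᶻ e ei ej))
      where
      go : ∀ a b c x² y² i j m → b * c ≡ a * (b + c) → c * x² + b * y² ≡ (b + c) * m →
        x² - 1ℤ ≡ i * b → y² - 1ℤ ≡ j * c → (b + c) * (m - 1ℤ) ≡ (b + c) * ((i + j) * a)
      go a b c x² y² i j m h e ei ej = lin₂ (i + j) (- 1ℤ) h e
        (lin₂ {C = (b + c) * (m - 1ℤ) - (b + c) * ((i + j) * a)} c b ei ej
          (solve (a ∷ b ∷ c ∷ x² ∷ y² ∷ i ∷ j ∷ m ∷ [])))

  parity-of : f a ≡₂ (f b ⊛ f c) → Parity a b c 1ℤ
  parity-of H (suc M) _ e = split (+ a ∣? + suc M - 1ℤ)
    where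
    Goal : ℕ → ℕ → Set
    Goal M k = (SquareClass a 1ℤ M → 8 ℕD.∣ 4 ℕ.+ k) × (¬ SquareClass a 1ℤ M → 8 ℕD.∣ k)
    on : ∀ n (e : Enum (V b c 1ℤ ((+ b + + c) * + (a ℕ.* n ℕ.+ 1)))) → Goal (a ℕ.* n ℕ.+ 1) (card e)
    on n e = (λ { (k , ek , _) → subst (λ t → 8 ℕD.∣ 4 ℕ.+ t) (sym (card-V′ n e))
                  (odd⇒8∣ ((f b ⊛ f c) n) (trans (sym (H n)) (cong (_% 2) (f-square {a} {n} (k , ek))))) }) ,
             (λ no → subst (8 ℕD.∣_) (sym (card-V′ n e))
                  (even⇒8∣ ((f b ⊛ f c) n) (trans (sym (H n)) (cong (_% 2) (f-nonsquare {a} {n} λ { (k , ek) → no (k , ek , a∣self n) })))))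
    split : Dec (+ a ∣ + suc M - 1ℤ) → Goal (suc M) (card e)
    split (no h) = (λ { (_ , _ , d) → ⊥-elim (h d) }) ,
      (λ _ → subst (8 ℕD.∣_) (sym (card-zero e λ {p} v → h (empty {suc M} {p} v))) (ℕD.divides 0 refl))
    split (yes h) = found (∣⇒∣ᵤ h)
      where
      move : ∀ {m} → m ≡ suc M → (∀ (e : Enum (V b c 1ℤ ((+ b + + c) * + m))) → Goal m (card e)) → Goal (suc M) (card e)
      move refl g = g e
      found : a ℕD.∣ M → Goal (suc M) (card e)
      found (ℕD.divides n eq) = move (trans (ℕP.+-comm (a ℕ.* n) 1) (cong suc (trans (ℕP.*-comm a n) (sym eq)))) (on n)

  of-counts : (∀ n (e : Enum (V b c 1ℤ ((+ b + + c) * + (a ℕ.* n ℕ.+ 1)))) → Counts (IsSquare (a ℕ.* n ℕ.+ 1)) (card e)) →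
    f a ≡₂ (f b ⊛ f c)
  of-counts counts n = split (isSquare? (a ℕ.* n ℕ.+ 1))
    where
    e = enumV b c 1ℤ ((+ b + + c) * + (a ℕ.* n ℕ.+ 1))
    split : Dec (IsSquare (a ℕ.* n ℕ.+ 1)) → f a n % 2 ≡ (f b ⊛ f c) n % 2
    split (yes sq) = trans (cong (_% 2) (f-square {a} {n} sq))
      (sym (8∣⇒odd ((f b ⊛ f c) n) (subst (λ t → 8 ℕD.∣ 4 ℕ.+ t) (card-V′ n e) (proj₁ (counts n e) sq))))
    split (no h) = trans (cong (_% 2) (f-nonsquare {a} {n} h))
      (sym (8∣⇒even ((f b ⊛ f c) n) (subst (8 ℕD.∣_) (card-V′ n e) (proj₂ (counts n e) h))))

-- Power series modulo 2, squaring and cancellation.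

tail : Series → Series
tail F n = F (suc n)

⊛-suc : ∀ F G n → (F ⊛ G) (suc n) ≡ F 0 ℕ.* G (suc n) ℕ.+ (tail F ⊛ G) n
⊛-suc F G n = cong (F 0 ℕ.* G (suc n) ℕ.+_) (cong sum (go id (suc n)))
  where
  open import Data.List using (applyUpTo)
  go : ∀ (h : ℕ → ℕ) m → map (λ i → F i ℕ.* G (suc n ∸ i)) (applyUpTo (λ i → suc (h i)) m)
    ≡ map (λ i → tail F i ℕ.* G (n ∸ i)) (applyUpTo h m)
  go h zero = refl
  go h (suc m) = cong (_ ∷_) (go (λ i → h (suc i)) m)

⊛-zero : ∀ F G → (F ⊛ G) 0 ≡ F 0 ℕ.* G 0
⊛-zero F G = ℕP.+-identityʳ (F 0 ℕ.* G 0)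

infix 4 _≐_
_≐_ : Series → Series → Set
F ≐ G = ∀ n → F n ≡ G n

⊛-congˡ : ∀ {F F′} G → F ≐ F′ → F ⊛ G ≐ F′ ⊛ G
⊛-congˡ {F} {F′} G h zero = trans (⊛-zero F G) (trans (cong (ℕ._* G 0) (h 0)) (sym (⊛-zero F′ G)))
⊛-congˡ {F} {F′} G h (suc n) = trans (⊛-suc F G n) (trans
  (cong₂ (λ u v → u ℕ.* G (suc n) ℕ.+ v) (h 0) (⊛-congˡ G (λ m → h (suc m)) n)) (sym (⊛-suc F′ G n)))

⊛-suc′ : ∀ F G n → (F ⊛ G) (suc n) ≡ F (suc n) ℕ.* G 0 ℕ.+ (F ⊛ tail G) n
⊛-suc′ F G zero = trans (⊛-suc F G 0) (trans (cong (F 0 ℕ.* G 1 ℕ.+_) (⊛-zero (tail F) G))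
  (trans (ℕP.+-comm (F 0 ℕ.* G 1) _) (cong (F 1 ℕ.* G 0 ℕ.+_) (sym (⊛-zero F (tail G))))))
⊛-suc′ F G (suc n) = trans (⊛-suc F G (suc n)) (trans (cong (F 0 ℕ.* G (suc (suc n)) ℕ.+_) (⊛-suc′ (tail F) G n))
  (trans (r (F 0 ℕ.* G (suc (suc n))) (F (suc (suc n)) ℕ.* G 0) ((tail F ⊛ tail G) n))
    (cong (F (suc (suc n)) ℕ.* G 0 ℕ.+_) (sym (⊛-suc F (tail G) n)))))
  where
  r : ∀ x y z → x ℕ.+ (y ℕ.+ z) ≡ y ℕ.+ (x ℕ.+ z)
  r = solveᴺ-∀

⊛-comm : ∀ F G → F ⊛ G ≐ G ⊛ F
⊛-comm F G zero = trans (⊛-zero F G) (trans (ℕP.*-comm (F 0) (G 0)) (sym (⊛-zero G F)))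
⊛-comm F G (suc n) = trans (⊛-suc F G n) (trans
  (cong₂ ℕ._+_ (ℕP.*-comm (F 0) (G (suc n))) (⊛-comm (tail F) G n)) (sym (⊛-suc′ G F n)))

-- The tail of a product F ⊛ G is F 0 times the tail of G plus the tail of F times G. Associativity
-- by induction meets exactly such a combination as a left factor.
⊛-linear : ∀ k G F H → (λ n → k ℕ.* G n ℕ.+ F n) ⊛ H ≐ (λ n → k ℕ.* (G ⊛ H) n ℕ.+ (F ⊛ H) n)
⊛-linear k G F H zero = trans (⊛-zero (λ n → k ℕ.* G n ℕ.+ F n) H) (trans (r k (G 0) (F 0) (H 0))
  (cong₂ (λ u v → k ℕ.* u ℕ.+ v) (sym (⊛-zero G H)) (sym (⊛-zero F H))))
  where
  r : ∀ k g f h → (k ℕ.* g ℕ.+ f) ℕ.* h ≡ k ℕ.* (g ℕ.* h) ℕ.+ f ℕ.* h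
  r = solveᴺ-∀
⊛-linear k G F H (suc n) = trans (⊛-suc (λ n → k ℕ.* G n ℕ.+ F n) H n) (trans
  (cong ((k ℕ.* G 0 ℕ.+ F 0) ℕ.* H (suc n) ℕ.+_) (⊛-linear k (tail G) (tail F) H n))
  (trans (r k (G 0) (F 0) (H (suc n)) ((tail G ⊛ H) n) ((tail F ⊛ H) n))
    (cong₂ (λ u v → k ℕ.* u ℕ.+ v) (sym (⊛-suc G H n)) (sym (⊛-suc F H n)))))
  where
  r : ∀ k g f h x y → (k ℕ.* g ℕ.+ f) ℕ.* h ℕ.+ (k ℕ.* x ℕ.+ y) ≡ k ℕ.* (g ℕ.* h ℕ.+ x) ℕ.+ (f ℕ.* h ℕ.+ y)
  r = solveᴺ-∀

⊛-assoc : ∀ F G H → (F ⊛ G) ⊛ H ≐ F ⊛ (G ⊛ H)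
⊛-assoc F G H zero = trans (⊛-zero (F ⊛ G) H) (trans (cong (ℕ._* H 0) (⊛-zero F G))
  (trans (ℕP.*-assoc (F 0) (G 0) (H 0)) (trans (cong (F 0 ℕ.*_) (sym (⊛-zero G H))) (sym (⊛-zero F (G ⊛ H))))))
⊛-assoc F G H (suc n) = trans (⊛-suc (F ⊛ G) H n) (trans
  (cong₂ ℕ._+_ (cong (ℕ._* H (suc n)) (⊛-zero F G))
    (trans (⊛-congˡ H (⊛-suc F G) n) (trans (⊛-linear (F 0) (tail G) (tail F ⊛ G) H n)
      (cong (F 0 ℕ.* (tail G ⊛ H) n ℕ.+_) (⊛-assoc (tail F) G H n)))))
  (trans (r (F 0) (G 0) (H (suc n)) ((tail G ⊛ H) n) ((tail F ⊛ (G ⊛ H)) n))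
    (trans (cong (λ t → F 0 ℕ.* t ℕ.+ (tail F ⊛ (G ⊛ H)) n) (sym (⊛-suc G H n))) (sym (⊛-suc F (G ⊛ H) n)))))
  where
  r : ∀ f g h x y → f ℕ.* g ℕ.* h ℕ.+ (f ℕ.* x ℕ.+ y) ≡ f ℕ.* (g ℕ.* h ℕ.+ x) ℕ.+ y
  r = solveᴺ-∀

+-cong₂ : ∀ {a a′ b b′} → a % 2 ≡ a′ % 2 → b % 2 ≡ b′ % 2 → (a ℕ.+ b) % 2 ≡ (a′ ℕ.+ b′) % 2
+-cong₂ {a} {a′} {b} {b′} h h′ = trans (%-distribˡ-+ a b 2)
  (trans (cong₂ (λ u v → (u ℕ.+ v) % 2) h h′) (sym (%-distribˡ-+ a′ b′ 2)))

*-cong₂ : ∀ {a a′ b b′} → a % 2 ≡ a′ % 2 → b % 2 ≡ b′ % 2 → (a ℕ.* b) % 2 ≡ (a′ ℕ.* b′) % 2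
*-cong₂ {a} {a′} {b} {b′} h h′ = trans (%-distribˡ-* a b 2)
  (trans (cong₂ (λ u v → (u ℕ.* v) % 2) h h′) (sym (%-distribˡ-* a′ b′ 2)))

-- The hypothesis is restricted to coefficients up to `n` so that cancellation by strong induction
-- can use it.
⊛-cong-below : ∀ P {F G} n → (∀ m → m ℕ.≤ n → F m % 2 ≡ G m % 2) → (P ⊛ F) n % 2 ≡ (P ⊛ G) n % 2
⊛-cong-below P {F} {G} zero h = trans (cong (_% 2) (⊛-zero P F)) (trans
  (*-cong₂ {P 0} {P 0} refl (h 0 z≤n)) (cong (_% 2) (sym (⊛-zero P G))))
⊛-cong-below P {F} {G} (suc n) h = trans (cong (_% 2) (⊛-suc P F n)) (trans
  (+-cong₂ {P 0 ℕ.* F (suc n)} {P 0 ℕ.* G (suc n)} (*-cong₂ {P 0} {P 0} refl (h (suc n) ℕP.≤-refl))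
    (⊛-cong-below (tail P) {F} {G} n (λ m m≤n → h m (ℕP.m≤n⇒m≤1+n m≤n))))
  (cong (_% 2) (sym (⊛-suc P G n))))

⊛-cong₂ʳ : ∀ P {F G} → F ≡₂ G → (P ⊛ F) ≡₂ (P ⊛ G)
⊛-cong₂ʳ P {F} {G} h n = ⊛-cong-below P {F} {G} n (λ m _ → h m)

⊛-cong₂ : ∀ {F F′ G G′} → F ≡₂ F′ → G ≡₂ G′ → (F ⊛ G) ≡₂ (F′ ⊛ G′)
⊛-cong₂ {F} {F′} {G} {G′} h h′ n = trans (⊛-cong₂ʳ F {G} {G′} h′ n) (trans (cong (_% 2) (⊛-comm F G′ n))
  (trans (⊛-cong₂ʳ G′ {F} {F′} h n) (cong (_% 2) (⊛-comm G′ F′ n))))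

+-cancelʳ₂ : ∀ {a a′ b b′} → b % 2 ≡ b′ % 2 → (a ℕ.+ b) % 2 ≡ (a′ ℕ.+ b′) % 2 → a % 2 ≡ a′ % 2
+-cancelʳ₂ {a} {a′} {b} {b′} hb h = trans (sym (twice₂ a b)) (trans (+-cong₂ {a ℕ.+ b} {a′ ℕ.+ b′} h hb) (twice₂ a′ b′))
  where
  twice₂ : ∀ a b → (a ℕ.+ b ℕ.+ b) % 2 ≡ a % 2
  twice₂ a b = trans (cong (_% 2) (r a b)) ([m+kn]%n≡m%n a b 2)
    where
    r : ∀ a b → a ℕ.+ b ℕ.+ b ≡ a ℕ.+ b ℕ.* 2
    r = solveᴺ-∀

-- The constant term 1 isolates the newest coefficient; all other terms agree by induction and are
-- subtracted modulo 2.
⊛-cancelˡ : ∀ P {F G} → P 0 ≡ 1 → (P ⊛ F) ≡₂ (P ⊛ G) → F ≡₂ G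
⊛-cancelˡ P {F} {G} P0 h = <-rec _ λ n rec → go n (λ m m<n → rec m<n)
  where
  unit : ∀ t → t % 2 ≡ (P 0 ℕ.* t) % 2
  unit t = cong (_% 2) (sym (trans (cong (ℕ._* t) P0) (ℕP.*-identityˡ t)))
  go : ∀ n → (∀ m → m ℕ.< n → F m % 2 ≡ G m % 2) → F n % 2 ≡ G n % 2
  go zero rec = trans (unit (F 0)) (trans (cong (_% 2) (sym (⊛-zero P F))) (trans (h 0)
    (trans (cong (_% 2) (⊛-zero P G)) (sym (unit (G 0))))))
  go (suc n) rec = trans (unit (F (suc n))) (trans
    (+-cancelʳ₂ {P 0 ℕ.* F (suc n)} {P 0 ℕ.* G (suc n)} {(tail P ⊛ F) n} {(tail P ⊛ G) n}
      (⊛-cong-below (tail P) {F} {G} n (λ m m≤n → rec m (s≤s m≤n)))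
      (trans (cong (_% 2) (sym (⊛-suc P F n))) (trans (h (suc n)) (cong (_% 2) (⊛-suc P G n)))))
    (sym (unit (G (suc n)))))

data Parityᴺ : ℕ → Set where
  twiceᴺ : ∀ k → Parityᴺ (k ℕ.+ k)
  1+twiceᴺ : ∀ k → Parityᴺ (suc (k ℕ.+ k))

parityᴺ : ∀ n → Parityᴺ n
parityᴺ zero = twiceᴺ 0
parityᴺ (suc n) with parityᴺ n
... | twiceᴺ k = 1+twiceᴺ k
... | 1+twiceᴺ k = subst Parityᴺ (cong suc (ℕP.+-suc k k)) (twiceᴺ (suc k))

-- F(q) ≡ G(q²) modulo 2.
Dilated : Series → Series → Set
Dilated F G = (∀ n → F (n ℕ.+ n) % 2 ≡ G n % 2) × (∀ n → F (suc (n ℕ.+ n)) % 2 ≡ 0)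

dilated-unique : ∀ {F F′ G} → Dilated F G → Dilated F′ G → F ≡₂ F′
dilated-unique (e , o) (e′ , o′) n with parityᴺ n
... | twiceᴺ k = trans (e k) (sym (e′ k))
... | 1+twiceᴺ k = trans (o k) (sym (o′ k))

suc+suc : ∀ n → suc n ℕ.+ suc n ≡ suc (suc (n ℕ.+ n))
suc+suc n = cong suc (ℕP.+-suc n n)

even-sum : ∀ t u → (t ℕ.+ (t ℕ.+ u)) % 2 ≡ u % 2
even-sum t u = trans (cong (_% 2) (r t u)) ([m+kn]%n≡m%n u t 2)
  where
  r : ∀ t u → t ℕ.+ (t ℕ.+ u) ≡ u ℕ.+ t ℕ.* 2
  r = solveᴺ-∀

-- The two extreme terms of the convolution are both F 0 · F (n + 2) and cancel modulo 2. Removing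
-- them replaces F by its tail and lowers the index by 2, which is the induction behind `frobenius`.
square-suc² : ∀ F n → (F ⊛ F) (suc (suc n)) % 2 ≡ (tail F ⊛ tail F) n % 2
square-suc² F n = trans (cong (_% 2) (trans (⊛-suc F F (suc n))
  (cong (F 0 ℕ.* F (suc (suc n)) ℕ.+_) (trans (⊛-suc′ (tail F) F n)
    (cong (ℕ._+ (tail F ⊛ tail F) n) (ℕP.*-comm (F (suc (suc n))) (F 0)))))))
  (even-sum (F 0 ℕ.* F (suc (suc n))) ((tail F ⊛ tail F) n))

square₂ : ∀ t → (t ℕ.* t) % 2 ≡ t % 2
square₂ t with even-or-odd t
... | inj₁ (q , refl) = trans (trans (cong (_% 2) (r q)) (m*n%n≡0 (q ℕ.* q ℕ.* 2) 2)) (sym (m*n%n≡0 q 2))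
  where
  r : ∀ q → q ℕ.* 2 ℕ.* (q ℕ.* 2) ≡ q ℕ.* q ℕ.* 2 ℕ.* 2
  r = solveᴺ-∀
... | inj₂ (q , refl) = trans (trans (cong (_% 2) (r q)) ([m+kn]%n≡m%n 1 (2 ℕ.* q ℕ.* (1 ℕ.+ q)) 2)) (sym (odd%2 q))
  where
  r : ∀ q → (1 ℕ.+ q ℕ.* 2) ℕ.* (1 ℕ.+ q ℕ.* 2) ≡ 1 ℕ.+ 2 ℕ.* q ℕ.* (1 ℕ.+ q) ℕ.* 2
  r = solveᴺ-∀

frobenius : ∀ F → Dilated (F ⊛ F) F
frobenius F = e F , o F
  where
  e : ∀ F n → (F ⊛ F) (n ℕ.+ n) % 2 ≡ F n % 2
  e F zero = trans (cong (_% 2) (⊛-zero F F)) (square₂ (F 0))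
  e F (suc n) = trans (cong (λ t → (F ⊛ F) t % 2) (suc+suc n)) (trans (square-suc² F (n ℕ.+ n)) (e (tail F) n))
  o : ∀ F n → (F ⊛ F) (suc (n ℕ.+ n)) % 2 ≡ 0
  o F zero = trans (cong (_% 2) (trans (⊛-suc F F 0) (trans (cong (F 0 ℕ.* F 1 ℕ.+_) (trans (⊛-zero (tail F) F)
    (trans (ℕP.*-comm (F 1) (F 0)) (sym (ℕP.+-identityʳ _))))) refl))) (even-sum (F 0 ℕ.* F 1) 0)
  o F (suc n) = trans (cong (λ t → (F ⊛ F) (suc t) % 2) (suc+suc n)) (trans (square-suc² F (suc (n ℕ.+ n))) (o (tail F) n))

f-eq : ∀ {m m′ n n′} → m ℕ.* n ≡ m′ ℕ.* n′ → f m n ≡ f m′ n′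
f-eq h = cong (λ t → ⌊ isSquare? (t ℕ.+ 1) ⌋₀₁) h

-- If m n + 1 = k² with m even, then 8 divides k² - 1, so n must be even unless 8 ∣ m.
f-dilate : ∀ m m′ → m′ ≡ 2 ℕ.* m → + 2 ∣ + m → ¬ (+ 8 ∣ + m) → Dilated (f m) (f m′)
f-dilate m m′ refl 2∣m 8∤m =
  (λ n → cong (_% 2) (f-eq {m} {2 ℕ.* m} (r m n))) , (λ n → cong (_% 2) (f-nonsquare {m} {suc (n ℕ.+ n)} (none n)))
  where
  r : ∀ m n → m ℕ.* (n ℕ.+ n) ≡ 2 ℕ.* m ℕ.* n
  r = solveᴺ-∀
  lemma₁ : ∀ x y → + 2 ∣ x * x - 1ℤ → + 8 ∣ x * x - 1ℤ
  lemma₁ = decide 8 (dv 2 (𝕩 ⊗ 𝕩 ⊖ κ 1ℤ) ⇒ dv 8 (𝕩 ⊗ 𝕩 ⊖ κ 1ℤ))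
  lemma₂ : ∀ x y → + 8 ∣ x * (1ℤ + (y + y)) → + 8 ∣ x
  lemma₂ = decide 8 (dv 8 (𝕩 ⊗ (κ 1ℤ ⊕ (𝕪 ⊕ 𝕪))) ⇒ dv 8 𝕩)
  none : ∀ n → ¬ IsSquare (m ℕ.* suc (n ℕ.+ n) ℕ.+ 1)
  none n (k , e) = 8∤m (lemma₂ (+ m) (+ n) (subst (+ 8 ∣_) eq
    (lemma₁ (+ k) 0ℤ (subst (+ 2 ∣_) (sym eq) (∣m⇒∣m*n {+ 2} {+ m} (1ℤ + (+ n + + n)) 2∣m)))))
    where
    s : ∀ x → x + 1ℤ - 1ℤ ≡ x
    s = solve-∀
    eq : + k * + k - 1ℤ ≡ + m * (1ℤ + (+ n + + n))
    eq = trans (cong (_- 1ℤ) (trans (sym (ℤP.pos-* k k)) (trans (cong +_ e) (cast m (suc (n ℕ.+ n))))))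
      (s (+ m * (1ℤ + (+ n + + n))))

f-square-root : ∀ m m′ → m′ ≡ 2 ℕ.* m → + 2 ∣ + m → ¬ (+ 8 ∣ + m) → f m ≡₂ (f m′ ⊛ f m′)
f-square-root m m′ h 2∣m 8∤m = dilated-unique {f m} {f m′ ⊛ f m′} {f m′} (f-dilate m m′ h 2∣m 8∤m) (frobenius (f m′))

square-product : ∀ {A B C A₂ B₂ C₂} → A ≡₂ (B ⊛ C) → A₂ ≡₂ (A ⊛ A) → B₂ ≡₂ (B ⊛ B) → C₂ ≡₂ (C ⊛ C) →
  A₂ ≡₂ (B₂ ⊛ C₂)
square-product {A} {B} {C} {A₂} {B₂} {C₂} h hA hB hC n =
  trans (hA n) (trans (⊛-cong₂ {A} {B ⊛ C} {A} {B ⊛ C} h h n) (trans (cong (_% 2) (shuffle n))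
    (sym (⊛-cong₂ {B₂} {B ⊛ B} {C₂} {C ⊛ C} hB hC n))))
  where
  ⊛-congʳ : ∀ P {F G} → F ≐ G → P ⊛ F ≐ P ⊛ G
  ⊛-congʳ P {F} {G} e n = trans (⊛-comm P F n) (trans (⊛-congˡ P e n) (⊛-comm G P n))
  shuffle : (B ⊛ C) ⊛ (B ⊛ C) ≐ (B ⊛ B) ⊛ (C ⊛ C)
  shuffle n = trans (⊛-assoc B C (B ⊛ C) n) (trans (⊛-congʳ B (λ m → trans (sym (⊛-assoc C B C m))
    (trans (⊛-congˡ C (⊛-comm C B) m) (⊛-assoc B C C m))) n) (sym (⊛-assoc B B (C ⊛ C) n)))

f-zero : ∀ m → f m 0 ≡ 1
f-zero m = f-square {m} {0} (1 , cong (ℕ._+ 1) (sym (ℕP.*-zeroʳ m)))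

-- With P = f₂₄ we have f₁₂ = P² and f₆ = P⁴, so f₆ = f₈ P gives f₈ = P³ = f₁₂ f₂₄.
cancel-root : ∀ {A B Q P} → P 0 ≡ 1 → A ≡₂ (B ⊛ P) → A ≡₂ (Q ⊛ Q) → Q ≡₂ (P ⊛ P) → B ≡₂ (Q ⊛ P)
cancel-root {A} {B} {Q} {P} P0 hA hQ hP = ⊛-cancelˡ P {B} {Q ⊛ P} P0 λ n →
  trans (cong (_% 2) (⊛-comm P B n)) (trans (sym (hA n)) (trans (hQ n) (trans (⊛-cong₂ʳ Q {Q} {P ⊛ P} hP n)
    (trans (cong (_% 2) (sym (⊛-assoc Q P P n))) (cong (_% 2) (⊛-comm (Q ⊛ P) P n))))))

-- As A has only even exponents modulo 2, an even exponent of the product pairs it with an even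
-- exponent of B.
even-part : ∀ {A A₂} → Dilated A A₂ → ∀ B n → (A ⊛ B) (n ℕ.+ n) % 2 ≡ (A₂ ⊛ (λ m → B (m ℕ.+ m))) n % 2
even-part {A} {A₂} (e , o) B zero = trans (cong (_% 2) (⊛-zero A B)) (trans (*-cong₂ {A 0} {A₂ 0} {B 0} {B 0} (e 0) refl)
  (cong (_% 2) (sym (⊛-zero A₂ (λ m → B (m ℕ.+ m))))))
even-part {A} {A₂} (e , o) B (suc n) = trans (cong (λ t → (A ⊛ B) t % 2) (suc+suc n)) (trans
  (cong (_% 2) (trans (⊛-suc A B (suc (n ℕ.+ n))) (cong (A 0 ℕ.* B (suc (suc (n ℕ.+ n))) ℕ.+_) (⊛-suc (tail A) B (n ℕ.+ n)))))
  (trans (+-cong₂ {A 0 ℕ.* B (suc (suc (n ℕ.+ n)))} {A₂ 0 ℕ.* B (suc n ℕ.+ suc n)}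
      (trans (cong (λ t → (A 0 ℕ.* B t) % 2) (sym (suc+suc n))) (*-cong₂ {A 0} {A₂ 0} {B (suc n ℕ.+ suc n)} (e 0) refl))
      (trans (+-cong₂ {A 1 ℕ.* B (suc (n ℕ.+ n))} {0} {(tail (tail A) ⊛ B) (n ℕ.+ n)} {(tail (tail A) ⊛ B) (n ℕ.+ n)}
          (*-cong₂ {A 1} {0} {B (suc (n ℕ.+ n))} {B (suc (n ℕ.+ n))} (o 0) refl) refl)
        (even-part {tail (tail A)} {tail A₂}
          ((λ m → trans (cong (λ t → A t % 2) (sym (suc+suc m))) (e (suc m))) ,
           (λ m → trans (cong (λ t → A (suc t) % 2) (sym (suc+suc m))) (o (suc m)))) B n)))
    (cong (_% 2) (sym (⊛-suc A₂ (λ m → B (m ℕ.+ m)) n)))))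

f-double : ∀ m m′ → m′ ≡ 2 ℕ.* m → (λ n → f m (n ℕ.+ n)) ≐ f m′
f-double m m′ refl n = f-eq {m} {2 ℕ.* m} (r m n)
  where
  r : ∀ m n → m ℕ.* (n ℕ.+ n) ≡ 2 ℕ.* m ℕ.* n
  r = solveᴺ-∀

-- The coefficients of `f m` at even exponents are those of `f (2 m)`. This carries an identity from
-- smaller to larger indices, the direction opposite to squaring; it takes (8, 12, 24) to (16, 24,
-- 48).
f-even-part : ∀ {a b c} → + 2 ∣ + b → ¬ (+ 8 ∣ + b) → f a ≡₂ (f b ⊛ f c) → f (2 ℕ.* a) ≡₂ (f (2 ℕ.* b) ⊛ f (2 ℕ.* c))
f-even-part {a} {b} {c} 2∣b 8∤b h n = trans (cong (_% 2) (sym (f-double a (2 ℕ.* a) refl n)))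
  (trans (h (n ℕ.+ n)) (trans (even-part {f b} {f (2 ℕ.* b)} (f-dilate b (2 ℕ.* b) refl 2∣b 8∤b) (f c) n)
    (⊛-cong₂ʳ (f (2 ℕ.* b)) {λ m → f c (m ℕ.+ m)} {f (2 ℕ.* c)} (λ m → cong (_% 2) (f-double c (2 ℕ.* c) refl m)) n)))

-- Counting by symmetries.

card-image : ∀ {A B : Set} {P : A → Set} {Q : B → Set} (φ : B → A) (e : Enum P) (eQ : Enum Q) →
  (∀ {q q′} → φ q ≡ φ q′ → q ≡ q′) → (∀ {q} → Q q → P (φ q)) → (∀ {p} → P p → ∃ λ q → Q q × φ q ≡ p) →
  card e ≡ card eQ
card-image φ e eQ inj to from = card-≡ (λ p q → φ q ≡ p) e eQ from (λ q → _ , to q , refl)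
  (λ h h′ → trans (sym h) h′) (λ h h′ → inj (trans h (sym h′)))

-- The group generated by σ₁ and σ₂ has order 4 and acts freely.
klein : ∀ {P : ℤ × ℤ → Set} (e : Enum P) (σ₁ σ₂ : ℤ × ℤ → ℤ × ℤ) (s₁ s₂ : ℤ × ℤ → ℤ) →
  (∀ p → σ₁ (σ₁ p) ≡ p) → (∀ p → σ₂ (σ₂ p) ≡ p) →
  (∀ p → s₁ (σ₁ p) ≡ - s₁ p) → (∀ p → s₁ (σ₂ p) ≡ s₁ p) → (∀ p → s₂ (σ₂ p) ≡ - s₂ p) →
  (∀ {p} → P p → P (σ₁ p)) → (∀ {p} → P p → P (σ₂ p)) →
  (∀ {p} → P p → s₁ p ≢ 0ℤ) → (∀ {p} → P p → s₂ p ≢ 0ℤ) → 4 ℕD.∣ card e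
klein e σ₁ σ₂ s₁ s₂ inv₁ inv₂ f₁ k₁ f₂ pres₁ pres₂ nz₁ nz₂ = ℕD.divides (card e₂) (trans
  (card-double pos₁? e σ₁ inv₁ pres₁ (λ {p} _ h h′ → pos-neg h (subst (0ℤ <_) (f₁ p) h′))
    (λ {p} pp h → subst (0ℤ <_) (sym (f₁ p)) (neg-pos (nz₁ pp) h)))
  (trans (cong (2 ℕ.*_) (card-double pos₂? e₁ σ₂ inv₂
      (λ { {p} (pp , h) → pres₂ pp , subst (0ℤ <_) (sym (k₁ p)) h })
      (λ {p} _ h h′ → pos-neg h (subst (0ℤ <_) (f₂ p) h′))
      (λ { {p} (pp , _) h → subst (0ℤ <_) (sym (f₂ p)) (neg-pos (nz₂ pp) h) })))
    (r (card e₂))))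
  where
  pos₁? : Decidable (λ p → 0ℤ < s₁ p)
  pos₁? p = 0ℤ <? s₁ p
  pos₂? : Decidable (λ p → 0ℤ < s₂ p)
  pos₂? p = 0ℤ <? s₂ p
  e₁ = restrict pos₁? e
  e₂ = restrict pos₂? e₁
  r : ∀ n → 2 ℕ.* (2 ℕ.* n) ≡ n ℕ.* 4
  r = solveᴺ-∀

-- Each solution satisfies exactly one of y ≡ α x and y ≡ - α x modulo `k`, and conjugation
-- exchanges the two halves. In the first half y = α x - t k, and this substitution leads to the new
-- form.
halve-image : ∀ (k : ℕ) (α : ℤ) {P Q : ℤ × ℤ → Set} (φ : ℤ × ℤ → ℤ × ℤ) (e : Enum P) (eQ : Enum Q) →
  (∀ x y → P (x , y) → P (x , - y)) →
  (∀ x y → P (x , y) → + k ∣ α * x - y → ¬ (+ k ∣ α * x + y)) →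
  (∀ x y → P (x , y) → ¬ (+ k ∣ α * x - y) → + k ∣ α * x + y) →
  (∀ {q q′} → φ q ≡ φ q′ → q ≡ q′) →
  (∀ {q} → Q q → P (φ q) × + k ∣ α * proj₁ (φ q) - proj₂ (φ q)) →
  (∀ x t → P (x , α * x - t * + k) → ∃ λ q → Q q × φ q ≡ (x , α * x - t * + k)) →
  card e ≡ 2 ℕ.* card eQ
halve-image k α {P} {Q} φ e eQ conj one other inj to from = trans
  (card-double near? e (λ { (x , y) → x , - y }) (λ { (x , y) → cong (x ,_) (ℤP.neg-involutive y) })
    (λ { {x , y} → conj x y })
    (λ { {x , y} p h h′ → one x y p h (subst (+ k ∣_) (r α x y) h′) })
    (λ { {x , y} p h → subst (+ k ∣_) (sym (r α x y)) (other x y p h) }))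
  (cong (2 ℕ.*_) (card-image φ (restrict near? e) eQ inj to
    (λ { {x , y} (p , divides t h) → back x y t (solve-y x y t h) p })))
  where
  near? : Decidable (λ (p : ℤ × ℤ) → + k ∣ α * proj₁ p - proj₂ p)
  near? (x , y) = + k ∣? α * x - y
  r : ∀ α x y → α * x - - y ≡ α * x + y
  r = solve-∀
  solve-y : ∀ x y t → α * x - y ≡ t * + k → α * x - t * + k ≡ y
  solve-y x y t h = trans (cong (λ z → α * x - z) (sym h)) (r′ (α * x) y)
    where
    r′ : ∀ a y → a - (a - y) ≡ y
    r′ = solve-∀
  back : ∀ x y t → α * x - t * + k ≡ y → P (x , y) → ∃ λ q → Q q × φ q ≡ (x , y)
  back x _ t refl p = from x t p

pair-≡ : ∀ {a a′ b b′ : ℤ} → (a , b) ≡ (a′ , b′) → a ≡ a′ × b ≡ b′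
pair-≡ refl = refl , refl

Principal : ℕ → ℤ → ℤ × ℤ → Set
Principal d N (x , y) = + 1 * (x * x) + + d * (y * y) ≡ N

enumPrincipal : ∀ d .{{_ : ℕ.NonZero d}} N → Enum (Principal d N)
enumPrincipal d N = enumBox (λ { (x , y) → _ ≟ N }) (abs N) (λ {x} {y} e → form-bound d 1 x y e)

module _ (d : ℕ) .{{_ : ℕ.NonZero d}} (M : ℕ) (M≢0 : ¬ M ≡ 0) (no-axis : ∀ y → ¬ (+ d * (y * y) ≡ + M)) where

  private
    On : ℤ × ℤ → Set
    On (x , y) = y ≡ 0ℤ

    on? : Decidable On
    on? (x , y) = y ≟ 0ℤ

    off-axis : (e : Enum (Principal d (+ M))) → 4 ℕD.∣ card (restrict (λ p → ¬? (on? p)) e)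
    off-axis e = klein (restrict (λ p → ¬? (on? p)) e) (λ { (x , y) → - x , y }) (λ { (x , y) → x , - y }) proj₁ proj₂
      (λ { (x , y) → cong (_, y) (ℤP.neg-involutive x) }) (λ { (x , y) → cong (x ,_) (ℤP.neg-involutive y) })
      (λ _ → refl) (λ _ → refl) (λ _ → refl)
      (λ { {x , y} (h , h′) → trans (cong (λ t → + 1 * t + + d * (y * y)) (neg-sq x)) h , h′ })
      (λ { {x , y} (h , h′) → trans (cong (λ t → + 1 * (x * x) + + d * t) (neg-sq y)) h ,
        λ z → h′ (trans (sym (ℤP.neg-involutive y)) (cong -_ z)) })
      (λ { {x , y} (h , _) refl → no-axis y (trans (sym (ℤP.+-identityˡ (+ d * (y * y)))) h) })
      (λ { {x , y} (_ , h) → h })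

    on-norm : ∀ d x → + 1 * (x * x) + d * (0ℤ * 0ℤ) ≡ x * x
    on-norm = solve-∀

    axis-square : (e : Enum (Principal d (+ M))) → IsSquare M → card (restrict on? e) ≡ 2
    axis-square e (k , ek) = trans (card-double pos? (restrict on? e) (λ { (x , y) → - x , y })
        (λ { (x , y) → cong (_, y) (ℤP.neg-involutive x) })
        (λ { {x , y} (h , h′) → trans (cong (λ t → + 1 * t + + d * (y * y)) (neg-sq x)) h , h′ })
        (λ _ → pos-neg)
        (λ { {x , y} (h , h′) → neg-pos (nz x y h h′) }))
      (cong (2 ℕ.*_) (card-one (restrict pos? (restrict on? e)) (+ k , 0ℤ)
        ((trans (on-norm (+ d) (+ k)) ekᶻ , refl) , 0<k)
        (λ { {x , y} ((h , h′) , 0<x) → only x y h h′ 0<x })))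
      where
      ekᶻ : + k * + k ≡ + M
      ekᶻ = trans (sym (ℤP.pos-* k k)) (cong +_ ek)
      pos? : Decidable (λ (p : ℤ × ℤ) → 0ℤ < proj₁ p)
      pos? (x , _) = 0ℤ <? x
      0<k : 0ℤ < + k
      0<k = +<+ (ℕP.n≢0⇒n>0 λ z → M≢0 (trans (sym ek) (cong (λ t → t ℕ.* t) z)))
      nz : ∀ x y → Principal d (+ M) (x , y) → y ≡ 0ℤ → x ≢ 0ℤ
      nz _ _ h refl refl = M≢0 (ℤP.+-injective (trans (sym h) (on-norm (+ d) 0ℤ)))
      only : ∀ x y → Principal d (+ M) (x , y) → y ≡ 0ℤ → 0ℤ < x → (x , y) ≡ (+ k , 0ℤ)
      only x _ h refl 0<x = cong (_, 0ℤ) (pos-sq-inj 0<x 0<k (trans (sym (on-norm (+ d) x)) (trans h (sym ekᶻ))))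

    axis-nonsquare : (e : Enum (Principal d (+ M))) → ¬ IsSquare M → card (restrict on? e) ≡ 0
    axis-nonsquare e no-sq = card-zero (restrict on? e) λ { {x , y} (h , h′) → none x y h h′ }
      where
      none : ∀ x y → Principal d (+ M) (x , y) → y ≡ 0ℤ → ⊥
      none x _ h refl = no-sq (abs x , ℤP.+-injective (trans (sym (sq-abs x)) (trans (sym (on-norm (+ d) x)) h)))

  -- Off the axis y = 0 the sign changes act freely, `no-axis` providing x ≠ 0, so that part is a
  -- multiple of 4. The axis holds the two square roots of `M` or nothing; doubling gives 4 or 0
  -- modulo 8.
  principal : (e : Enum (Principal d (+ M))) → Counts (IsSquare M) (2 ℕ.* card e)
  principal e = (λ sq → subst (λ t → 8 ℕD.∣ 4 ℕ.+ 2 ℕ.* t) (sym (card-split on? e))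
      (subst (λ t → 8 ℕD.∣ 4 ℕ.+ 2 ℕ.* (t ℕ.+ q)) (sym (axis-square e sq))
        (subst (8 ℕD.∣_) (sym (r q)) (ℕD.∣m∣n⇒∣m+n (ℕD.divides 1 refl) (twice q (off-axis e)))))) ,
    (λ no-sq → subst (λ t → 8 ℕD.∣ 2 ℕ.* t) (sym (card-split on? e))
      (subst (λ t → 8 ℕD.∣ 2 ℕ.* (t ℕ.+ q)) (sym (axis-nonsquare e no-sq)) (twice q (off-axis e))))
    where
    q = card (restrict (λ p → ¬? (on? p)) e)
    r : ∀ q → 4 ℕ.+ 2 ℕ.* (2 ℕ.+ q) ≡ 8 ℕ.+ 2 ℕ.* q
    r = solveᴺ-∀

-- Four identities by reduction to principal forms.

8∧3 : ∀ {z} → + 8 ∣ z → + 3 ∣ z → + 24 ∣ z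
8∧3 = Cop-∣∣ (- + 1 , + 3 , refl)

8∧5 : ∀ {z} → + 8 ∣ z → + 5 ∣ z → + 40 ∣ z
8∧5 = Cop-∣∣ (+ 2 , - + 3 , refl)

24∧7 : ∀ {z} → + 24 ∣ z → + 7 ∣ z → + 168 ∣ z
24∧7 = Cop-∣∣ (- + 2 , + 7 , refl)

24∧5 : ∀ {z} → + 24 ∣ z → + 5 ∣ z → + 120 ∣ z
24∧5 = Cop-∣∣ (- + 1 , + 5 , refl)

by : ∀ {d e z} q → + e ≡ q * + d → + e ∣ z → + d ∣ z
by q eq h = ∣-trans (divides q eq) h

-- (6, 8, 24): 3 x² + y² = 4 M with M = 6 n + 1.
module Identity6 where

  -- Multiplication of x + y√-3 by 1 + √-3, of norm 4, with the coefficient of √-3 listed first.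
  φ : ℤ × ℤ → ℤ × ℤ
  φ (x , y) = x + y , x - + 3 * y

  φ-inj : ∀ {q q′} → φ q ≡ φ q′ → q ≡ q′
  φ-inj {x , y} {x′ , y′} h = go (pair-≡ h)
    where
    go : x + y ≡ x′ + y′ × x - + 3 * y ≡ x′ - + 3 * y′ → (x , y) ≡ (x′ , y′)
    go (h₁ , h₂) = cong₂ _,_
      (cancelˡ (+ 4) (λ ()) (lin₂ (+ 3) (+ 1) h₁ h₂ (solve (x ∷ y ∷ x′ ∷ y′ ∷ []))))
      (cancelˡ (+ 4) (λ ()) (lin₂ (+ 1) (- + 1) h₁ h₂ (solve (x ∷ y ∷ x′ ∷ y′ ∷ []))))

  M≡ : ∀ n → + (6 ℕ.* n ℕ.+ 1) ≡ + 6 * + n + 1ℤ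
  M≡ n = cast 6 n

  module _ (n : ℕ) where

    m = + 6 * + n + 1ℤ

    conj : ∀ x y → V 8 24 1ℤ (+ 32 * m) (x , y) → V 8 24 1ℤ (+ 32 * m) (x , - y)
    conj x y (e , d , d′) = trans (cong (λ t → + 24 * (x * x) + + 8 * t) (neg-sq y)) e , d ,
      subst (λ t → + 24 ∣ t - 1ℤ) (sym (neg-sq y)) d′

    one : ∀ x y → V 8 24 1ℤ (+ 32 * m) (x , y) → + 4 ∣ + 1 * x - y → ¬ (+ 4 ∣ + 1 * x + y)
    one x y (_ , d , _) = decide 8 (dv 8 (𝕩 ⊗ 𝕩 ⊖ κ 1ℤ) ⇒ dv 4 (κ (+ 1) ⊗ 𝕩 ⊖ 𝕪) ⇒ ndv 4 (κ (+ 1) ⊗ 𝕩 ⊕ 𝕪)) x y d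

    other : ∀ x y → V 8 24 1ℤ (+ 32 * m) (x , y) → ¬ (+ 4 ∣ + 1 * x - y) → + 4 ∣ + 1 * x + y
    other x y (_ , d , d′) = decide 8 (dv 8 (𝕩 ⊗ 𝕩 ⊖ κ 1ℤ) ⇒ dv 8 (𝕪 ⊗ 𝕪 ⊖ κ 1ℤ) ⇒
      ndv 4 (κ (+ 1) ⊗ 𝕩 ⊖ 𝕪) ⇒ dv 4 (κ (+ 1) ⊗ 𝕩 ⊕ 𝕪)) x y d (by {8} {24} (+ 3) refl d′)

    to : ∀ x y → Principal 3 m (x , y) → V 8 24 1ℤ (+ 32 * m) (φ (x , y)) × + 4 ∣ + 1 * (x + y) - (x - + 3 * y)
    to x y e = (trans (r x y) (cong (+ 32 *_) e) ,
        decide 8 (dv 2 (𝕩 ⊗ 𝕩 ⊕ κ (+ 3) ⊗ (𝕪 ⊗ 𝕪) ⊖ κ 1ℤ) ⇒ dv 8 ((𝕩 ⊕ 𝕪) ⊗ (𝕩 ⊕ 𝕪) ⊖ κ 1ℤ)) x y two ,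
        8∧3 (decide 8 (dv 2 (𝕩 ⊗ 𝕩 ⊕ κ (+ 3) ⊗ (𝕪 ⊗ 𝕪) ⊖ κ 1ℤ) ⇒ dv 8 ((𝕩 ⊖ κ (+ 3) ⊗ 𝕪) ⊗ (𝕩 ⊖ κ (+ 3) ⊗ 𝕪) ⊖ κ 1ℤ)) x y two)
          (decide 3 (dv 3 (𝕩 ⊗ 𝕩 ⊕ κ (+ 3) ⊗ (𝕪 ⊗ 𝕪) ⊖ κ 1ℤ) ⇒ dv 3 ((𝕩 ⊖ κ (+ 3) ⊗ 𝕪) ⊗ (𝕩 ⊖ κ (+ 3) ⊗ 𝕪) ⊖ κ 1ℤ)) x y three)) ,
      divides y (r′ x y)
      where
      r : ∀ x y → + 24 * ((x + y) * (x + y)) + + 8 * ((x - + 3 * y) * (x - + 3 * y)) ≡ + 32 * (+ 1 * (x * x) + + 3 * (y * y))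
      r = solve-∀
      r′ : ∀ x y → + 1 * (x + y) - (x - + 3 * y) ≡ y * + 4
      r′ = solve-∀
      diff : ∀ x y n → + 1 * (x * x) + + 3 * (y * y) ≡ + 6 * n + 1ℤ → x * x + + 3 * (y * y) - 1ℤ ≡ + 6 * n
      diff x y n e = lin 1ℤ e (solve (x ∷ y ∷ n ∷ []))
      six : + 6 ∣ x * x + + 3 * (y * y) - 1ℤ
      six = divides (+ n) (trans (diff x y (+ n) e) (ℤP.*-comm (+ 6) (+ n)))
      two = by {2} {6} (+ 3) refl six
      three = by {3} {6} (+ 2) refl six

    from : ∀ x t → V 8 24 1ℤ (+ 32 * m) (x , + 1 * x - t * + 4) →
      ∃ λ q → Principal 3 m q × φ q ≡ (x , + 1 * x - t * + 4)
    from x t (e , _) = (x - t , t) , cancelˡ (+ 32) (λ ()) (lin 1ℤ e (r x t m)) , cong₂ _,_ (r₁ x t) (r₂ x t)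
      where
      r : ∀ x t m → + 32 * (+ 1 * ((x - t) * (x - t)) + + 3 * (t * t)) - + 32 * m ≡
        1ℤ * (+ 24 * (x * x) + + 8 * ((+ 1 * x - t * + 4) * (+ 1 * x - t * + 4)) - + 32 * m)
      r = solve-∀
      r₁ : ∀ x t → x - t + t ≡ x
      r₁ = solve-∀
      r₂ : ∀ x t → x - t - + 3 * t ≡ + 1 * x - t * + 4
      r₂ = solve-∀

    no-axis : ∀ y → ¬ (+ 3 * (y * y) ≡ + (6 ℕ.* n ℕ.+ 1))
    no-axis y e = decide 3 (dv 3 (κ (+ 3) ⊗ (𝕩 ⊗ 𝕩) ⊖ κ (+ 6) ⊗ 𝕪 ⊖ κ 1ℤ) ⇒ ⊥ᶠ) y (+ n)
      (divides 0ℤ (lin 1ℤ (trans e (M≡ n)) (r y (+ n))))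
      where
      r : ∀ y n → + 3 * (y * y) - + 6 * n - 1ℤ - 0ℤ * + 3 ≡ 1ℤ * (+ 3 * (y * y) - (+ 6 * n + 1ℤ))
      r = solve-∀

    counts : (e : Enum (V 8 24 1ℤ (+ 32 * + (6 ℕ.* n ℕ.+ 1)))) → Counts (IsSquare (6 ℕ.* n ℕ.+ 1)) (card e)
    counts e = subst (Counts (IsSquare (6 ℕ.* n ℕ.+ 1))) (sym half)
      (principal 3 (6 ℕ.* n ℕ.+ 1) (λ z → ℕP.m+1+n≢0 (6 ℕ.* n) z) no-axis eQ)
      where
      eQ = enumPrincipal 3 (+ (6 ℕ.* n ℕ.+ 1))
      move : ∀ {N} → m ≡ N → (e : Enum (V 8 24 1ℤ (+ 32 * N))) (eQ : Enum (Principal 3 N)) → card e ≡ 2 ℕ.* card eQ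
      move refl e eQ = halve-image 4 (+ 1) φ e eQ conj one other φ-inj (λ { {x , y} h → to x y h }) from
      half = move (sym (M≡ n)) e eQ

  identity : f 6 ≡₂ (f 8 ⊛ f 24)
  identity = Bridge.of-counts 6 8 24 refl counts

Norm : ℕ → ℕ → ℤ → ℤ × ℤ → Set
Norm c b N (x , y) = + c * (x * x) + + b * (y * y) ≡ N

form-conj : ∀ c b {N} x y → Norm c b N (x , y) → Norm c b N (x , - y)
form-conj c b x y e = trans (cong (λ t → + c * (x * x) + + b * t) (neg-sq y)) e

∣-diff : ∀ {d A B C} → A ≡ B → d ∣ B - C → d ∣ A - C
∣-diff refl h = h

odd-square : ∀ x → ¬ (+ 2 ∣ x) → + 8 ∣ x * x - 1ℤ
odd-square x = decide 8 (ndv 2 𝕩 ⇒ dv 8 (𝕩 ⊗ 𝕩 ⊖ κ 1ℤ)) x 0ℤ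

square-odd : ∀ x → + 8 ∣ x * x - 1ℤ → ¬ (+ 2 ∣ x)
square-odd x h = decide 8 (dv 8 (𝕩 ⊗ 𝕩 ⊖ κ 1ℤ) ⇒ ndv 2 𝕩) x 0ℤ h

OddSolution : (c b : ℕ) (N : ℤ) → ℤ × ℤ → Set
OddSolution c b N p = Norm c b N p × ¬ (+ 2 ∣ proj₁ p)

enumOddSolution : ∀ c b .{{_ : ℕ.NonZero b}} .{{_ : ℕ.NonZero c}} N → Enum (OddSolution c b N)
enumOddSolution c b N = enumBox (λ { (x , y) → (_ ≟ N) ×-dec ¬? (+ 2 ∣? x) }) (abs N)
  (λ {x} {y} h → form-bound b c x y (proj₁ h))

double-square : ∀ {m} → IsSquare (4 ℕ.* m) → IsSquare m
double-square {m} (k , e) with even-or-odd k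
... | inj₁ (q , refl) = q , ℕP.*-cancelˡ-≡ _ _ 4 (trans (r q) e)
  where
  r : ∀ q → 4 ℕ.* (q ℕ.* q) ≡ q ℕ.* 2 ℕ.* (q ℕ.* 2)
  r = solveᴺ-∀
... | inj₂ (q , refl) = ⊥-elim (0≢1 (trans (sym (m*n%n≡0 (2 ℕ.* m) 2)) (trans (cong (_% 2) (trans (r′ m) (trans (sym e) (r q))))
    (odd%2 (2 ℕ.* q ℕ.* q ℕ.+ 2 ℕ.* q)))))
  where
  r : ∀ q → (1 ℕ.+ q ℕ.* 2) ℕ.* (1 ℕ.+ q ℕ.* 2) ≡ 1 ℕ.+ (2 ℕ.* q ℕ.* q ℕ.+ 2 ℕ.* q) ℕ.* 2
  r = solveᴺ-∀
  r′ : ∀ m → 2 ℕ.* m ℕ.* 2 ≡ 4 ℕ.* m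
  r′ = solveᴺ-∀

square-double : ∀ {m} → IsSquare m → IsSquare (4 ℕ.* m)
square-double (k , refl) = 2 ℕ.* k , r k
  where
  r : ∀ k → 2 ℕ.* k ℕ.* (2 ℕ.* k) ≡ 4 ℕ.* (k ℕ.* k)
  r = solveᴺ-∀

Counts-⇔ : ∀ {S S′ : Set} {n} → (S → S′) → (S′ → S) → Counts S n → Counts S′ n
Counts-⇔ to from (h , h′) = (λ s → h (from s)) , (λ ns → h′ (λ s → ns (to s)))

parity-int : ∀ n → (∃ λ q → n ≡ 2 ℕ.* q) ⊎ ¬ (+ 2 ∣ + n)
parity-int n with even-or-odd n
... | inj₁ (q , refl) = inj₁ (q , ℕP.*-comm q 2)
... | inj₂ (q , refl) = inj₂ λ h → 0≢1 (trans (sym (ev (∣⇒∣ᵤ h))) (odd%2 q))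
  where
  ev : ∀ {n} → 2 ℕD.∣ n → n % 2 ≡ 0
  ev (ℕD.divides q refl) = m*n%n≡0 q 2

square-∣ : ∀ {n} k → k ℕ.* k ≡ n → + k * + k ≡ + n
square-∣ k e = trans (sym (ℤP.pos-* k k)) (cong +_ e)

twice-odd-nonsquare : ∀ {m} → ¬ (+ 2 ∣ + m) → ¬ IsSquare (2 ℕ.* m)
twice-odd-nonsquare {m} h (k , e) = h (decide 4 (dv 4 (κ (+ 2) ⊗ 𝕩) ⇒ dv 2 𝕩) (+ m) 0ℤ (subst (+ 4 ∣_) eq
  (decide 4 (dv 2 (𝕩 ⊗ 𝕩) ⇒ dv 4 (𝕩 ⊗ 𝕩)) (+ k) 0ℤ (subst (+ 2 ∣_) (sym eq) (∣m⇒∣m*n {+ 2} {+ 2} (+ m) ∣-refl)))))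
  where
  eq : + k * + k ≡ + 2 * + m
  eq = trans (square-∣ k e) (ℤP.pos-* 2 m)

odd-sum : ∀ N {A} → A ≡ N → ¬ (+ 2 ∣ N) → ¬ (+ 2 ∣ A)
odd-sum N refl h = h

odd-pred : ∀ z → ¬ (+ 2 ∣ z) → + 16 ∣ + 8 * z - + 8
odd-pred z h = decide 16 (ndv 2 𝕩 ⇒ dv 16 (κ (+ 8) ⊗ 𝕩 ⊖ κ (+ 8))) z 0ℤ h

-- (15, 24, 40): 5 x² + 3 y² = 8 M with M = 15 n + 1.
module Identity15 where

  -- Composition with the representation 8 = 5 · 1² + 3 · 1², the image of (1 , 0): 5 (x + 3y)² + 3
  -- (x - 5y)² = 8 (x² + 15y²).
  φ₁ : ℤ × ℤ → ℤ × ℤ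
  φ₁ (x , y) = x + + 3 * y , x - + 5 * y

  φ₁-inj : ∀ {q q′} → φ₁ q ≡ φ₁ q′ → q ≡ q′
  φ₁-inj {x , y} {x′ , y′} h = go (pair-≡ h)
    where
    go : x + + 3 * y ≡ x′ + + 3 * y′ × x - + 5 * y ≡ x′ - + 5 * y′ → (x , y) ≡ (x′ , y′)
    go (h₁ , h₂) = cong₂ _,_
      (cancelˡ (+ 8) (λ ()) (lin₂ (+ 5) (+ 3) h₁ h₂ (solve (x ∷ y ∷ x′ ∷ y′ ∷ []))))
      (cancelˡ (+ 8) (λ ()) (lin₂ (+ 1) (- + 1) h₁ h₂ (solve (x ∷ y ∷ x′ ∷ y′ ∷ []))))

  half-odd : ∀ m → ¬ (+ 2 ∣ m) → (e : Enum (OddSolution 5 3 (+ 8 * m))) (eQ : Enum (Principal 15 m)) → card e ≡ 2 ℕ.* card eQ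
  half-odd m odd e eQ = halve-image 8 (+ 1) φ₁ e eQ (λ x y h → form-conj 5 3 x y (proj₁ h) , proj₂ h)
    (λ x y h → decide 8 (ndv 2 𝕩 ⇒ dv 8 (κ (+ 1) ⊗ 𝕩 ⊖ 𝕪) ⇒ ndv 8 (κ (+ 1) ⊗ 𝕩 ⊕ 𝕪)) x y (proj₂ h))
    (λ x y h → decide 16 (ndv 2 𝕩 ⇒ dv 16 (κ (+ 5) ⊗ (𝕩 ⊗ 𝕩) ⊕ κ (+ 3) ⊗ (𝕪 ⊗ 𝕪) ⊖ κ (+ 8)) ⇒
      ndv 8 (κ (+ 1) ⊗ 𝕩 ⊖ 𝕪) ⇒ dv 8 (κ (+ 1) ⊗ 𝕩 ⊕ 𝕪)) x y (proj₂ h) (∣-diff (proj₁ h) (odd-pred m odd)))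
    φ₁-inj
    (λ { {x , y} h → (trans (r x y) (cong (+ 8 *_) h) ,
        decide 2 (ndv 2 (κ (+ 1) ⊗ (𝕩 ⊗ 𝕩) ⊕ κ (+ 15) ⊗ (𝕪 ⊗ 𝕪)) ⇒ ndv 2 (𝕩 ⊕ κ (+ 3) ⊗ 𝕪)) x y (odd-sum m h odd)) ,
        divides y (r′ x y) })
    (λ x t h → (x - + 3 * t , t) , cancelˡ (+ 8) (λ ()) (lin 1ℤ (proj₁ h) (r₀ x t m)) , cong₂ _,_ (r₁ x t) (r₂ x t))
    where
    r : ∀ x y → + 5 * ((x + + 3 * y) * (x + + 3 * y)) + + 3 * ((x - + 5 * y) * (x - + 5 * y)) ≡ + 8 * (+ 1 * (x * x) + + 15 * (y * y))
    r = solve-∀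
    r′ : ∀ x y → + 1 * (x + + 3 * y) - (x - + 5 * y) ≡ y * + 8
    r′ = solve-∀
    r₀ : ∀ x t m → + 8 * (+ 1 * ((x - + 3 * t) * (x - + 3 * t)) + + 15 * (t * t)) - + 8 * m ≡
      1ℤ * (+ 5 * (x * x) + + 3 * ((+ 1 * x - t * + 8) * (+ 1 * x - t * + 8)) - + 8 * m)
    r₀ = solve-∀
    r₁ : ∀ x t → x - + 3 * t + + 3 * t ≡ x
    r₁ = solve-∀
    r₂ : ∀ x t → x - + 3 * t - + 5 * t ≡ + 1 * x - t * + 8
    r₂ = solve-∀

  -- The reduced form of discriminant -15 outside the principal class. It takes over when M is even,
  -- where the congruence between the coordinates becomes y ≡ ± 3x (mod 8).
  Middle : ℤ → ℤ × ℤ → Set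
  Middle m (z , t) = + 2 * (z * z) - z * t + + 2 * (t * t) ≡ m × ¬ (+ 2 ∣ z)

  enumMiddle : ∀ m → Enum (Middle m)
  enumMiddle m = enumBox (λ { (z , t) → (_ ≟ m) ×-dec ¬? (+ 2 ∣? z) }) (abs (+ 8 * m))
    (λ {z} {t} h → proj₂ (form-bound 15 1 (+ 4 * t - z) z (trans (r₁ z t) (cong (+ 8 *_) (proj₁ h)))) ,
                   proj₂ (form-bound 15 1 (+ 4 * z - t) t (trans (r₂ z t) (cong (+ 8 *_) (proj₁ h)))))
    where
    r₁ : ∀ z t → + 1 * ((+ 4 * t - z) * (+ 4 * t - z)) + + 15 * (z * z) ≡ + 8 * (+ 2 * (z * z) - z * t + + 2 * (t * t))
    r₁ = solve-∀
    r₂ : ∀ z t → + 1 * ((+ 4 * z - t) * (+ 4 * z - t)) + + 15 * (t * t) ≡ + 8 * (+ 2 * (z * z) - z * t + + 2 * (t * t))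
    r₂ = solve-∀

  φ₂ : ℤ × ℤ → ℤ × ℤ
  φ₂ (z , t) = z + + 2 * t , + 3 * z - + 2 * t

  φ₂-inj : ∀ {q q′} → φ₂ q ≡ φ₂ q′ → q ≡ q′
  φ₂-inj {x , y} {x′ , y′} h = go (pair-≡ h)
    where
    go : x + + 2 * y ≡ x′ + + 2 * y′ × + 3 * x - + 2 * y ≡ + 3 * x′ - + 2 * y′ → (x , y) ≡ (x′ , y′)
    go (h₁ , h₂) = cong₂ _,_
      (cancelˡ (+ 4) (λ ()) (lin₂ (+ 1) (+ 1) h₁ h₂ (solve (x ∷ y ∷ x′ ∷ y′ ∷ []))))
      (cancelˡ (+ 8) (λ ()) (lin₂ (+ 3) (- + 1) h₁ h₂ (solve (x ∷ y ∷ x′ ∷ y′ ∷ []))))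

  half-even : ∀ m → (e : Enum (OddSolution 5 3 (+ 8 * (+ 2 * m)))) (eQ : Enum (Middle m)) → card e ≡ 2 ℕ.* card eQ
  half-even m e eQ = halve-image 8 (+ 3) φ₂ e eQ (λ x y h → form-conj 5 3 x y (proj₁ h) , proj₂ h)
    (λ x y h → decide 8 (ndv 2 𝕩 ⇒ dv 8 (κ (+ 3) ⊗ 𝕩 ⊖ 𝕪) ⇒ ndv 8 (κ (+ 3) ⊗ 𝕩 ⊕ 𝕪)) x y (proj₂ h))
    (λ x y h → decide 16 (ndv 2 𝕩 ⇒ dv 16 (κ (+ 5) ⊗ (𝕩 ⊗ 𝕩) ⊕ κ (+ 3) ⊗ (𝕪 ⊗ 𝕪)) ⇒
      ndv 8 (κ (+ 3) ⊗ 𝕩 ⊖ 𝕪) ⇒ dv 8 (κ (+ 3) ⊗ 𝕩 ⊕ 𝕪)) x y (proj₂ h) (divides m (trans (proj₁ h) (r₃ m))))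
    φ₂-inj
    (λ { {x , y} (h , h′) → (trans (r x y) (trans (cong (+ 16 *_) h) (r₄ m)) ,
        decide 2 (ndv 2 𝕩 ⇒ ndv 2 (𝕩 ⊕ κ (+ 2) ⊗ 𝕪)) x y h′) , divides y (r′ x y) })
    (λ x t h → (x - + 2 * t , t) , (cancelˡ (+ 16) (λ ()) (lin 1ℤ (proj₁ h) (r₀ x t m)) ,
        decide 2 (ndv 2 𝕩 ⇒ ndv 2 (𝕩 ⊖ κ (+ 2) ⊗ 𝕪)) x t (proj₂ h)) , cong₂ _,_ (r₁ x t) (r₂ x t))
    where
    r : ∀ z t → + 5 * ((z + + 2 * t) * (z + + 2 * t)) + + 3 * ((+ 3 * z - + 2 * t) * (+ 3 * z - + 2 * t)) ≡
      + 16 * (+ 2 * (z * z) - z * t + + 2 * (t * t))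
    r = solve-∀
    r′ : ∀ z t → + 3 * (z + + 2 * t) - (+ 3 * z - + 2 * t) ≡ t * + 8
    r′ = solve-∀
    r₀ : ∀ x t m → + 16 * (+ 2 * ((x - + 2 * t) * (x - + 2 * t)) - (x - + 2 * t) * t + + 2 * (t * t)) - + 16 * m ≡
      1ℤ * (+ 5 * (x * x) + + 3 * ((+ 3 * x - t * + 8) * (+ 3 * x - t * + 8)) - + 8 * (+ 2 * m))
    r₀ = solve-∀
    r₁ : ∀ x t → x - + 2 * t + + 2 * t ≡ x
    r₁ = solve-∀
    r₂ : ∀ x t → + 3 * (x - + 2 * t) - + 2 * t ≡ + 3 * x - t * + 8
    r₂ = solve-∀
    r₃ : ∀ m → + 8 * (+ 2 * m) ≡ m * + 16
    r₃ = solve-∀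
    r₄ : ∀ m → + 16 * m ≡ + 8 * (+ 2 * m)
    r₄ = solve-∀

  φ₃ : ℤ × ℤ → ℤ × ℤ
  φ₃ (z , t) = z - t , z + t

  φ₃-inj : ∀ {q q′} → φ₃ q ≡ φ₃ q′ → q ≡ q′
  φ₃-inj {x , y} {x′ , y′} h = go (pair-≡ h)
    where
    go : x - y ≡ x′ - y′ × x + y ≡ x′ + y′ → (x , y) ≡ (x′ , y′)
    go (h₁ , h₂) = cong₂ _,_
      (cancelˡ (+ 2) (λ ()) (lin₂ (+ 1) (+ 1) h₁ h₂ (solve (x ∷ y ∷ x′ ∷ y′ ∷ []))))
      (cancelˡ (+ 2) (λ ()) (lin₂ (- + 1) (+ 1) h₁ h₂ (solve (x ∷ y ∷ x′ ∷ y′ ∷ []))))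

  -- Compared with `half-even` at 2m, both counts are twice the same number: the counts for 4m and
  -- for m agree, which is the descent at the prime 2.
  half-quarter : ∀ m → (e : Enum (OddSolution 5 3 (+ 8 * m))) (eQ : Enum (Middle (+ 2 * m))) → card e ≡ 2 ℕ.* card eQ
  half-quarter m e eQ = halve-image 4 (+ 1) φ₃ e eQ (λ x y h → form-conj 5 3 x y (proj₁ h) , proj₂ h)
    (λ x y h → decide 4 (ndv 2 𝕩 ⇒ dv 4 (κ (+ 1) ⊗ 𝕩 ⊖ 𝕪) ⇒ ndv 4 (κ (+ 1) ⊗ 𝕩 ⊕ 𝕪)) x y (proj₂ h))
    (λ x y h → decide 8 (ndv 2 𝕩 ⇒ dv 8 (κ (+ 5) ⊗ (𝕩 ⊗ 𝕩) ⊕ κ (+ 3) ⊗ (𝕪 ⊗ 𝕪)) ⇒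
      ndv 4 (κ (+ 1) ⊗ 𝕩 ⊖ 𝕪) ⇒ dv 4 (κ (+ 1) ⊗ 𝕩 ⊕ 𝕪)) x y (proj₂ h) (divides m (trans (proj₁ h) (ℤP.*-comm (+ 8) m))))
    φ₃-inj
    (λ { {z , t} (h , h′) → (trans (r z t) (trans (cong (+ 4 *_) h) (r₄ m)) , odd z t h h′) , four z t (even-t z t h h′) })
    (λ x t h → (x - + 2 * t , - (+ 2 * t)) , (cancelˡ (+ 4) (λ ()) (lin 1ℤ (proj₁ h) (r₀ x t m)) ,
        decide 2 (ndv 2 𝕩 ⇒ ndv 2 (𝕩 ⊖ κ (+ 2) ⊗ 𝕪)) x t (proj₂ h)) , cong₂ _,_ (r₁ x t) (r₂ x t))
    where
    r : ∀ z t → + 5 * ((z - t) * (z - t)) + + 3 * ((z + t) * (z + t)) ≡ + 4 * (+ 2 * (z * z) - z * t + + 2 * (t * t))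
    r = solve-∀
    even-t : ∀ z t → + 2 * (z * z) - z * t + + 2 * (t * t) ≡ + 2 * m → ¬ (+ 2 ∣ z) → + 2 ∣ t
    even-t z t h h′ = decide 2 (dv 2 (κ (+ 2) ⊗ (𝕩 ⊗ 𝕩) ⊖ 𝕩 ⊗ 𝕪 ⊕ κ (+ 2) ⊗ (𝕪 ⊗ 𝕪)) ⇒ ndv 2 𝕩 ⇒ dv 2 𝕪) z t
      (divides m (trans h (ℤP.*-comm (+ 2) m))) h′
    odd : ∀ z t → + 2 * (z * z) - z * t + + 2 * (t * t) ≡ + 2 * m → ¬ (+ 2 ∣ z) → ¬ (+ 2 ∣ z - t)
    odd z t h h′ = decide 2 (ndv 2 𝕩 ⇒ dv 2 𝕪 ⇒ ndv 2 (𝕩 ⊖ 𝕪)) z t h′ (even-t z t h h′)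
    four : ∀ z t → + 2 ∣ t → + 4 ∣ + 1 * (z - t) - (z + t)
    four = decide 4 (dv 2 𝕪 ⇒ dv 4 (κ (+ 1) ⊗ (𝕩 ⊖ 𝕪) ⊖ (𝕩 ⊕ 𝕪)))
    r₀ : ∀ x t m → + 4 * (+ 2 * ((x - + 2 * t) * (x - + 2 * t)) - (x - + 2 * t) * - (+ 2 * t) + + 2 * (- (+ 2 * t) * - (+ 2 * t)))
      - + 4 * (+ 2 * m) ≡ 1ℤ * (+ 5 * (x * x) + + 3 * ((+ 1 * x - t * + 4) * (+ 1 * x - t * + 4)) - + 8 * m)
    r₀ = solve-∀
    r₁ : ∀ x t → x - + 2 * t - - (+ 2 * t) ≡ x
    r₁ = solve-∀
    r₂ : ∀ x t → x - + 2 * t + - (+ 2 * t) ≡ + 1 * x - t * + 4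
    r₂ = solve-∀
    r₄ : ∀ m → + 4 * (+ 2 * m) ≡ + 8 * m
    r₄ = solve-∀

  -- The form is symmetric under exchange of its variables, with or without a common sign change. On
  -- the fixed lines z = t and z = - t its values are 3z² and 5z², which the hypotheses exclude.
  middle-even : ∀ m → ¬ (+ 2 ∣ m) → ¬ (+ 3 ∣ m) → ¬ (+ 5 ∣ m) → (e : Enum (Middle m)) → 4 ℕD.∣ card e
  middle-even m odd 3∤ 5∤ e = klein e (λ { (z , t) → t , z }) (λ { (z , t) → - t , - z })
    (λ { (z , t) → z - t }) (λ { (z , t) → z + t })
    (λ _ → refl) (λ { (z , t) → cong₂ _,_ (ℤP.neg-involutive z) (ℤP.neg-involutive t) })
    (λ { (z , t) → r₁ z t }) (λ { (z , t) → r₂ z t }) (λ { (z , t) → r₃ z t })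
    (λ { {z , t} (h , h′) → trans (r₄ z t) h , odd-t z t h })
    (λ { {z , t} (h , h′) → trans (r₅ z t) h , decide 2 (ndv 2 𝕩 ⇒ ndv 2 (κ 0ℤ ⊖ 𝕩)) t 0ℤ (odd-t z t h) ∘ subst (+ 2 ∣_) (sym (ℤP.+-identityˡ (- t))) })
    (λ { {z , t} (h , _) d → 3∤ (divides (z * z) (trans (sym h) (r₆ z t d))) })
    (λ { {z , t} (h , _) d → 5∤ (divides (z * z) (trans (sym h) (r₇ z t d))) })
    where
    odd-t : ∀ z t → + 2 * (z * z) - z * t + + 2 * (t * t) ≡ m → ¬ (+ 2 ∣ t)
    odd-t z t h = decide 2 (ndv 2 (κ (+ 2) ⊗ (𝕩 ⊗ 𝕩) ⊖ 𝕩 ⊗ 𝕪 ⊕ κ (+ 2) ⊗ (𝕪 ⊗ 𝕪)) ⇒ ndv 2 𝕪) z t (odd-sum m h odd)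
    r₁ : ∀ z t → t - z ≡ - (z - t)
    r₁ = solve-∀
    r₂ : ∀ z t → - t - - z ≡ z - t
    r₂ = solve-∀
    r₃ : ∀ z t → - t + - z ≡ - (z + t)
    r₃ = solve-∀
    r₄ : ∀ z t → + 2 * (t * t) - t * z + + 2 * (z * z) ≡ + 2 * (z * z) - z * t + + 2 * (t * t)
    r₄ = solve-∀
    r₅ : ∀ z t → + 2 * (- t * - t) - - t * - z + + 2 * (- z * - z) ≡ + 2 * (z * z) - z * t + + 2 * (t * t)
    r₅ = solve-∀
    r₆ : ∀ z t → z - t ≡ 0ℤ → + 2 * (z * z) - z * t + + 2 * (t * t) ≡ z * z * + 3
    r₆ z t d = lin (- z - + 2 * t) d (solve (z ∷ t ∷ []))
    r₇ : ∀ z t → z + t ≡ 0ℤ → + 2 * (z * z) - z * t + + 2 * (t * t) ≡ z * z * + 5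
    r₇ z t d = lin (+ 2 * t - + 3 * z) d (solve (z ∷ t ∷ []))

  Claim : ℕ → Set
  Claim M = ¬ M ≡ 0 → ¬ (+ 3 ∣ + M) → ¬ (+ 5 ∣ + M) → ∀ {N} → N ≡ + M → (e : Enum (OddSolution 5 3 (+ 8 * N))) → Counts (IsSquare M) (card e)

  -- For odd M the principal form decides. For M twice an odd number there is no square, and
  -- `middle-even` gives 8. For M divisible by 4 the factor 4 is removed, which affects neither the
  -- count nor being a square.
  claim : ∀ M → Claim M
  claim = <-rec _ λ M rec → by-parity M (λ {k} → rec {k}) (parity-int M)
    where
    ∤half : ∀ {d m} → ¬ (+ d ∣ + (2 ℕ.* m)) → ¬ (+ d ∣ + m)
    ∤half {d} {m} h h′ = h (subst (+ d ∣_) (sym (ℤP.pos-* 2 m)) (∣n⇒∣m*n (+ 2) h′))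
    by-parity : ∀ M → (∀ {k} → k ℕ.< M → Claim k) → (∃ λ q → M ≡ 2 ℕ.* q) ⊎ ¬ (+ 2 ∣ + M) → Claim M
    by-parity M rec (inj₂ odd) M≢0 3∤ 5∤ refl e = subst (Counts (IsSquare M)) (sym (half-odd (+ M) odd e (enumPrincipal 15 (+ M))))
      (principal 15 M M≢0 (λ y h → 3∤ (subst (+ 3 ∣_) h (divides (+ 5 * (y * y)) (r y)))) (enumPrincipal 15 (+ M)))
      where
      r : ∀ y → + 15 * (y * y) ≡ + 5 * (y * y) * + 3
      r = solve-∀
    by-parity .(2 ℕ.* m) rec (inj₁ (m , refl)) M≢0 3∤ 5∤ {N} eN e = by-half (parity-int m)
      where
      eN′ : N ≡ + 2 * + m
      eN′ = trans eN (ℤP.pos-* 2 m)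
      half : card e ≡ 2 ℕ.* card (enumMiddle (+ m))
      half = at eN′ e
        where
        at : ∀ {N} → N ≡ + 2 * + m → (e : Enum (OddSolution 5 3 (+ 8 * N))) → card e ≡ 2 ℕ.* card (enumMiddle (+ m))
        at refl e = half-even (+ m) e (enumMiddle (+ m))
      by-half : (∃ λ q → m ≡ 2 ℕ.* q) ⊎ ¬ (+ 2 ∣ + m) → Counts (IsSquare (2 ℕ.* m)) (card e)
      by-half (inj₂ odd) = (λ sq → ⊥-elim (twice-odd-nonsquare odd sq)) , (λ _ → subst (8 ℕD.∣_) (sym half)
        (twice (card (enumMiddle (+ m))) (middle-even (+ m) odd (∤half {3} {m} 3∤) (∤half {5} {m} 5∤) (enumMiddle (+ m)))))
      by-half (inj₁ (q , mq)) = quarter q mq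
        where
        quarter : ∀ q → m ≡ 2 ℕ.* q → Counts (IsSquare (2 ℕ.* m)) (card e)
        quarter q refl = subst (Counts (IsSquare (2 ℕ.* m))) (sym same)
          (Counts-⇔ (λ s → subst IsSquare (r q) (square-double s)) (λ s → double-square (subst IsSquare (sym (r q)) s))
            (rec q<M (λ z → M≢0 (cong (λ t → 2 ℕ.* (2 ℕ.* t)) z)) (∤half {3} {q} (∤half {3} {m} 3∤)) (∤half {5} {q} (∤half {5} {m} 5∤)) refl e′))
          where
          r : ∀ q → 4 ℕ.* q ≡ 2 ℕ.* (2 ℕ.* q)
          r = solveᴺ-∀
          q<M : q ℕ.< 2 ℕ.* (2 ℕ.* q)
          q<M = ℕP.<-≤-trans (ℕP.m<m*n q 4 {{ℕ.≢-nonZero λ z → M≢0 (cong (λ t → 2 ℕ.* (2 ℕ.* t)) z)}} (s≤s (s≤s z≤n)))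
            (ℕP.≤-reflexive (trans (ℕP.*-comm q 4) (r q)))
          e′ = enumOddSolution 5 3 (+ 8 * + q)
          same : card e ≡ card e′
          same = trans half (sym (at (ℤP.pos-* 2 q) (enumMiddle (+ (2 ℕ.* q)))))
            where
            at : ∀ {N} → N ≡ + 2 * + q → (eM : Enum (Middle N)) → card e′ ≡ 2 ℕ.* card eM
            at refl eM = half-quarter (+ q) e′ eM

  module _ (n : ℕ) where

    m = + 15 * + n + 1ℤ

    diff : ∀ A n → A ≡ + 8 * (+ 15 * n + 1ℤ) → A - + 8 ≡ n * + 120
    diff A n e = lin 1ℤ e (solve (A ∷ n ∷ []))

    to : ∀ x y → V 24 40 1ℤ (+ 64 * m) (x , y) → OddSolution 5 3 (+ 8 * m) (x , y)
    to x y (e , d , _) = cancelˡ (+ 8) (λ ()) (lin 1ℤ e (r x y m)) , square-odd x (by {8} {24} (+ 3) refl d)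
      where
      r : ∀ x y m → + 8 * (+ 5 * (x * x) + + 3 * (y * y)) - + 8 * (+ 8 * m) ≡ 1ℤ * (+ 40 * (x * x) + + 24 * (y * y) - + 64 * m)
      r = solve-∀

    from : ∀ x y → OddSolution 5 3 (+ 8 * m) (x , y) → V 24 40 1ℤ (+ 64 * m) (x , y)
    from x y (e , h) = trans (r x y) (trans (cong (+ 8 *_) e) (r′ m)) ,
      8∧3 (odd-square x h) (decide 3 (dv 3 (κ (+ 5) ⊗ (𝕩 ⊗ 𝕩) ⊕ κ (+ 3) ⊗ (𝕪 ⊗ 𝕪) ⊖ κ (+ 8)) ⇒ dv 3 (𝕩 ⊗ 𝕩 ⊖ κ 1ℤ)) x y (by {3} {120} (+ 40) refl d)) ,
      8∧5 (decide 8 (ndv 2 𝕩 ⇒ dv 8 (κ (+ 5) ⊗ (𝕩 ⊗ 𝕩) ⊕ κ (+ 3) ⊗ (𝕪 ⊗ 𝕪) ⊖ κ (+ 8)) ⇒ dv 8 (𝕪 ⊗ 𝕪 ⊖ κ 1ℤ)) x y h (by {8} {120} (+ 15) refl d))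
          (decide 5 (dv 5 (κ (+ 5) ⊗ (𝕩 ⊗ 𝕩) ⊕ κ (+ 3) ⊗ (𝕪 ⊗ 𝕪) ⊖ κ (+ 8)) ⇒ dv 5 (𝕪 ⊗ 𝕪 ⊖ κ 1ℤ)) x y (by {5} {120} (+ 24) refl d))
      where
      r : ∀ x y → + 40 * (x * x) + + 24 * (y * y) ≡ + 8 * (+ 5 * (x * x) + + 3 * (y * y))
      r = solve-∀
      r′ : ∀ m → + 8 * (+ 8 * m) ≡ + 64 * m
      r′ = solve-∀
      d : + 120 ∣ + 5 * (x * x) + + 3 * (y * y) - + 8
      d = divides (+ n) (diff (+ 5 * (x * x) + + 3 * (y * y)) (+ n) e)

    counts : (e : Enum (V 24 40 1ℤ (+ 64 * + (15 ℕ.* n ℕ.+ 1)))) → Counts (IsSquare (15 ℕ.* n ℕ.+ 1)) (card e)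
    counts e = subst (Counts (IsSquare (15 ℕ.* n ℕ.+ 1))) (sym (move (sym (cast 15 n)) e))
      (claim (15 ℕ.* n ℕ.+ 1) (λ z → ℕP.m+1+n≢0 (15 ℕ.* n) z) (unit 3 (+ 5 * + n) (λ ()) r₃) (unit 5 (+ 3 * + n) (λ ()) r₅)
        (sym (cast 15 n)) (enumOddSolution 5 3 (+ 8 * m)))
      where
      move : ∀ {N} → m ≡ N → (e : Enum (V 24 40 1ℤ (+ 64 * N))) → card e ≡ card (enumOddSolution 5 3 (+ 8 * m))
      move refl e = card-⇔ e (enumOddSolution 5 3 (+ 8 * m)) (λ { {x , y} → to x y }) (λ { {x , y} → from x y })
      unit : ∀ d q → ¬ d ≡ 1 → + (15 ℕ.* n ℕ.+ 1) ≡ q * + d + 1ℤ → ¬ (+ d ∣ + (15 ℕ.* n ℕ.+ 1))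
      unit d q d≢1 eq h = d≢1 (∣1⇒ (∣-by (∣m∣n⇒∣m-n (subst (+ d ∣_) eq h) (∣n⇒∣m*n q ∣-refl)) (s (q * + d))))
        where
        s : ∀ z → z + 1ℤ - z ≡ 1ℤ
        s = solve-∀
      r₃ : + (15 ℕ.* n ℕ.+ 1) ≡ + 5 * + n * + 3 + 1ℤ
      r₃ = trans (cast 15 n) (s (+ n))
        where
        s : ∀ n → + 15 * n + 1ℤ ≡ + 5 * n * + 3 + 1ℤ
        s = solve-∀
      r₅ : + (15 ℕ.* n ℕ.+ 1) ≡ + 3 * + n * + 5 + 1ℤ
      r₅ = trans (cast 15 n) (s (+ n))
        where
        s : ∀ n → + 15 * n + 1ℤ ≡ + 3 * n * + 5 + 1ℤ
        s = solve-∀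

  identity : f 15 ≡₂ (f 24 ⊛ f 40)
  identity = Bridge.of-counts 15 24 40 refl counts

m<n*m : ∀ m n .{{_ : ℕ.NonZero m}} → 1 ℕ.< n → m ℕ.< n ℕ.* m
m<n*m m n h = subst (m ℕ.<_) (ℕP.*-comm m n) (ℕP.m<m*n m n h)

coprime-unit : ∀ a n d q → ¬ d ≡ 1 → + a ≡ q * + d → ¬ (+ d ∣ + (a ℕ.* n ℕ.+ 1))
coprime-unit a n d q d≢1 eq h = d≢1 (∣1⇒ (∣-by (∣m∣n⇒∣m-n (subst (+ d ∣_) (cast a n) h)
  (∣m⇒∣m*n {+ d} {+ a} (+ n) (divides q eq))) (s (+ a * + n))))
  where
  s : ∀ z → z + 1ℤ - z ≡ 1ℤ
  s = solve-∀

-- (21, 24, 168): 7 x² + y² = 8 M with M = 21 n + 1.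
module Identity21 where

  -- Multiplication of x + y√-7 by 1 + √-7, of norm 8, again with the coefficient of the root first.
  φ₁ : ℤ × ℤ → ℤ × ℤ
  φ₁ (x , y) = x + y , x - + 7 * y

  φ₁-inj : ∀ {q q′} → φ₁ q ≡ φ₁ q′ → q ≡ q′
  φ₁-inj {x , y} {x′ , y′} h = go (pair-≡ h)
    where
    go : x + y ≡ x′ + y′ × x - + 7 * y ≡ x′ - + 7 * y′ → (x , y) ≡ (x′ , y′)
    go (h₁ , h₂) = cong₂ _,_
      (cancelˡ (+ 8) (λ ()) (lin₂ (+ 7) (+ 1) h₁ h₂ (solve (x ∷ y ∷ x′ ∷ y′ ∷ []))))
      (cancelˡ (+ 8) (λ ()) (lin₂ (+ 1) (- + 1) h₁ h₂ (solve (x ∷ y ∷ x′ ∷ y′ ∷ []))))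

  half-odd : ∀ m → ¬ (+ 2 ∣ m) → (e : Enum (OddSolution 7 1 (+ 8 * m))) (eQ : Enum (Principal 7 m)) → card e ≡ 2 ℕ.* card eQ
  half-odd m odd e eQ = halve-image 8 (+ 1) φ₁ e eQ (λ x y h → form-conj 7 1 x y (proj₁ h) , proj₂ h)
    (λ x y h → decide 8 (ndv 2 𝕩 ⇒ dv 8 (κ (+ 1) ⊗ 𝕩 ⊖ 𝕪) ⇒ ndv 8 (κ (+ 1) ⊗ 𝕩 ⊕ 𝕪)) x y (proj₂ h))
    (λ x y h → decide 16 (ndv 2 𝕩 ⇒ dv 16 (κ (+ 7) ⊗ (𝕩 ⊗ 𝕩) ⊕ κ (+ 1) ⊗ (𝕪 ⊗ 𝕪) ⊖ κ (+ 8)) ⇒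
      ndv 8 (κ (+ 1) ⊗ 𝕩 ⊖ 𝕪) ⇒ dv 8 (κ (+ 1) ⊗ 𝕩 ⊕ 𝕪)) x y (proj₂ h) (∣-diff (proj₁ h) (odd-pred m odd)))
    φ₁-inj
    (λ { {x , y} h → (trans (r x y) (cong (+ 8 *_) h) ,
        decide 2 (ndv 2 (κ (+ 1) ⊗ (𝕩 ⊗ 𝕩) ⊕ κ (+ 7) ⊗ (𝕪 ⊗ 𝕪)) ⇒ ndv 2 (𝕩 ⊕ 𝕪)) x y (odd-sum m h odd)) ,
        divides y (r′ x y) })
    (λ x t h → (x - t , t) , cancelˡ (+ 8) (λ ()) (lin 1ℤ (proj₁ h) (r₀ x t m)) , cong₂ _,_ (r₁ x t) (r₂ x t))
    where
    r : ∀ x y → + 7 * ((x + y) * (x + y)) + + 1 * ((x - + 7 * y) * (x - + 7 * y)) ≡ + 8 * (+ 1 * (x * x) + + 7 * (y * y))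
    r = solve-∀
    r′ : ∀ x y → + 1 * (x + y) - (x - + 7 * y) ≡ y * + 8
    r′ = solve-∀
    r₀ : ∀ x t m → + 8 * (+ 1 * ((x - t) * (x - t)) + + 7 * (t * t)) - + 8 * m ≡
      1ℤ * (+ 7 * (x * x) + + 1 * ((+ 1 * x - t * + 8) * (+ 1 * x - t * + 8)) - + 8 * m)
    r₀ = solve-∀
    r₁ : ∀ x t → x - t + t ≡ x
    r₁ = solve-∀
    r₂ : ∀ x t → x - t - + 7 * t ≡ + 1 * x - t * + 8
    r₂ = solve-∀

  Middle : ℤ → ℤ × ℤ → Set
  Middle m (z , t) = z * z - z * t + + 2 * (t * t) ≡ m × ¬ (+ 2 ∣ z)

  enumMiddle : ∀ m → Enum (Middle m)
  enumMiddle m = enumBox (λ { (z , t) → (_ ≟ m) ×-dec ¬? (+ 2 ∣? z) }) (abs (+ 8 * m))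
    (λ {z} {t} h → proj₂ (form-bound 7 1 (+ 4 * t - z) z (trans (r₁ z t) (cong (+ 8 *_) (proj₁ h)))) ,
                   proj₂ (form-bound 14 2 (+ 2 * z - t) t (trans (r₂ z t) (cong (+ 8 *_) (proj₁ h)))))
    where
    r₁ : ∀ z t → + 1 * ((+ 4 * t - z) * (+ 4 * t - z)) + + 7 * (z * z) ≡ + 8 * (z * z - z * t + + 2 * (t * t))
    r₁ = solve-∀
    r₂ : ∀ z t → + 2 * ((+ 2 * z - t) * (+ 2 * z - t)) + + 14 * (t * t) ≡ + 8 * (z * z - z * t + + 2 * (t * t))
    r₂ = solve-∀

  φ₂ : ℤ × ℤ → ℤ × ℤ
  φ₂ (z , t) = z - + 2 * t , + 3 * z + + 2 * t

  φ₂-inj : ∀ {q q′} → φ₂ q ≡ φ₂ q′ → q ≡ q′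
  φ₂-inj {x , y} {x′ , y′} h = go (pair-≡ h)
    where
    go : x - + 2 * y ≡ x′ - + 2 * y′ × + 3 * x + + 2 * y ≡ + 3 * x′ + + 2 * y′ → (x , y) ≡ (x′ , y′)
    go (h₁ , h₂) = cong₂ _,_
      (cancelˡ (+ 4) (λ ()) (lin₂ (+ 1) (+ 1) h₁ h₂ (solve (x ∷ y ∷ x′ ∷ y′ ∷ []))))
      (cancelˡ (+ 8) (λ ()) (lin₂ (- + 3) (+ 1) h₁ h₂ (solve (x ∷ y ∷ x′ ∷ y′ ∷ []))))

  half-even : ∀ m → (e : Enum (OddSolution 7 1 (+ 8 * (+ 2 * m)))) (eQ : Enum (Middle m)) → card e ≡ 2 ℕ.* card eQ
  half-even m e eQ = halve-image 8 (+ 3) φ₂ e eQ (λ x y h → form-conj 7 1 x y (proj₁ h) , proj₂ h)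
    (λ x y h → decide 8 (ndv 2 𝕩 ⇒ dv 8 (κ (+ 3) ⊗ 𝕩 ⊖ 𝕪) ⇒ ndv 8 (κ (+ 3) ⊗ 𝕩 ⊕ 𝕪)) x y (proj₂ h))
    (λ x y h → decide 16 (ndv 2 𝕩 ⇒ dv 16 (κ (+ 7) ⊗ (𝕩 ⊗ 𝕩) ⊕ κ (+ 1) ⊗ (𝕪 ⊗ 𝕪)) ⇒
      ndv 8 (κ (+ 3) ⊗ 𝕩 ⊖ 𝕪) ⇒ dv 8 (κ (+ 3) ⊗ 𝕩 ⊕ 𝕪)) x y (proj₂ h) (divides m (trans (proj₁ h) (r₃ m))))
    φ₂-inj
    (λ { {x , y} (h , h′) → (trans (r x y) (trans (cong (+ 16 *_) h) (r₄ m)) ,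
        decide 2 (ndv 2 𝕩 ⇒ ndv 2 (𝕩 ⊖ κ (+ 2) ⊗ 𝕪)) x y h′) , divides (- y) (r′ x y) })
    (λ x t h → (x - + 2 * t , - t) , (cancelˡ (+ 16) (λ ()) (lin 1ℤ (proj₁ h) (r₀ x t m)) ,
        decide 2 (ndv 2 𝕩 ⇒ ndv 2 (𝕩 ⊖ κ (+ 2) ⊗ 𝕪)) x t (proj₂ h)) , cong₂ _,_ (r₁ x t) (r₂ x t))
    where
    r : ∀ z t → + 7 * ((z - + 2 * t) * (z - + 2 * t)) + + 1 * ((+ 3 * z + + 2 * t) * (+ 3 * z + + 2 * t)) ≡
      + 16 * (z * z - z * t + + 2 * (t * t))
    r = solve-∀
    r′ : ∀ z t → + 3 * (z - + 2 * t) - (+ 3 * z + + 2 * t) ≡ - t * + 8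
    r′ = solve-∀
    r₀ : ∀ x t m → + 16 * ((x - + 2 * t) * (x - + 2 * t) - (x - + 2 * t) * - t + + 2 * (- t * - t)) - + 16 * m ≡
      1ℤ * (+ 7 * (x * x) + + 1 * ((+ 3 * x - t * + 8) * (+ 3 * x - t * + 8)) - + 8 * (+ 2 * m))
    r₀ = solve-∀
    r₁ : ∀ x t → x - + 2 * t - + 2 * - t ≡ x
    r₁ = solve-∀
    r₂ : ∀ x t → + 3 * (x - + 2 * t) + + 2 * - t ≡ + 3 * x - t * + 8
    r₂ = solve-∀
    r₃ : ∀ m → + 8 * (+ 2 * m) ≡ m * + 16
    r₃ = solve-∀
    r₄ : ∀ m → + 16 * m ≡ + 8 * (+ 2 * m)
    r₄ = solve-∀

  φ₃ : ℤ × ℤ → ℤ × ℤ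
  φ₃ (z , t) = z , z - + 4 * t

  φ₃-inj : ∀ {q q′} → φ₃ q ≡ φ₃ q′ → q ≡ q′
  φ₃-inj {x , y} {x′ , y′} h = go (pair-≡ h)
    where
    go : x ≡ x′ × x - + 4 * y ≡ x′ - + 4 * y′ → (x , y) ≡ (x′ , y′)
    go (h₁ , h₂) = cong₂ _,_ h₁
      (cancelˡ (+ 4) (λ ()) (lin₂ (+ 1) (- + 1) h₁ h₂ (solve (x ∷ y ∷ x′ ∷ y′ ∷ []))))

  -- The set `Middle m` is the one of `half-even`, so here already the counts for 2m and m agree and
  -- a single factor 2 is removed at each step. For this reason the criterion admits twice a square.
  half-quarter : ∀ m → (e : Enum (OddSolution 7 1 (+ 8 * m))) (eQ : Enum (Middle m)) → card e ≡ 2 ℕ.* card eQ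
  half-quarter m e eQ = halve-image 4 (+ 1) φ₃ e eQ (λ x y h → form-conj 7 1 x y (proj₁ h) , proj₂ h)
    (λ x y h → decide 4 (ndv 2 𝕩 ⇒ dv 4 (κ (+ 1) ⊗ 𝕩 ⊖ 𝕪) ⇒ ndv 4 (κ (+ 1) ⊗ 𝕩 ⊕ 𝕪)) x y (proj₂ h))
    (λ x y h → decide 8 (ndv 2 𝕩 ⇒ dv 8 (κ (+ 7) ⊗ (𝕩 ⊗ 𝕩) ⊕ κ (+ 1) ⊗ (𝕪 ⊗ 𝕪)) ⇒
      ndv 4 (κ (+ 1) ⊗ 𝕩 ⊖ 𝕪) ⇒ dv 4 (κ (+ 1) ⊗ 𝕩 ⊕ 𝕪)) x y (proj₂ h) (divides m (trans (proj₁ h) (ℤP.*-comm (+ 8) m))))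
    φ₃-inj
    (λ { {z , t} (h , h′) → (trans (r z t) (cong (+ 8 *_) h) , h′) , divides t (r′ z t) })
    (λ x t h → (x , t) , (cancelˡ (+ 8) (λ ()) (lin 1ℤ (proj₁ h) (r₀ x t m)) , proj₂ h) , cong (x ,_) (r₂ x t))
    where
    r : ∀ z t → + 7 * (z * z) + + 1 * ((z - + 4 * t) * (z - + 4 * t)) ≡ + 8 * (z * z - z * t + + 2 * (t * t))
    r = solve-∀
    r′ : ∀ z t → + 1 * z - (z - + 4 * t) ≡ t * + 4
    r′ = solve-∀
    r₀ : ∀ x t m → + 8 * (x * x - x * t + + 2 * (t * t)) - + 8 * m ≡
      1ℤ * (+ 7 * (x * x) + + 1 * ((+ 1 * x - t * + 4) * (+ 1 * x - t * + 4)) - + 8 * m)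
    r₀ = solve-∀
    r₂ : ∀ x t → x - + 4 * t ≡ + 1 * x - t * + 4
    r₂ = solve-∀

  -- The count is odd exactly when the odd part of M is a square.
  SquareOrTwice : ℕ → Set
  SquareOrTwice M = IsSquare M ⊎ IsSquare (2 ℕ.* M)

  Claim : ℕ → Set
  Claim M = ¬ M ≡ 0 → ¬ (+ 7 ∣ + M) → ∀ {N} → N ≡ + M → (e : Enum (OddSolution 7 1 (+ 8 * N))) → Counts (SquareOrTwice M) (card e)

  claim : ∀ M → Claim M
  claim = <-rec _ λ M rec → by-parity M (λ {k} → rec {k}) (parity-int M)
    where
    by-parity : ∀ M → (∀ {k} → k ℕ.< M → Claim k) → (∃ λ q → M ≡ 2 ℕ.* q) ⊎ ¬ (+ 2 ∣ + M) → Claim M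
    by-parity M rec (inj₂ odd) M≢0 7∤ refl e = Counts-⇔ inj₁ [ id , (λ h → ⊥-elim (twice-odd-nonsquare odd h)) ]′
      (subst (Counts (IsSquare M)) (sym (half-odd (+ M) odd e (enumPrincipal 7 (+ M))))
        (principal 7 M M≢0 (λ y h → 7∤ (subst (+ 7 ∣_) h (divides (y * y) (ℤP.*-comm (+ 7) (y * y))))) (enumPrincipal 7 (+ M))))
    by-parity .(2 ℕ.* m) rec (inj₁ (m , refl)) M≢0 7∤ {N} eN e = subst (Counts (SquareOrTwice (2 ℕ.* m))) (sym same)
      (Counts-⇔ [ (λ s → inj₂ (subst IsSquare (r m) (square-double s))) , inj₁ ]′
        [ inj₂ , (λ s → inj₁ (double-square (subst IsSquare (sym (r m)) s))) ]′
        (rec (m<n*m m 2 {{ℕ.≢-nonZero m≢0}} (s≤s (s≤s z≤n))) m≢0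
          (λ h → 7∤ (subst (+ 7 ∣_) (sym (ℤP.pos-* 2 m)) (∣n⇒∣m*n (+ 2) h))) refl e′))
      where
      m≢0 : ¬ m ≡ 0
      m≢0 z = M≢0 (cong (2 ℕ.*_) z)
      r : ∀ m → 4 ℕ.* m ≡ 2 ℕ.* (2 ℕ.* m)
      r = solveᴺ-∀
      e′ = enumOddSolution 7 1 (+ 8 * + m)
      half : card e ≡ 2 ℕ.* card (enumMiddle (+ m))
      half = at (trans eN (ℤP.pos-* 2 m)) e
        where
        at : ∀ {N} → N ≡ + 2 * + m → (e : Enum (OddSolution 7 1 (+ 8 * N))) → card e ≡ 2 ℕ.* card (enumMiddle (+ m))
        at refl e = half-even (+ m) e (enumMiddle (+ m))
      same : card e ≡ card e′
      same = trans half (sym (half-quarter (+ m) e′ (enumMiddle (+ m))))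

  module _ (n : ℕ) where

    m = + 21 * + n + 1ℤ

    diff : ∀ A n → A ≡ + 8 * (+ 21 * n + 1ℤ) → A - + 8 ≡ n * + 168
    diff A n e = lin 1ℤ e (solve (A ∷ n ∷ []))

    to : ∀ x y → V 24 168 1ℤ (+ 192 * m) (x , y) → OddSolution 7 1 (+ 8 * m) (x , y)
    to x y (e , d , _) = cancelˡ (+ 24) (λ ()) (lin 1ℤ e (r x y m)) , square-odd x (by {8} {24} (+ 3) refl d)
      where
      r : ∀ x y m → + 24 * (+ 7 * (x * x) + + 1 * (y * y)) - + 24 * (+ 8 * m) ≡ 1ℤ * (+ 168 * (x * x) + + 24 * (y * y) - + 192 * m)
      r = solve-∀

    from : ∀ x y → OddSolution 7 1 (+ 8 * m) (x , y) → V 24 168 1ℤ (+ 192 * m) (x , y)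
    from x y (e , h) = trans (r x y) (trans (cong (+ 24 *_) e) (r′ m)) ,
      8∧3 (odd-square x h) (decide 3 (dv 3 F ⇒ dv 3 (𝕩 ⊗ 𝕩 ⊖ κ 1ℤ)) x y d₃) ,
      24∧7 (8∧3 (decide 8 (ndv 2 𝕩 ⇒ dv 8 F ⇒ dv 8 (𝕪 ⊗ 𝕪 ⊖ κ 1ℤ)) x y h (by {8} {168} (+ 21) refl d))
                (decide 3 (dv 3 F ⇒ dv 3 (𝕪 ⊗ 𝕪 ⊖ κ 1ℤ)) x y d₃))
           (decide 7 (dv 7 F ⇒ dv 7 (𝕪 ⊗ 𝕪 ⊖ κ 1ℤ)) x y (by {7} {168} (+ 24) refl d))
      where
      F = κ (+ 7) ⊗ (𝕩 ⊗ 𝕩) ⊕ κ (+ 1) ⊗ (𝕪 ⊗ 𝕪) ⊖ κ (+ 8)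
      r : ∀ x y → + 168 * (x * x) + + 24 * (y * y) ≡ + 24 * (+ 7 * (x * x) + + 1 * (y * y))
      r = solve-∀
      r′ : ∀ m → + 24 * (+ 8 * m) ≡ + 192 * m
      r′ = solve-∀
      d : + 168 ∣ + 7 * (x * x) + + 1 * (y * y) - + 8
      d = divides (+ n) (diff (+ 7 * (x * x) + + 1 * (y * y)) (+ n) e)
      d₃ = by {3} {168} (+ 56) refl d

    not-twice : ¬ IsSquare (2 ℕ.* (21 ℕ.* n ℕ.+ 1))
    not-twice (k , e) = decide 3 (dv 3 (𝕩 ⊗ 𝕩 ⊖ κ (+ 2) ⊗ (κ (+ 21) ⊗ 𝕪 ⊕ κ 1ℤ)) ⇒ ⊥ᶠ) (+ k) (+ n)
      (divides 0ℤ (x≡y⇒x-y≡0 (trans (square-∣ k e) (trans (ℤP.pos-* 2 (21 ℕ.* n ℕ.+ 1)) (cong (+ 2 *_) (cast 21 n))))))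

    counts : (e : Enum (V 24 168 1ℤ (+ 192 * + (21 ℕ.* n ℕ.+ 1)))) → Counts (IsSquare (21 ℕ.* n ℕ.+ 1)) (card e)
    counts e = subst (Counts (IsSquare (21 ℕ.* n ℕ.+ 1))) (sym (move (sym (cast 21 n)) e))
      (Counts-⇔ [ id , (λ h → ⊥-elim (not-twice h)) ]′ inj₁
        (claim (21 ℕ.* n ℕ.+ 1) (λ z → ℕP.m+1+n≢0 (21 ℕ.* n) z) (coprime-unit 21 n 7 (+ 3) (λ ()) refl)
          (sym (cast 21 n)) (enumOddSolution 7 1 (+ 8 * m))))
      where
      move : ∀ {N} → m ≡ N → (e : Enum (V 24 168 1ℤ (+ 192 * N))) → card e ≡ card (enumOddSolution 7 1 (+ 8 * m))
      move refl e = card-⇔ e (enumOddSolution 7 1 (+ 8 * m)) (λ { {x , y} → to x y }) (λ { {x , y} → from x y })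

  identity : f 21 ≡₂ (f 24 ⊛ f 168)
  identity = Bridge.of-counts 21 24 168 refl counts

-- (20, 24, 120): 5 x² + y² = 6 M with M = 20 n + 1.
module Identity20 where

  Solution : ℤ → ℤ × ℤ → Set
  Solution m (x , y) = Norm 5 1 (+ 6 * m) (x , y) × ¬ (+ 3 ∣ x)

  enumSolution : ∀ m → Enum (Solution m)
  enumSolution m = enumBox (λ { (x , y) → (_ ≟ + 6 * m) ×-dec ¬? (+ 3 ∣? x) }) (abs (+ 6 * m))
    (λ {x} {y} h → form-bound 1 5 x y (proj₁ h))

  -- Modulo 3 the form x² + 5y² is (x - y)(x + y). The condition keeps x + y√-5 outside one of the
  -- two prime ideals above 3.
  Sum : ℤ → ℤ × ℤ → Set
  Sum m (x , y) = Principal 5 m (x , y) × ¬ (+ 3 ∣ x + y)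

  enumSum : ∀ m → Enum (Sum m)
  enumSum m = enumBox (λ { (x , y) → (_ ≟ m) ×-dec ¬? (+ 3 ∣? x + y) }) (abs m)
    (λ {x} {y} h → form-bound 5 1 x y (proj₁ h))

  φ₁ : ℤ × ℤ → ℤ × ℤ
  φ₁ (x , y) = x + y , x - + 5 * y

  φ₁-inj : ∀ {q q′} → φ₁ q ≡ φ₁ q′ → q ≡ q′
  φ₁-inj {x , y} {x′ , y′} h = go (pair-≡ h)
    where
    go : x + y ≡ x′ + y′ × x - + 5 * y ≡ x′ - + 5 * y′ → (x , y) ≡ (x′ , y′)
    go (h₁ , h₂) = cong₂ _,_
      (cancelˡ (+ 6) (λ ()) (lin₂ (+ 5) (+ 1) h₁ h₂ (solve (x ∷ y ∷ x′ ∷ y′ ∷ []))))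
      (cancelˡ (+ 6) (λ ()) (lin₂ (+ 1) (- + 1) h₁ h₂ (solve (x ∷ y ∷ x′ ∷ y′ ∷ []))))

  half : ∀ m → (e : Enum (Solution m)) (eQ : Enum (Sum m)) → card e ≡ 2 ℕ.* card eQ
  half m e eQ = halve-image 6 (+ 1) φ₁ e eQ (λ x y h → form-conj 5 1 x y (proj₁ h) , proj₂ h)
    (λ x y h → decide 6 (ndv 3 𝕩 ⇒ dv 6 (κ (+ 1) ⊗ 𝕩 ⊖ 𝕪) ⇒ ndv 6 (κ (+ 1) ⊗ 𝕩 ⊕ 𝕪)) x y (proj₂ h))
    (λ x y h → decide 6 (ndv 3 𝕩 ⇒ dv 6 (κ (+ 5) ⊗ (𝕩 ⊗ 𝕩) ⊕ κ (+ 1) ⊗ (𝕪 ⊗ 𝕪)) ⇒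
      ndv 6 (κ (+ 1) ⊗ 𝕩 ⊖ 𝕪) ⇒ dv 6 (κ (+ 1) ⊗ 𝕩 ⊕ 𝕪)) x y (proj₂ h) (divides m (trans (proj₁ h) (ℤP.*-comm (+ 6) m))))
    φ₁-inj
    (λ { {x , y} (h , h′) → (trans (r x y) (cong (+ 6 *_) h) , h′) , divides y (r′ x y) })
    (λ x t h → (x - t , t) , (cancelˡ (+ 6) (λ ()) (lin 1ℤ (proj₁ h) (r₀ x t m)) ,
        (λ d → proj₂ h (subst (+ 3 ∣_) (r₁ x t) d))) , cong₂ _,_ (r₁ x t) (r₂ x t))
    where
    r : ∀ x y → + 5 * ((x + y) * (x + y)) + + 1 * ((x - + 5 * y) * (x - + 5 * y)) ≡ + 6 * (+ 1 * (x * x) + + 5 * (y * y))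
    r = solve-∀
    r′ : ∀ x y → + 1 * (x + y) - (x - + 5 * y) ≡ y * + 6
    r′ = solve-∀
    r₀ : ∀ x t m → + 6 * (+ 1 * ((x - t) * (x - t)) + + 5 * (t * t)) - + 6 * m ≡
      1ℤ * (+ 5 * (x * x) + + 1 * ((+ 1 * x - t * + 6) * (+ 1 * x - t * + 6)) - + 6 * m)
    r₀ = solve-∀
    r₁ : ∀ x t → x - t + t ≡ x
    r₁ = solve-∀
    r₂ : ∀ x t → x - t - + 5 * t ≡ + 1 * x - t * + 6
    r₂ = solve-∀

  unramified : ∀ m → ¬ (+ 3 ∣ m) → (e : Enum (Sum m)) (eQ : Enum (Principal 5 m)) → card e ≡ card eQ
  unramified m 3∤ e eQ = card-⇔ e eQ proj₁ (λ { {x , y} h → h ,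
    decide 3 (ndv 3 (κ (+ 1) ⊗ (𝕩 ⊗ 𝕩) ⊕ κ (+ 5) ⊗ (𝕪 ⊗ 𝕪)) ⇒ ndv 3 (𝕩 ⊕ 𝕪)) x y (λ d → 3∤ (subst (+ 3 ∣_) h d)) })

  -- The non-principal reduced form of discriminant -20, reached by dividing by a prime ideal above
  -- 3.
  Middle : ℤ → ℤ × ℤ → Set
  Middle m (y , z) = + 2 * (y * y) + + 2 * (y * z) + + 3 * (z * z) ≡ m

  enumMiddle : ∀ m → Enum (Middle m)
  enumMiddle m = enumBox (λ { (y , z) → _ ≟ m }) (abs (+ 6 * m))
    (λ {y} {z} h → proj₂ (form-bound 10 2 (+ 3 * z + y) y (trans (r₁ y z) (cong (+ 6 *_) h))) ,
                   proj₂ (form-bound 15 3 (+ 2 * y + z) z (trans (r₂ y z) (cong (+ 6 *_) h))))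
    where
    r₁ : ∀ y z → + 2 * ((+ 3 * z + y) * (+ 3 * z + y)) + + 10 * (y * y) ≡ + 6 * (+ 2 * (y * y) + + 2 * (y * z) + + 3 * (z * z))
    r₁ = solve-∀
    r₂ : ∀ y z → + 3 * ((+ 2 * y + z) * (+ 2 * y + z)) + + 15 * (z * z) ≡ + 6 * (+ 2 * (y * y) + + 2 * (y * z) + + 3 * (z * z))
    r₂ = solve-∀

  φ₂ : ℤ × ℤ → ℤ × ℤ
  φ₂ (y , z) = y + + 3 * z , y

  φ₂-inj : ∀ {q q′} → φ₂ q ≡ φ₂ q′ → q ≡ q′
  φ₂-inj {x , y} {x′ , y′} h = go (pair-≡ h)
    where
    go : x + + 3 * y ≡ x′ + + 3 * y′ × x ≡ x′ → (x , y) ≡ (x′ , y′)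
    go (h₁ , h₂) = cong₂ _,_ h₂
      (cancelˡ (+ 3) (λ ()) (lin₂ (+ 1) (- + 1) h₁ h₂ (solve (x ∷ y ∷ x′ ∷ y′ ∷ []))))

  -- Since 3 divides the norm but not x + y, it divides x - y; the substitution x = y + 3z then
  -- splits off the factor 3.
  ramified : ∀ m → ¬ (+ 3 ∣ m) → (e : Enum (Sum (+ 3 * m))) (eQ : Enum (Middle m)) → card e ≡ card eQ
  ramified m 3∤ e eQ = card-image φ₂ e eQ φ₂-inj (λ { {y , z} h → to y z h }) (λ { {x , y} (h , h′) → from x y h h′ })
    where
    r : ∀ y z → + 1 * ((y + + 3 * z) * (y + + 3 * z)) + + 5 * (y * y) ≡ + 3 * (+ 2 * (y * y) + + 2 * (y * z) + + 3 * (z * z))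
    r = solve-∀
    to : ∀ y z → Middle m (y , z) → Sum (+ 3 * m) (φ₂ (y , z))
    to y z h = trans (r y z) (cong (+ 3 *_) h) ,
      decide 3 (ndv 3 (κ (+ 2) ⊗ (𝕩 ⊗ 𝕩) ⊕ κ (+ 2) ⊗ (𝕩 ⊗ 𝕪) ⊕ κ (+ 3) ⊗ (𝕪 ⊗ 𝕪)) ⇒ ndv 3 (𝕩 ⊕ κ (+ 3) ⊗ 𝕪 ⊕ 𝕩)) y z
        (λ d → 3∤ (subst (+ 3 ∣_) h d))
    from : ∀ x y → Principal 5 (+ 3 * m) (x , y) → ¬ (+ 3 ∣ x + y) → ∃ λ q → Middle m q × φ₂ q ≡ (x , y)
    from x y h h′ = go (decide 3 (dv 3 (κ (+ 1) ⊗ (𝕩 ⊗ 𝕩) ⊕ κ (+ 5) ⊗ (𝕪 ⊗ 𝕪)) ⇒ ndv 3 (𝕩 ⊕ 𝕪) ⇒ dv 3 (𝕩 ⊖ 𝕪)) x y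
        (divides m (trans h (ℤP.*-comm (+ 3) m))) h′)
      where
      go : + 3 ∣ x - y → ∃ λ q → Middle m q × φ₂ q ≡ (x , y)
      go (divides z ez) = (y , z) , cancelˡ (+ 3) (λ ()) (trans (sym (r y z))
        (trans (cong (λ t → + 1 * (t * t) + + 5 * (y * y)) eq) h)) , cong (_, y) eq
        where
        solve-x : ∀ x y z → x - y ≡ z * + 3 → y + + 3 * z ≡ x
        solve-x x y z e = lin (- 1ℤ) e (solve (x ∷ y ∷ z ∷ []))
        eq : y + + 3 * z ≡ x
        eq = solve-x x y z ez

  middle-even : ∀ m → ¬ (+ 2 ∣ m) → (e : Enum (Middle m)) → 4 ℕD.∣ card e
  middle-even m odd e = klein e (λ { (y , z) → - y - z , z }) (λ { (y , z) → y + z , - z })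
    (λ { (y , z) → + 2 * y + z }) proj₂
    (λ { (y , z) → cong (_, z) (i₁ y z) }) (λ { (y , z) → cong₂ _,_ (i₂ y z) (ℤP.neg-involutive z) })
    (λ { (y , z) → r₁ y z }) (λ { (y , z) → r₂ y z }) (λ _ → refl)
    (λ { {y , z} h → trans (r₃ y z) h }) (λ { {y , z} h → trans (r₄ y z) h })
    (λ { {y , z} h d → odd (divides (+ 5 * (y * y)) (trans (sym h) (r₅ y z d))) })
    (λ { {y , _} h refl → odd (divides (y * y) (trans (sym h) (r₆ y))) })
    where
    i₁ : ∀ y z → - (- y - z) - z ≡ y
    i₁ = solve-∀
    i₂ : ∀ y z → y + z + - z ≡ y
    i₂ = solve-∀
    r₁ : ∀ y z → + 2 * (- y - z) + z ≡ - (+ 2 * y + z)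
    r₁ = solve-∀
    r₂ : ∀ y z → + 2 * (y + z) + - z ≡ + 2 * y + z
    r₂ = solve-∀
    r₃ : ∀ y z → + 2 * ((- y - z) * (- y - z)) + + 2 * ((- y - z) * z) + + 3 * (z * z) ≡ + 2 * (y * y) + + 2 * (y * z) + + 3 * (z * z)
    r₃ = solve-∀
    r₄ : ∀ y z → + 2 * ((y + z) * (y + z)) + + 2 * ((y + z) * - z) + + 3 * (- z * - z) ≡ + 2 * (y * y) + + 2 * (y * z) + + 3 * (z * z)
    r₄ = solve-∀
    r₅ : ∀ y z → + 2 * y + z ≡ 0ℤ → + 2 * (y * y) + + 2 * (y * z) + + 3 * (z * z) ≡ + 5 * (y * y) * + 2
    r₅ y z d = lin (+ 3 * z - + 4 * y) d (solve (y ∷ z ∷ []))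
    r₆ : ∀ y → + 2 * (y * y) + + 2 * (y * 0ℤ) + + 3 * (0ℤ * 0ℤ) ≡ y * y * + 2
    r₆ = solve-∀

  -- Multiplication of x + w√-5 by -2 + √-5, of norm 9, which generates the square of a prime ideal
  -- above 3.
  φ₃ : ℤ × ℤ → ℤ × ℤ
  φ₃ (x , w) = - (+ 5 * w) - + 2 * x , x - + 2 * w

  φ₃-inj : ∀ {q q′} → φ₃ q ≡ φ₃ q′ → q ≡ q′
  φ₃-inj {x , y} {x′ , y′} h = go (pair-≡ h)
    where
    go : - (+ 5 * y) - + 2 * x ≡ - (+ 5 * y′) - + 2 * x′ × x - + 2 * y ≡ x′ - + 2 * y′ → (x , y) ≡ (x′ , y′)
    go (h₁ , h₂) = cong₂ _,_
      (cancelˡ (+ 9) (λ ()) (lin₂ (- + 2) (+ 5) h₁ h₂ (solve (x ∷ y ∷ x′ ∷ y′ ∷ []))))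
      (cancelˡ (+ 9) (λ ()) (lin₂ (- + 1) (- + 2) h₁ h₂ (solve (x ∷ y ∷ x′ ∷ y′ ∷ []))))

  descend : ∀ m → (e : Enum (Sum (+ 9 * m))) (eQ : Enum (Sum m)) → card e ≡ card eQ
  descend m e eQ = card-image φ₃ e eQ φ₃-inj (λ { {x , w} (h , h′) → to x w h h′ }) (λ { {x , y} (h , h′) → from x y h h′ })
    where
    r : ∀ x w → + 1 * ((- (+ 5 * w) - + 2 * x) * (- (+ 5 * w) - + 2 * x)) + + 5 * ((x - + 2 * w) * (x - + 2 * w))
      ≡ + 9 * (+ 1 * (x * x) + + 5 * (w * w))
    r = solve-∀
    to : ∀ x w → Principal 5 m (x , w) → ¬ (+ 3 ∣ x + w) → Sum (+ 9 * m) (φ₃ (x , w))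
    to x w h h′ = trans (r x w) (cong (+ 9 *_) h) ,
      decide 3 (ndv 3 (𝕩 ⊕ 𝕪) ⇒ ndv 3 (κ 0ℤ ⊖ κ (+ 5) ⊗ 𝕪 ⊖ κ (+ 2) ⊗ 𝕩 ⊕ (𝕩 ⊖ κ (+ 2) ⊗ 𝕪))) x w h′ ∘ subst (+ 3 ∣_) (s x w)
      where
      s : ∀ x w → - (+ 5 * w) - + 2 * x + (x - + 2 * w) ≡ 0ℤ - + 5 * w - + 2 * x + (x - + 2 * w)
      s = solve-∀
    from : ∀ x y → Principal 5 (+ 9 * m) (x , y) → ¬ (+ 3 ∣ x + y) → ∃ λ q → Sum m q × φ₃ q ≡ (x , y)
    from x y h h′ = go (decide 9 (dv 9 (κ (+ 1) ⊗ (𝕩 ⊗ 𝕩) ⊕ κ (+ 5) ⊗ (𝕪 ⊗ 𝕪)) ⇒ ndv 3 (𝕩 ⊕ 𝕪) ⇒ dv 9 (𝕩 ⊕ κ (+ 2) ⊗ 𝕪)) x y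
        (divides m (trans h (ℤP.*-comm (+ 9) m))) h′)
      where
      back : ∀ x y w → x + + 2 * y ≡ w * + 9 → - (+ 5 * - w) - + 2 * (y - + 2 * w) ≡ x
      back x y w e = lin (- 1ℤ) e (solve (x ∷ y ∷ w ∷ []))
      back′ : ∀ y w → y - + 2 * w - + 2 * - w ≡ y
      back′ = solve-∀
      go : + 9 ∣ x + + 2 * y → ∃ λ q → Sum m q × φ₃ q ≡ (x , y)
      go (divides w ew) = (y - + 2 * w , - w) , (cancelˡ (+ 9) (λ ()) (trans (sym (r (y - + 2 * w) (- w)))
          (trans (cong₂ (λ u v → + 1 * (u * u) + + 5 * (v * v)) (back x y w ew) (back′ y w)) h)) ,
          (λ d → h′ (subst (+ 3 ∣_) (s x y w ew) (∣m∣n⇒∣m+n (∣n⇒∣m*n (- + 1) d) (∣n⇒∣m*n (+ 2 * w) ∣-refl)))))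
        , cong₂ _,_ (back x y w ew) (back′ y w)
        where
        s : ∀ x y w → x + + 2 * y ≡ w * + 9 → - + 1 * (y - + 2 * w + - w) + + 2 * w * + 3 ≡ x + y
        s x y w e = lin (- 1ℤ) e (solve (x ∷ y ∷ w ∷ []))

  Claim : ℕ → Set
  Claim M = ¬ M ≡ 0 → ¬ (+ 2 ∣ + M) → ¬ (+ 5 ∣ + M) → ∀ {N} → N ≡ + M → (e : Enum (Sum N)) → Counts (IsSquare M) (2 ℕ.* card e)

  claim : ∀ M → Claim M
  claim = <-rec _ λ M rec → by-three M (λ {k} → rec {k}) (+ 3 ∣? + M)
    where
    ∤part : ∀ d k {m} → ¬ (+ d ∣ + (k ℕ.* m)) → ¬ (+ d ∣ + m)
    ∤part d k {m} h h′ = h (subst (+ d ∣_) (sym (ℤP.pos-* k m)) (∣n⇒∣m*n (+ k) h′))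
    nine : ∀ {m} → IsSquare (9 ℕ.* m) → IsSquare m
    nine {m} (k , e) = go (∣⇒∣ᵤ (decide 9 (dv 9 (𝕩 ⊗ 𝕩) ⇒ dv 3 𝕩) (+ k) 0ℤ (divides (+ m) (trans (square-∣ k e) (trans (ℤP.pos-* 9 m) (ℤP.*-comm (+ 9) (+ m)))))))
      where
      r : ∀ q → 9 ℕ.* (q ℕ.* q) ≡ q ℕ.* 3 ℕ.* (q ℕ.* 3)
      r = solveᴺ-∀
      go : 3 ℕD.∣ k → IsSquare m
      go (ℕD.divides q refl) = q , ℕP.*-cancelˡ-≡ _ _ 9 (trans (r q) e)
    nine′ : ∀ {m} → IsSquare m → IsSquare (9 ℕ.* m)
    nine′ (k , refl) = 3 ℕ.* k , r k
      where
      r : ∀ q → 3 ℕ.* q ℕ.* (3 ℕ.* q) ≡ 9 ℕ.* (q ℕ.* q)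
      r = solveᴺ-∀
    by-three : ∀ M → (∀ {k} → k ℕ.< M → Claim k) → Dec (+ 3 ∣ + M) → Claim M
    by-three M rec (no 3∤) M≢0 2∤ 5∤ refl e = subst (λ t → Counts (IsSquare M) (2 ℕ.* t)) (sym (unramified (+ M) 3∤ e (enumPrincipal 5 (+ M))))
      (principal 5 M M≢0 (λ y h → 5∤ (subst (+ 5 ∣_) h (divides (y * y) (ℤP.*-comm (+ 5) (y * y))))) (enumPrincipal 5 (+ M)))
    by-three M rec (yes 3∣M) M≢0 2∤ 5∤ {N} eN e = third (∣⇒∣ᵤ 3∣M)
      where
      third : 3 ℕD.∣ M → Counts (IsSquare M) (2 ℕ.* card e)
      third (ℕD.divides m eM) = by-third (+ 3 ∣? + m)
        where
        eM′ : M ≡ 3 ℕ.* m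
        eM′ = trans eM (ℕP.*-comm m 3)
        by-third : Dec (+ 3 ∣ + m) → Counts (IsSquare M) (2 ℕ.* card e)
        by-third (no 3∤m) = (λ sq → ⊥-elim (nonsquare₃ sq)) , (λ _ → twice (card e)
            (subst (4 ℕD.∣_) (sym (at (trans eN (trans (cong +_ eM′) (ℤP.pos-* 3 m))) e))
              (middle-even (+ m) (∤part 2 3 {m} (subst (λ t → ¬ (+ 2 ∣ + t)) eM′ 2∤)) (enumMiddle (+ m)))))
          where
          at : ∀ {N} → N ≡ + 3 * + m → (e : Enum (Sum N)) → card e ≡ card (enumMiddle (+ m))
          at refl e = ramified (+ m) 3∤m e (enumMiddle (+ m))
          nonsquare₃ : ¬ IsSquare M
          nonsquare₃ (k , ek) = 3∤m (decide 9 (dv 9 (κ (+ 3) ⊗ 𝕩) ⇒ dv 3 𝕩) (+ m) 0ℤ (subst (+ 9 ∣_) eq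
              (decide 9 (dv 3 (𝕩 ⊗ 𝕩) ⇒ dv 9 (𝕩 ⊗ 𝕩)) (+ k) 0ℤ (subst (+ 3 ∣_) (sym eq) (∣m⇒∣m*n {+ 3} {+ 3} (+ m) ∣-refl)))))
            where
            eq : + k * + k ≡ + 3 * + m
            eq = trans (square-∣ k (trans ek eM′)) (ℤP.pos-* 3 m)
        by-third (yes 3∣m) = ninth (∣⇒∣ᵤ 3∣m)
          where
          ninth : 3 ℕD.∣ m → Counts (IsSquare M) (2 ℕ.* card e)
          ninth (ℕD.divides q em) = subst (λ t → Counts (IsSquare M) (2 ℕ.* t)) (sym (at (trans eN (trans (cong +_ eM″) (ℤP.pos-* 9 q))) e))
            (Counts-⇔ (λ s → subst IsSquare (sym eM″) (nine′ s)) (λ s → nine (subst IsSquare eM″ s))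
              (rec q<M q≢0 (∤part 2 9 {q} (subst (λ t → ¬ (+ 2 ∣ + t)) eM″ 2∤)) (∤part 5 9 {q} (subst (λ t → ¬ (+ 5 ∣ + t)) eM″ 5∤))
                refl (enumSum (+ q))))
            where
            r : ∀ q → 3 ℕ.* (q ℕ.* 3) ≡ 9 ℕ.* q
            r = solveᴺ-∀
            eM″ : M ≡ 9 ℕ.* q
            eM″ = trans eM′ (trans (cong (3 ℕ.*_) em) (r q))
            q≢0 : ¬ q ≡ 0
            q≢0 z = M≢0 (trans eM″ (cong (9 ℕ.*_) z))
            q<M : q ℕ.< M
            q<M = subst (q ℕ.<_) (sym eM″) (m<n*m q 9 {{ℕ.≢-nonZero q≢0}} (s≤s (s≤s z≤n)))
            at : ∀ {N} → N ≡ + 9 * + q → (e : Enum (Sum N)) → card e ≡ card (enumSum (+ q))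
            at refl e = descend (+ q) e (enumSum (+ q))

  module _ (n : ℕ) where

    m = + 20 * + n + 1ℤ

    diff : ∀ A n → A ≡ + 6 * (+ 20 * n + 1ℤ) → A - + 6 ≡ n * + 120
    diff A n e = lin 1ℤ e (solve (A ∷ n ∷ []))

    to : ∀ x y → V 24 120 1ℤ (+ 144 * m) (x , y) → Solution m (x , y)
    to x y (e , d , _) = cancelˡ (+ 24) (λ ()) (lin 1ℤ e (r x y m)) ,
      decide 3 (dv 3 (𝕩 ⊗ 𝕩 ⊖ κ 1ℤ) ⇒ ndv 3 𝕩) x 0ℤ (by {3} {24} (+ 8) refl d)
      where
      r : ∀ x y m → + 24 * (+ 5 * (x * x) + + 1 * (y * y)) - + 24 * (+ 6 * m) ≡ 1ℤ * (+ 120 * (x * x) + + 24 * (y * y) - + 144 * m)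
      r = solve-∀

    from : ∀ x y → Solution m (x , y) → V 24 120 1ℤ (+ 144 * m) (x , y)
    from x y (e , h) = trans (r x y) (trans (cong (+ 24 *_) e) (r′ m)) ,
      8∧3 (decide 8 (dv 4 F ⇒ dv 8 (𝕩 ⊗ 𝕩 ⊖ κ 1ℤ)) x y d₄) (decide 3 (ndv 3 𝕩 ⇒ dv 3 (𝕩 ⊗ 𝕩 ⊖ κ 1ℤ)) x y h) ,
      24∧5 (8∧3 (decide 8 (dv 4 F ⇒ dv 8 (𝕪 ⊗ 𝕪 ⊖ κ 1ℤ)) x y d₄)
                (decide 3 (ndv 3 𝕩 ⇒ dv 3 F ⇒ dv 3 (𝕪 ⊗ 𝕪 ⊖ κ 1ℤ)) x y h (by {3} {120} (+ 40) refl d)))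
           (decide 5 (dv 5 F ⇒ dv 5 (𝕪 ⊗ 𝕪 ⊖ κ 1ℤ)) x y (by {5} {120} (+ 24) refl d))
      where
      F = κ (+ 5) ⊗ (𝕩 ⊗ 𝕩) ⊕ κ (+ 1) ⊗ (𝕪 ⊗ 𝕪) ⊖ κ (+ 6)
      r : ∀ x y → + 120 * (x * x) + + 24 * (y * y) ≡ + 24 * (+ 5 * (x * x) + + 1 * (y * y))
      r = solve-∀
      r′ : ∀ m → + 24 * (+ 6 * m) ≡ + 144 * m
      r′ = solve-∀
      d : + 120 ∣ + 5 * (x * x) + + 1 * (y * y) - + 6
      d = divides (+ n) (diff (+ 5 * (x * x) + + 1 * (y * y)) (+ n) e)
      d₄ = by {4} {120} (+ 30) refl d

    counts : (e : Enum (V 24 120 1ℤ (+ 144 * + (20 ℕ.* n ℕ.+ 1)))) → Counts (IsSquare (20 ℕ.* n ℕ.+ 1)) (card e)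
    counts e = subst (Counts (IsSquare (20 ℕ.* n ℕ.+ 1))) (sym (trans (move (sym (cast 20 n)) e) (half m (enumSolution m) (enumSum m))))
      (claim (20 ℕ.* n ℕ.+ 1) (λ z → ℕP.m+1+n≢0 (20 ℕ.* n) z) (coprime-unit 20 n 2 (+ 10) (λ ()) refl)
        (coprime-unit 20 n 5 (+ 4) (λ ()) refl) (sym (cast 20 n)) (enumSum m))
      where
      move : ∀ {N} → m ≡ N → (e : Enum (V 24 120 1ℤ (+ 144 * N))) → card e ≡ card (enumSolution m)
      move refl e = card-⇔ e (enumSolution m) (λ { {x , y} → to x y }) (λ { {x , y} → from x y })

  identity : f 20 ≡₂ (f 24 ⊛ f 120)
  identity = Bridge.of-counts 20 24 120 refl counts

-- Triples of the shape (h u v, h u w, h v w) with w = u + v.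

prime-divisor : ∀ d → ¬ d ≡ 0 → ¬ d ≡ 1 → ∃ λ p → Prime p × p ℕD.∣ d
prime-divisor d d≢0 d≢1 = go factors isFactorisation factorsPrime
  where
  open PrimeFactorisation (factorise d {{ℕ.≢-nonZero d≢0}})
  go : ∀ ps → d ≡ product ps → All Prime ps → ∃ λ p → Prime p × p ℕD.∣ d
  go [] e _ = ⊥-elim (d≢1 e)
  go (p ∷ ps) e (pr All.∷ _) = p , pr , subst (p ℕD.∣_) (sym e) (ℕD.m∣m*n (product ps))

no-common-prime⇒Cop : ∀ {m n} → ¬ n ≡ 0 → (∀ {p} → Prime p → p ℕD.∣ m → p ℕD.∣ n → ⊥) → Cop (+ m) (+ n)
no-common-prime⇒Cop {m} {n} n≢0 none = Cop-coprime λ {d} (d∣m , d∣n) → decidable-stable (d ℕ.≟ 1) λ d≢1 →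
  let p , pr , p∣d = prime-divisor d (λ { refl → n≢0 (ℕD.0∣⇒≡0 d∣n) }) d≢1
  in none pr (ℕD.∣-trans p∣d d∣m) (ℕD.∣-trans p∣d d∣n)

prime∣2 : ∀ {p} → Prime p → p ℕD.∣ 2 → p ≡ 2
prime∣2 pr h with prime⇒irreducible prime[2] h
... | inj₁ refl = ⊥-elim (¬prime[1] pr)
... | inj₂ e = e

prime[3] : Prime 3
prime[3] = toWitness {a? = prime? 3} _

prime∣3 : ∀ {p} → Prime p → p ℕD.∣ 3 → p ≡ 3
prime∣3 pr h with prime⇒irreducible prime[3] h
... | inj₁ refl = ⊥-elim (¬prime[1] pr)
... | inj₂ e = e

-- The equation bc = a (b + c) has the solutions (a , b , c) = (h u v , h u w , h v w), w = u + v.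
Represents : ℕ → ℕ → ℕ → Set
Represents h u v = ∀ {ρ} → Cop ρ (+ (h ℕ.* u ℕ.* v)) → Cop ρ (+ (u ℕ.+ v)) → ∀ k → 0 ℕ.< k →
  + (h ℕ.* u ℕ.* v) ∣ + k * + k - ρ * ρ → ∃₂ λ x y →
  + v * (x * x) + + u * (y * y) ≡ + (u ℕ.+ v) * (+ k * + k) ×
  + (h ℕ.* u ℕ.* (u ℕ.+ v)) ∣ x * x - ρ * ρ × + (h ℕ.* v ℕ.* (u ℕ.+ v)) ∣ y * y - ρ * ρ

module _ (h u v : ℕ) .{{nzh : ℕ.NonZero h}} .{{nzu : ℕ.NonZero u}} .{{nzv : ℕ.NonZero v}} where

  private
    w = u ℕ.+ v

    instance
      nzw : ℕ.NonZero w
      nzw = ℕ.>-nonZero (ℕP.<-≤-trans (ℕ.>-nonZero⁻¹ u) (ℕP.m≤m+n u v))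
      nza : ℕ.NonZero (h ℕ.* u ℕ.* v)
      nza = ℕP.m*n≢0 (h ℕ.* u) v {{ℕP.m*n≢0 h u}}
      nzb : ℕ.NonZero (h ℕ.* u ℕ.* w)
      nzb = ℕP.m*n≢0 (h ℕ.* u) w {{ℕP.m*n≢0 h u}}
      nzc : ℕ.NonZero (h ℕ.* v ℕ.* w)
      nzc = ℕP.m*n≢0 (h ℕ.* v) w {{ℕP.m*n≢0 h v}}

  shape-harmonic : h ℕ.* u ℕ.* (u ℕ.+ v) ℕ.* (h ℕ.* v ℕ.* (u ℕ.+ v)) ≡
    h ℕ.* u ℕ.* v ℕ.* (h ℕ.* u ℕ.* (u ℕ.+ v) ℕ.+ h ℕ.* v ℕ.* (u ℕ.+ v))
  shape-harmonic = r h u v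
    where
    r : ∀ h u v → h ℕ.* u ℕ.* (u ℕ.+ v) ℕ.* (h ℕ.* v ℕ.* (u ℕ.+ v)) ≡
      h ℕ.* u ℕ.* v ℕ.* (h ℕ.* u ℕ.* (u ℕ.+ v) ℕ.+ h ℕ.* v ℕ.* (u ℕ.+ v))
    r = solveᴺ-∀

  -- Here b = u · hw, c = v · hw and b + c = w · hw, so hw cancels from the norm equation. A unit
  -- modulo a and w is a unit modulo bc = a h w².
  represents : f (h ℕ.* u ℕ.* v) ≡₂ (f (h ℕ.* u ℕ.* (u ℕ.+ v)) ⊛ f (h ℕ.* v ℕ.* (u ℕ.+ v))) → Represents h u v
  represents H {ρ} ρ⊥a ρ⊥w k 0<k d = out (Classes.represented (h ℕ.* u ℕ.* v) b c shape-harmonic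
    (Bridge.parity-of (h ℕ.* u ℕ.* v) b c shape-harmonic H) {ρ} ρ⊥bc k 0<k d)
    where
    b = h ℕ.* u ℕ.* w
    c = h ℕ.* v ℕ.* w
    hw = h ℕ.* w
    b≡ : + b ≡ + u * + hw
    b≡ = trans (cong +_ (r h u w)) (ℤP.pos-* u hw)
      where
      r : ∀ h u w → h ℕ.* u ℕ.* w ≡ u ℕ.* (h ℕ.* w)
      r = solveᴺ-∀
    c≡ : + c ≡ + v * + hw
    c≡ = trans (cong +_ (r h v w)) (ℤP.pos-* v hw)
      where
      r : ∀ h v w → h ℕ.* v ℕ.* w ≡ v ℕ.* (h ℕ.* w)
      r = solveᴺ-∀
    ρ⊥h : Cop ρ (+ h)
    ρ⊥h = Cop-∣ʳ ρ⊥a (∣ᵤ⇒∣ {+ h} {+ (h ℕ.* u ℕ.* v)} (ℕD.∣m⇒∣m*n v (ℕD.m∣m*n u)))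
    ρ⊥bc : Cop ρ (+ b * + c)
    ρ⊥bc = subst (Cop ρ) (trans (cong (λ t → + (h ℕ.* u ℕ.* v) * (+ h * t)) (sym (ℤP.pos-* w w)))
      (trans (cong (+ (h ℕ.* u ℕ.* v) *_) (sym (ℤP.pos-* h (w ℕ.* w)))) (trans (sym (ℤP.pos-* (h ℕ.* u ℕ.* v) (h ℕ.* (w ℕ.* w))))
        (trans (cong +_ (r h u v w)) (ℤP.pos-* b c)))))
      (Cop-* ρ⊥a (Cop-* ρ⊥h (Cop-* ρ⊥w ρ⊥w)))
      where
      r : ∀ h u v w → h ℕ.* u ℕ.* v ℕ.* (h ℕ.* (w ℕ.* w)) ≡ h ℕ.* u ℕ.* w ℕ.* (h ℕ.* v ℕ.* w)
      r = solveᴺ-∀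
    out : (∃₂ λ x y → V b c (ρ * ρ) ((+ b + + c) * (+ k * + k)) (x , y)) → ∃₂ λ x y →
      + v * (x * x) + + u * (y * y) ≡ + w * (+ k * + k) × + b ∣ x * x - ρ * ρ × + c ∣ y * y - ρ * ρ
    out (x , y , e , d₁ , d₂) = x , y , cancelˡ (+ hw) (nonZero hw {{ℕP.m*n≢0 h w}})
      (simplify (+ u) (+ v) (+ hw) x y (+ k) (trans (sym (cong₂ (λ s t → t * (x * x) + s * (y * y)) b≡ c≡))
        (trans e (cong₂ (λ s t → (s + t) * (+ k * + k)) b≡ c≡)))) , d₁ , d₂
      where
      simplify : ∀ u v g x y k → v * g * (x * x) + u * g * (y * y) ≡ (u * g + v * g) * (k * k) →
        g * (v * (x * x) + u * (y * y)) ≡ g * ((u + v) * (k * k))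
      simplify u v g x y k e = lin 1ℤ e (solve (u ∷ v ∷ g ∷ x ∷ y ∷ k ∷ []))

  module Analysis (u⊥v : Cop (+ u) (+ v)) (rep : Represents h u v) where

    private
      a = h ℕ.* u ℕ.* v

      1<w : 1 ℕ.< w
      1<w = ℕP.+-mono-≤ (ℕ.>-nonZero⁻¹ u) (ℕ.>-nonZero⁻¹ v)

      w⊥v : Cop (+ w) (+ v)
      w⊥v = Cop-sym (subst (Cop (+ v)) (cong (λ t → + u + t) (ℤP.*-identityˡ (+ v))) (Cop-shift {+ v} {+ u} (+ 1) (Cop-sym u⊥v)))

      unit-abs : ∀ {X Y} → v ℕ.* (X ℕ.* X) ℕ.+ u ℕ.* (Y ℕ.* Y) ≡ u ℕ.+ v → ¬ X ≡ 0 → ¬ Y ≡ 0 → X ≡ 1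
      unit-abs {zero} _ X≢0 _ = ⊥-elim (X≢0 refl)
      unit-abs {suc zero} _ _ _ = refl
      unit-abs {suc (suc X)} {Y} e _ Y≢0 = ⊥-elim (ℕP.<⇒≱ (ℕP.≤-<-trans (ℕP.≤-reflexive (ℕP.+-comm u v))
        (ℕP.+-mono-<-≤ (ℕP.m<m*n v (suc (suc X) ℕ.* suc (suc X)) (s≤s (s≤s z≤n)))
          (ℕP.m≤m*n u (Y ℕ.* Y) {{ℕP.m*n≢0 Y Y {{ℕ.≢-nonZero Y≢0}} {{ℕ.≢-nonZero Y≢0}}}}))) (ℕP.≤-reflexive e))

    -- The case k = 1, where the only possible representation is x² = y² = 1.
    unit-square : ∀ {ρ} → Cop ρ (+ a) → Cop ρ (+ w) → + a ∣ 1ℤ - ρ * ρ → + (h ℕ.* u ℕ.* w) ∣ 1ℤ - ρ * ρ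
    unit-square {ρ} ρ⊥a ρ⊥w d = go (rep {ρ} ρ⊥a ρ⊥w 1 (s≤s z≤n) d)
      where
      nz : ∀ {g z} → + w ∣ + g → + g ∣ z * z - ρ * ρ → ¬ z ≡ 0ℤ
      nz {g} w∣g dz refl = ℕP.<⇒≢ 1<w (sym (∣1⇒ (Cop-euclid 1ℤ (Cop-* (Cop-sym ρ⊥w) (Cop-sym ρ⊥w)) (∣-by
        (∣n⇒∣m*n (- 1ℤ) (∣-trans w∣g dz)) (r ρ)))))
        where
        r : ∀ ρ → - 1ℤ * (0ℤ * 0ℤ - ρ * ρ) ≡ ρ * ρ * 1ℤ
        r = solve-∀
      go : (∃₂ λ x y → + v * (x * x) + + u * (y * y) ≡ + w * (+ 1 * + 1) ×
        + (h ℕ.* u ℕ.* w) ∣ x * x - ρ * ρ × + (h ℕ.* v ℕ.* w) ∣ y * y - ρ * ρ) → + (h ℕ.* u ℕ.* w) ∣ 1ℤ - ρ * ρ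
      go (x , y , e , d₁ , d₂) = subst (λ t → + (h ℕ.* u ℕ.* w) ∣ t - ρ * ρ) x²≡1 d₁
        where
        X≡1 : abs x ≡ 1
        X≡1 = unit-abs {abs x} {abs y} (ℤP.+-injective (trans (sym (form-abs u v x y)) (trans e (ℤP.*-identityʳ (+ w)))))
          (λ z → nz {z = x} (∣ᵤ⇒∣ {+ w} {+ (h ℕ.* u ℕ.* w)} (ℕD.n∣m*n (h ℕ.* u))) d₁ (ℤP.∣i∣≡0⇒i≡0 z))
          (λ z → nz {z = y} (∣ᵤ⇒∣ {+ w} {+ (h ℕ.* v ℕ.* w)} (ℕD.n∣m*n (h ℕ.* v))) d₂ (ℤP.∣i∣≡0⇒i≡0 z))
        x²≡1 : x * x ≡ 1ℤ
        x²≡1 = trans (sq-abs x) (cong (λ t → + (t ℕ.* t)) X≡1)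

    -- ρ = 1 + a t is a square root of 1 modulo a, hence modulo b.
    local : ∀ q t → q ℕD.∣ w → Cop (1ℤ + + a * + t) (+ q) → + q ∣ + t * (+ 2 + + a * + t)
    local q t q∣w 1+at⊥q = go (avoid-primes (1 ℕ.+ a ℕ.* t) (a ℕ.* q) w cop)
      where
      1+at : + (1 ℕ.+ a ℕ.* t) ≡ 1ℤ + + a * + t
      1+at = cong (λ z → 1ℤ + z) (ℤP.pos-* a t)
      cop : ∀ {p} → Prime p → p ℕD.∣ 1 ℕ.+ a ℕ.* t → p ℕD.∣ a ℕ.* q → ⊥
      cop {p} pr d d′ = [ (λ p∣a → ¬prime[1] (subst Prime (ℕD.∣1⇒≡1 (ℕD.∣m+n∣m⇒∣n
            (subst (p ℕD.∣_) (ℕP.+-comm 1 (a ℕ.* t)) d) (ℕD.∣m⇒∣m*n t p∣a))) pr)) ,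
          (λ p∣q → ¬prime[1] (subst Prime (∣1⇒ (common (Cop-∣ʳ (Cop-∣ 1+at⊥q
            (subst (+ p ∣_) 1+at (∣ᵤ⇒∣ {+ p} {+ (1 ℕ.+ a ℕ.* t)} d))) (∣ᵤ⇒∣ {+ p} {+ q} p∣q)))) pr)) ]′
          (euclidsLemma a q pr d′)
        where
        common : ∀ {p} → Cop p p → p ∣ 1ℤ
        common {p} (x , y , e) = divides (x + y) (trans (sym e) (r x y p))
          where
          r : ∀ x y p → x * p + y * p ≡ (x + y) * p
          r = solve-∀
      go : (∃ λ s → ∀ {p} → Prime p → p ℕ.≤ w → ¬ (p ℕD.∣ 1 ℕ.+ a ℕ.* t ℕ.+ a ℕ.* q ℕ.* s)) → + q ∣ + t * (+ 2 + + a * + t)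
      go (s , avoid) = ∣-by (∣m∣n⇒∣m-n (∣-trans (∣ᵤ⇒∣ {+ q} {+ w} q∣w) w∣) (∣n⇒∣m*n (+ s * (+ 2 + + a * t′ + + a * + t)) ∣-refl))
          (r₃ (+ a) (+ t) (+ q) (+ s))
        where
        t′ = + t + + q * + s
        ρ = 1ℤ + + a * t′
        ρ≡ : + (1 ℕ.+ a ℕ.* t ℕ.+ a ℕ.* q ℕ.* s) ≡ ρ
        ρ≡ = trans (cong₂ _+_ 1+at (trans (ℤP.pos-* (a ℕ.* q) s) (cong (_* + s) (ℤP.pos-* a q)))) (r (+ a) (+ t) (+ q) (+ s))
          where
          r : ∀ a t q s → 1ℤ + a * t + a * q * s ≡ 1ℤ + a * (t + q * s)
          r = solve-∀
        ρ⊥a : Cop ρ (+ a)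
        ρ⊥a = 1ℤ , - t′ , r (+ a) t′
          where
          r : ∀ a t → 1ℤ * (1ℤ + a * t) + - t * a ≡ 1ℤ
          r = solve-∀
        ρ⊥w : Cop ρ (+ w)
        ρ⊥w = subst (λ z → Cop z (+ w)) ρ≡ (no-common-prime⇒Cop (ℕ.≢-nonZero⁻¹ w) λ pr d d′ → avoid pr (ℕD.∣⇒≤ d′) d)
        a∣ : + a ∣ 1ℤ - ρ * ρ
        a∣ = divides (- (t′ * (+ 2 + + a * t′))) (r (+ a) t′)
          where
          r : ∀ a t → 1ℤ - (1ℤ + a * t) * (1ℤ + a * t) ≡ - (t * (+ 2 + a * t)) * a
          r = solve-∀
        w∣ : + w ∣ t′ * (+ 2 + + a * t′)
        w∣ = Cop-euclid (t′ * (+ 2 + + a * t′)) w⊥v (*-cancelˡ-∣ (+ (h ℕ.* u)) {{ℕP.m*n≢0 h u}} (subst₂ _∣_ (ℤP.pos-* (h ℕ.* u) w)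
          (trans (r₁ (+ a) t′) (trans (cong (_* (t′ * (+ 2 + + a * t′))) (ℤP.pos-* (h ℕ.* u) v)) (ℤP.*-assoc (+ (h ℕ.* u)) (+ v) (t′ * (+ 2 + + a * t′)))))
          (∣n⇒∣m*n (- 1ℤ) (unit-square {ρ} ρ⊥a ρ⊥w a∣))))
          where
          r₁ : ∀ a t → - 1ℤ * (1ℤ - (1ℤ + a * t) * (1ℤ + a * t)) ≡ a * (t * (+ 2 + a * t))
          r₁ = solve-∀
        r₃ : ∀ a t q s → (t + q * s) * (+ 2 + a * (t + q * s)) - s * (+ 2 + a * (t + q * s) + a * t) * q ≡ t * (+ 2 + a * t)
        r₃ = solve-∀

    private
      absurd : ∀ q r .{{_ : ℕ.NonZero r}} → r ℕ.< q → ¬ (+ q ∣ + r)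
      absurd q r = ∣-bound

      -- t = 1, 2, 3 rule out the primes from 5 on.
      only-2-3 : ∀ {p} → Prime p → p ℕD.∣ w → p ≡ 2 ⊎ p ≡ 3
      only-2-3 {p} pr p∣w with + p ∣? + 2 | + p ∣? + 3
      ... | yes h₂ | _ = inj₁ (prime∣2 pr (∣⇒∣ᵤ h₂))
      ... | no _ | yes h₃ = inj₂ (prime∣3 pr (∣⇒∣ᵤ h₃))
      ... | no p∤2 | no p∤3 = ⊥-elim ([ caseA , caseB ]′ (alt 1))
        where
        alt : ∀ t → + p ∣ 1ℤ + + a * + t ⊎ + p ∣ + t * (+ 2 + + a * + t)
        alt t with + p ∣? 1ℤ + + a * + t
        ... | yes d = inj₁ d
        ... | no n = inj₂ (local p t p∣w (Cop-sym (prime-Cop pr n)))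
        two : ∀ z → + 2 ≡ z → + p ∣ z → ⊥
        two _ refl = p∤2
        three : ∀ z → + 3 ≡ z → + p ∣ z → ⊥
        three _ refl = p∤3
        caseA : + p ∣ 1ℤ + + a * + 1 → ⊥
        caseA d = [ (λ d′ → two _ (r₁ (+ a)) (∣m∣n⇒∣m-n (∣n⇒∣m*n (+ 3) d) d′)) ,
                    (λ d′ → three _ (r₂ (+ a)) (∣m∣n⇒∣m-n (∣n⇒∣m*n (+ 9) d) d′)) ]′ (alt 3)
          where
          r₁ : ∀ a → + 2 ≡ + 3 * (1ℤ + a * + 1) - (1ℤ + a * + 3)
          r₁ = solve-∀
          r₂ : ∀ a → + 3 ≡ + 9 * (1ℤ + a * + 1) - + 3 * (+ 2 + a * + 3)
          r₂ = solve-∀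
        caseB : + p ∣ + 1 * (+ 2 + + a * + 1) → ⊥
        caseB d = [ (λ d′ → three _ (r₁ (+ a)) (∣m∣n⇒∣m-n (∣n⇒∣m*n (+ 2) d) d′)) ,
                    (λ d′ → p∤2 (prime-sq (+ 2) pr (four _ (r₂ (+ a)) (∣m∣n⇒∣m-n (∣n⇒∣m*n (+ 4) d) d′)))) ]′ (alt 2)
          where
          four : ∀ z → + 2 * + 2 ≡ z → + p ∣ z → + p ∣ + 2 * + 2
          four _ refl h = h
          r₁ : ∀ a → + 3 ≡ + 2 * (+ 1 * (+ 2 + a * + 1)) - (1ℤ + a * + 2)
          r₁ = solve-∀
          r₂ : ∀ a → + 2 * + 2 ≡ + 4 * (+ 1 * (+ 2 + a * + 1)) - + 2 * (+ 2 + a * + 2)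
          r₂ = solve-∀

      -- This and the next four claims apply `local` with a `t` for which 1 + a t is a unit modulo
      -- q, yet t (2 + a t) is a fixed nonzero residue: 6 modulo 9 for t = 3, 8 modulo 16 for t = 4,
      -- and, with the stated divisor of a, 4 modulo 8 for t = 2, 2 modulo 4 and 2 modulo 3 for t =
      -- 1.
      9∤w : ¬ (9 ℕD.∣ w)
      9∤w d = absurd 9 6 (s≤s (s≤s (s≤s (s≤s (s≤s (s≤s (s≤s z≤n))))))) (∣-by (∣m∣n⇒∣m-n
        (local 9 3 d (1ℤ - + a * + 3 , + a * + a , r₁ (+ a))) (∣n⇒∣m*n (+ a) ∣-refl)) (r₂ (+ a)))
        where
        r₁ : ∀ a → (1ℤ - a * + 3) * (1ℤ + a * + 3) + a * a * + 9 ≡ 1ℤ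
        r₁ = solve-∀
        r₂ : ∀ a → + 3 * (+ 2 + a * + 3) - a * + 9 ≡ + 6
        r₂ = solve-∀

      16∤w : ¬ (16 ℕD.∣ w)
      16∤w d = absurd 16 8 (s≤s (s≤s (s≤s (s≤s (s≤s (s≤s (s≤s (s≤s (s≤s z≤n))))))))) (∣-by (∣m∣n⇒∣m-n
        (local 16 4 d (1ℤ - + a * + 4 , + a * + a , r₁ (+ a))) (∣n⇒∣m*n (+ a) ∣-refl)) (r₂ (+ a)))
        where
        r₁ : ∀ a → (1ℤ - a * + 4) * (1ℤ + a * + 4) + a * a * + 16 ≡ 1ℤ
        r₁ = solve-∀
        r₂ : ∀ a → + 4 * (+ 2 + a * + 4) - a * + 16 ≡ + 8
        r₂ = solve-∀

    even⇒8∤w : + 2 ∣ + a → ¬ (8 ℕD.∣ w)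
    even⇒8∤w (divides α e) d = absurd 8 4 (s≤s (s≤s (s≤s (s≤s (s≤s z≤n))))) (∣-by (∣m∣n⇒∣m-n
        (local 8 2 d (subst (λ z → Cop (1ℤ + z * + 2) (+ 8)) (sym e) (1ℤ - α * + 4 , + 2 * α * α , r₁ α))) (∣n⇒∣m*n α ∣-refl))
        (trans (cong (λ z → + 2 * (+ 2 + z * + 2) - α * + 8) e) (r₂ α)))
        where
        r₁ : ∀ α → (1ℤ - α * + 4) * (1ℤ + α * + 2 * + 2) + + 2 * α * α * + 8 ≡ 1ℤ
        r₁ = solve-∀
        r₂ : ∀ α → + 2 * (+ 2 + α * + 2 * + 2) - α * + 8 ≡ + 4
        r₂ = solve-∀

    4∣⇒4∤w : + 4 ∣ + a → ¬ (4 ℕD.∣ w)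
    4∣⇒4∤w (divides α e) d = absurd 4 2 (s≤s (s≤s (s≤s z≤n))) (∣-by (∣m∣n⇒∣m-n
        (local 4 1 d (subst (λ z → Cop (1ℤ + z * + 1) (+ 4)) (sym e) (1ℤ , - α , r₁ α))) (∣n⇒∣m*n α ∣-refl))
        (trans (cong (λ z → + 1 * (+ 2 + z * + 1) - α * + 4) e) (r₂ α)))
        where
        r₁ : ∀ α → 1ℤ * (1ℤ + α * + 4 * + 1) + - α * + 4 ≡ 1ℤ
        r₁ = solve-∀
        r₂ : ∀ α → + 1 * (+ 2 + α * + 4 * + 1) - α * + 4 ≡ + 2
        r₂ = solve-∀

    3∣w⇒3∤a : 3 ℕD.∣ w → ¬ (+ 3 ∣ + a)
    3∣w⇒3∤a d (divides α e) = absurd 3 2 (s≤s (s≤s (s≤s z≤n))) (∣-by (∣m∣n⇒∣m-n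
        (local 3 1 d (subst (λ z → Cop (1ℤ + z * + 1) (+ 3)) (sym e) (1ℤ , - α , r₁ α))) (∣n⇒∣m*n α ∣-refl))
        (trans (cong (λ z → + 1 * (+ 2 + z * + 1) - α * + 3) e) (r₂ α)))
        where
        r₁ : ∀ α → 1ℤ * (1ℤ + α * + 3 * + 1) + - α * + 3 ≡ 1ℤ
        r₁ = solve-∀
        r₂ : ∀ α → + 1 * (+ 2 + α * + 3 * + 1) - α * + 3 ≡ + 2
        r₂ = solve-∀

    w∣24 : w ℕD.∣ 24
    w∣24 = strip (3 ℕD.∣? w)
      where
      eighth : ∀ i n → ¬ n ≡ 0 → (∀ {p} → Prime p → p ℕD.∣ n → p ≡ 2) → ¬ (2 ℕ.^ suc i ℕD.∣ n) → n ℕD.∣ 2 ℕ.^ i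
      eighth i n n≢0 only large with even-or-odd n
      eighth i n n≢0 only large | inj₂ (q , refl) = subst (ℕD._∣ 2 ℕ.^ i) (sym is-one) (ℕD.1∣ (2 ℕ.^ i))
        where
        is-one : 1 ℕ.+ q ℕ.* 2 ≡ 1
        is-one = decidable-stable (1 ℕ.+ q ℕ.* 2 ℕ.≟ 1) λ ne → let p , pr , d = prime-divisor (1 ℕ.+ q ℕ.* 2) (λ ()) ne in
          ℕP.<⇒≱ (s≤s (s≤s z≤n)) (ℕD.∣⇒≤ (ℕD.∣m+n∣m⇒∣n (subst (ℕD._∣ (q ℕ.* 2 ℕ.+ 1)) (only pr d)
            (subst (p ℕD.∣_) (ℕP.+-comm 1 (q ℕ.* 2)) d)) (ℕD.n∣m*n q)))
      eighth zero n n≢0 only large | inj₁ (q , refl) = ⊥-elim (large (ℕD.n∣m*n q))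
      eighth (suc i) n n≢0 only large | inj₁ (q , refl) = subst (ℕD._∣ 2 ℕ.* 2 ℕ.^ i) (ℕP.*-comm 2 q)
        (ℕD.*-monoʳ-∣ 2 (eighth i q (λ z → n≢0 (cong (ℕ._* 2) z)) (λ pr d → only pr (ℕD.∣m⇒∣m*n 2 d))
          (λ d → large (subst (2 ℕ.* 2 ℕ.^ suc i ℕD.∣_) (ℕP.*-comm 2 q) (ℕD.*-monoʳ-∣ 2 d)))))
      strip : Dec (3 ℕD.∣ w) → w ℕD.∣ 24
      strip (no 3∤w) = ℕD.∣-trans (eighth 3 w (ℕ.≢-nonZero⁻¹ w) (λ pr d → [ id , (λ { refl → ⊥-elim (3∤w d) }) ]′ (only-2-3 pr d)) 16∤w)
        (ℕD.divides 3 refl)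
      strip (yes (ℕD.divides w₁ e)) = subst (ℕD._∣ 24) (sym e) (ℕD.*-monoˡ-∣ 3 (eighth 3 w₁ (λ z → ℕ.≢-nonZero⁻¹ w (trans e (cong (ℕ._* 3) z)))
        (λ {p} pr d → [ id , (λ { refl → ⊥-elim (9∤w (subst (9 ℕD.∣_) (sym e) (ℕD.*-monoˡ-∣ 3 d))) }) ]′
          (only-2-3 pr (subst (p ℕD.∣_) (sym e) (ℕD.∣m⇒∣m*n 3 d))))
        (λ d → 16∤w (subst (16 ℕD.∣_) (sym e) (ℕD.∣m⇒∣m*n 3 d)))))

    -- Only ρ must be a unit modulo w; k = r need only be prime to a, since ρ is chosen as r plus a
    -- multiple of a. So `r` may be a prime divisor of w. The solutions X and Y stay prime to w,
    -- hence differ from such an `r`, and the nonzero numbers X² - r² and Y² - r² bound h.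
    extract : ∀ r → 0 ℕ.< r → (∀ {p} → Prime p → p ℕD.∣ r → p ℕD.∣ a → ⊥) → ∃₂ λ X Y →
      v ℕ.* (X ℕ.* X) ℕ.+ u ℕ.* (Y ℕ.* Y) ≡ w ℕ.* (r ℕ.* r) ×
      + (h ℕ.* u) ∣ + (X ℕ.* X) - + (r ℕ.* r) × + (h ℕ.* v) ∣ + (Y ℕ.* Y) - + (r ℕ.* r) ×
      (∀ {p} → Prime p → p ℕD.∣ w → ¬ (p ℕD.∣ X) × ¬ (p ℕD.∣ Y))
    extract r 0<r cop = go (avoid-primes r a (a ℕ.+ w) cop)
      where
      Goal = ∃₂ λ X Y → v ℕ.* (X ℕ.* X) ℕ.+ u ℕ.* (Y ℕ.* Y) ≡ w ℕ.* (r ℕ.* r) ×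
        + (h ℕ.* u) ∣ + (X ℕ.* X) - + (r ℕ.* r) × + (h ℕ.* v) ∣ + (Y ℕ.* Y) - + (r ℕ.* r) ×
        (∀ {p} → Prime p → p ℕD.∣ w → ¬ (p ℕD.∣ X) × ¬ (p ℕD.∣ Y))
      go : (∃ λ t → ∀ {p} → Prime p → p ℕ.≤ a ℕ.+ w → ¬ (p ℕD.∣ r ℕ.+ a ℕ.* t)) → Goal
      go (t , avoid) = fin (rep {ρ} (bez (ℕP.m≤m+n a w)) (bez {w} (ℕP.m≤n+m w a)) r 0<r a∣)
        where
        ρ = + (r ℕ.+ a ℕ.* t)
        bez : ∀ {n} .{{_ : ℕ.NonZero n}} → n ℕ.≤ a ℕ.+ w → Cop ρ (+ n)
        bez {n} n≤ = no-common-prime⇒Cop (ℕ.≢-nonZero⁻¹ n) λ pr d d′ → avoid pr (ℕP.≤-trans (ℕD.∣⇒≤ d′) n≤) d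
        a∣ : + a ∣ + r * + r - ρ * ρ
        a∣ = subst (λ z → + a ∣ + r * + r - z * z) (cong (λ z → + r + z) (sym (ℤP.pos-* a t)))
          (divides (- (+ t * (+ 2 * + r + + a * + t))) (s (+ a) (+ r) (+ t)))
          where
          s : ∀ a r t → r * r - (r + a * t) * (r + a * t) ≡ - (t * (+ 2 * r + a * t)) * a
          s = solve-∀
        prime-free : ∀ {p z g} → Prime p → p ℕD.∣ w → + w ∣ + g → + g ∣ z * z - ρ * ρ → ¬ (p ℕD.∣ abs z)
        prime-free {p} {z} pr p∣w w∣g d p∣z = avoid pr (ℕP.≤-trans (ℕD.∣⇒≤ p∣w) (ℕP.m≤n+m w a)) (∣⇒∣ᵤ (prime-sq ρ pr (∣-by
          (∣m∣n⇒∣m-n (∣n⇒∣m*n z (∣ᵤ⇒∣ {+ p} {z} p∣z)) (∣-trans (∣ᵤ⇒∣ {+ p} {+ w} p∣w) (∣-trans w∣g d))) (s z ρ))))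
          where
          s : ∀ z ρ → z * z - (z * z - ρ * ρ) ≡ ρ * ρ
          s = solve-∀
        reduce : ∀ {d} z → + d ∣ + a → + d ∣ z * z - ρ * ρ → + d ∣ + (abs z ℕ.* abs z) - + (r ℕ.* r)
        reduce {d} z d∣a h = subst₂ (λ s t → + d ∣ s - t) (sq-abs z) (sym (ℤP.pos-* r r))
          (∣-by (∣m∣n⇒∣m-n h (∣-trans d∣a a∣)) (s (z * z) (ρ * ρ) (+ r * + r)))
          where
          s : ∀ x y z → x - y - (z - y) ≡ x - z
          s = solve-∀
        fin : (∃₂ λ x y → + v * (x * x) + + u * (y * y) ≡ + w * (+ r * + r) ×
          + (h ℕ.* u ℕ.* w) ∣ x * x - ρ * ρ × + (h ℕ.* v ℕ.* w) ∣ y * y - ρ * ρ) → Goal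
        fin (x , y , e , d₁ , d₂) = abs x , abs y ,
          ℤP.+-injective (trans (sym (form-abs u v x y)) (trans e (trans (cong (+ w *_) (sym (ℤP.pos-* r r))) (sym (ℤP.pos-* w (r ℕ.* r)))))) ,
          reduce x (∣ᵤ⇒∣ {+ (h ℕ.* u)} {+ a} (ℕD.m∣m*n v)) (∣-trans (∣ᵤ⇒∣ {+ (h ℕ.* u)} {+ (h ℕ.* u ℕ.* w)} (ℕD.m∣m*n w)) d₁) ,
          reduce y (∣ᵤ⇒∣ {+ (h ℕ.* v)} {+ a} (ℕD.divides u (s h u v))) (∣-trans (∣ᵤ⇒∣ {+ (h ℕ.* v)} {+ (h ℕ.* v ℕ.* w)} (ℕD.m∣m*n w)) d₂) ,
          (λ pr p∣w → prime-free {z = x} pr p∣w (∣ᵤ⇒∣ {+ w} {+ (h ℕ.* u ℕ.* w)} (ℕD.n∣m*n (h ℕ.* u))) d₁ ,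
                      prime-free {z = y} pr p∣w (∣ᵤ⇒∣ {+ w} {+ (h ℕ.* v ℕ.* w)} (ℕD.n∣m*n (h ℕ.* v))) d₂)
          where
          s : ∀ h u v → h ℕ.* u ℕ.* v ≡ u ℕ.* (h ℕ.* v)
          s = solveᴺ-∀

-- Finite searches.

-- For u + v ∣ 24 this amounts to coprimality, and it is cheap to evaluate.
Reduced : ℕ → ℕ → Set
Reduced u v = ¬ (2 ℕD.∣ u × 2 ℕD.∣ v) × ¬ (3 ℕD.∣ u × 3 ℕD.∣ v)

reduced? : ∀ u v → Dec (Reduced u v)
reduced? u v = ¬? ((2 ℕD.∣? u) ×-dec (2 ℕD.∣? v)) ×-dec ¬? ((3 ℕD.∣? u) ×-dec (3 ℕD.∣? v))

_∈³?_ : (t : ℕ × ℕ × ℕ) (ts : List (ℕ × ℕ × ℕ)) → Dec (t ∈ ts)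
_∈³?_ = _∈?_
  where
  open import Data.Product.Properties using (≡-dec)
  open import Data.List.Membership.DecPropositional (≡-dec ℕ._≟_ (≡-dec ℕ._≟_ ℕ._≟_)) using (_∈?_)

oddTable evenTable : List (ℕ × ℕ × ℕ)
oddTable = (1 , 1 , 7) ∷ (3 , 1 , 7) ∷ (1 , 3 , 5) ∷ (1 , 7 , 1) ∷ (3 , 7 , 1) ∷ (1 , 5 , 3) ∷ []
evenTable = (1 , 1 , 2) ∷ (2 , 1 , 2) ∷ (4 , 1 , 2) ∷ (8 , 1 , 2) ∷ (2 , 1 , 5) ∷ (4 , 1 , 5) ∷ (8 , 1 , 5) ∷
            (1 , 2 , 1) ∷ (2 , 2 , 1) ∷ (4 , 2 , 1) ∷ (8 , 2 , 1) ∷ (2 , 5 , 1) ∷ (4 , 5 , 1) ∷ (8 , 5 , 1) ∷ []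

-- The bounds belong to r = 2 and w ≤ 24: the equation gives X² ≤ 4w ≤ 96 < 10², likewise for Y, and
-- h u divides the nonzero number X² - 4, of absolute value at most 100.
odd-search : ∀ {u} → u ℕ.< 24 → ∀ {v} → v ℕ.< 24 → u ℕ.+ v ℕD.∣ 24 → Reduced u v →
  ∀ {X} → X ℕ.< 10 → ∀ {Y} → Y ℕ.< 10 → v ℕ.* (X ℕ.* X) ℕ.+ u ℕ.* (Y ℕ.* Y) ≡ (u ℕ.+ v) ℕ.* 4 →
  ¬ (2 ℕD.∣ X) → ¬ (2 ℕD.∣ Y) → ∀ {h} → h ℕ.< 101 →
  + (h ℕ.* u) ∣ + (X ℕ.* X) - + 4 → + (h ℕ.* v) ∣ + (Y ℕ.* Y) - + 4 → ¬ (2 ℕD.∣ h ℕ.* u ℕ.* v) → (h , u , v) ∈ oddTable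
odd-search = toWitness {a? = odd?} _
  where
  odd? = ℕP.allUpTo? (λ u → ℕP.allUpTo? (λ v → (u ℕ.+ v ℕD.∣? 24) →-dec reduced? u v →-dec
    ℕP.allUpTo? (λ X → ℕP.allUpTo? (λ Y → (v ℕ.* (X ℕ.* X) ℕ.+ u ℕ.* (Y ℕ.* Y) ℕ.≟ (u ℕ.+ v) ℕ.* 4) →-dec
    ¬? (2 ℕD.∣? X) →-dec ¬? (2 ℕD.∣? Y) →-dec
    ℕP.allUpTo? (λ h → (+ (h ℕ.* u) ∣? + (X ℕ.* X) - + 4) →-dec (+ (h ℕ.* v) ∣? + (Y ℕ.* Y) - + 4) →-dec
      ¬? (2 ℕD.∣? h ℕ.* u ℕ.* v) →-dec ((h , u , v) ∈³? oddTable)) 101) 10) 10) 24) 24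

-- The bounds belong to r = 3 and w ≤ 12: now X² ≤ 9w ≤ 108 < 11², and h u divides X² - 9.
even-search : ∀ {u} → u ℕ.< 24 → ∀ {v} → v ℕ.< 24 → u ℕ.+ v ℕD.∣ 12 → 3 ℕD.∣ u ℕ.+ v → Reduced u v →
  ∀ {X} → X ℕ.< 11 → ∀ {Y} → Y ℕ.< 11 → v ℕ.* (X ℕ.* X) ℕ.+ u ℕ.* (Y ℕ.* Y) ≡ (u ℕ.+ v) ℕ.* 9 →
  ¬ (3 ℕD.∣ X) → ¬ (3 ℕD.∣ Y) → ∀ {h} → h ℕ.< 101 →
  + (h ℕ.* u) ∣ + (X ℕ.* X) - + 9 → + (h ℕ.* v) ∣ + (Y ℕ.* Y) - + 9 → 2 ℕD.∣ h ℕ.* u ℕ.* v → (h , u , v) ∈ evenTable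
even-search = toWitness {a? = even?} _
  where
  even? = ℕP.allUpTo? (λ u → ℕP.allUpTo? (λ v → (u ℕ.+ v ℕD.∣? 12) →-dec (3 ℕD.∣? u ℕ.+ v) →-dec reduced? u v →-dec
    ℕP.allUpTo? (λ X → ℕP.allUpTo? (λ Y → (v ℕ.* (X ℕ.* X) ℕ.+ u ℕ.* (Y ℕ.* Y) ℕ.≟ (u ℕ.+ v) ℕ.* 9) →-dec
    ¬? (3 ℕD.∣? X) →-dec ¬? (3 ℕD.∣? Y) →-dec
    ℕP.allUpTo? (λ h → (+ (h ℕ.* u) ∣? + (X ℕ.* X) - + 9) →-dec (+ (h ℕ.* v) ∣? + (Y ℕ.* Y) - + 9) →-dec
      (2 ℕD.∣? h ℕ.* u ℕ.* v) →-dec ((h , u , v) ∈³? evenTable)) 101) 11) 11) 24) 24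

-- The remaining pairs (u , v), for which h is not yet bounded. The leading 0 is a filler that
-- allows the membership test for triples to be reused.
smallTable : List (ℕ × ℕ × ℕ)
smallTable = (0 , 1 , 1) ∷ (0 , 1 , 3) ∷ (0 , 3 , 1) ∷ []

small-search : ∀ {u} → u ℕ.< 24 → ∀ {v} → v ℕ.< 24 → ¬ u ≡ 0 → ¬ v ≡ 0 → u ℕ.+ v ℕD.∣ 24 → Reduced u v →
  ¬ (3 ℕD.∣ u ℕ.+ v) → ¬ (8 ℕD.∣ u ℕ.+ v) → (0 , u , v) ∈ smallTable
small-search = toWitness {a? = small?} _
  where
  small? = ℕP.allUpTo? (λ u → ℕP.allUpTo? (λ v → ¬? (u ℕ.≟ 0) →-dec ¬? (v ℕ.≟ 0) →-dec
    (u ℕ.+ v ℕD.∣? 24) →-dec reduced? u v →-dec ¬? (3 ℕD.∣? u ℕ.+ v) →-dec ¬? (8 ℕD.∣? u ℕ.+ v) →-dec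
    ((0 , u , v) ∈³? smallTable)) 24) 24

divisor-12 : ∀ {w} → w ℕ.< 25 → w ℕD.∣ 24 → ¬ (8 ℕD.∣ w) → w ℕD.∣ 12
divisor-12 = toWitness {a? = ℕP.allUpTo? (λ w → (w ℕD.∣? 24) →-dec ¬? (8 ℕD.∣? w) →-dec (w ℕD.∣? 12)) 25} _

reduced : ∀ {u v} → gcd u v ≡ 1 → Reduced u v
reduced {u} {v} g≡1 = (λ h → common h λ ()) , (λ h → common h λ ())
  where
  common : ∀ {d} → d ℕD.∣ u × d ℕD.∣ v → ¬ d ≡ 1 → ⊥
  common {d} (h , h′) d≢1 = d≢1 (ℕD.∣1⇒≡1 (subst (d ℕD.∣_) g≡1 (gcd-greatest h h′)))

square-< : ∀ {X n} → X ℕ.* X ℕ.< n ℕ.* n → X ℕ.< n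
square-< {X} {n} h = ℕP.≰⇒> λ n≤X → ℕP.<⇒≱ h (ℕP.*-mono-≤ n≤X n≤X)

module Table (h u v : ℕ) .{{nzh : ℕ.NonZero h}} .{{nzu : ℕ.NonZero u}} .{{nzv : ℕ.NonZero v}}
  (g≡1 : gcd u v ≡ 1) (rep : Represents h u v) where

  private
    w = u ℕ.+ v
    a = h ℕ.* u ℕ.* v

  u⊥v : Cop (+ u) (+ v)
  u⊥v = Cop-coprime (gcd≡1⇒coprime g≡1)

  open Analysis h u v u⊥v rep public

  w≤24 : w ℕ.≤ 24
  w≤24 = ℕD.∣⇒≤ w∣24

  u<24 : u ℕ.< 24
  u<24 = ℕP.<-≤-trans (ℕP.m<m+n u (ℕ.>-nonZero⁻¹ v)) w≤24

  v<24 : v ℕ.< 24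
  v<24 = ℕP.<-≤-trans (ℕP.m<n+m v (ℕ.>-nonZero⁻¹ u)) w≤24

  private
    -- v X² + u Y² = w r² ≤ n r² < m²
    small-X : ∀ {X Y} n r m → w ℕ.≤ n → n ℕ.* r ℕ.< m ℕ.* m → v ℕ.* (X ℕ.* X) ℕ.+ u ℕ.* (Y ℕ.* Y) ≡ w ℕ.* r → X ℕ.< m × Y ℕ.< m
    small-X {X} {Y} n r m w≤n lt e =
      square-< (ℕP.≤-<-trans (ℕP.≤-trans (ℕP.m≤n*m (X ℕ.* X) v) (ℕP.≤-trans (ℕP.m≤m+n _ _) total)) lt) ,
      square-< (ℕP.≤-<-trans (ℕP.≤-trans (ℕP.m≤n*m (Y ℕ.* Y) u) (ℕP.≤-trans (ℕP.m≤n+m _ _) total)) lt)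
      where
      total : v ℕ.* (X ℕ.* X) ℕ.+ u ℕ.* (Y ℕ.* Y) ℕ.≤ n ℕ.* r
      total = ℕP.≤-trans (ℕP.≤-reflexive e) (ℕP.*-monoˡ-≤ r w≤n)

    small-h : ∀ {X} r → + (h ℕ.* u) ∣ + (X ℕ.* X) - + r → ¬ X ℕ.* X ≡ r → X ℕ.* X ℕ.≤ 100 → r ℕ.≤ 100 → h ℕ.< 101
    small-h {X} r d ne X≤ r≤ = s≤s (ℕP.≤-trans (ℕP.m≤m*n h u) (ℕP.≤-trans
      (ℕD.∣⇒≤ {{ℕ.≢-nonZero λ z → ne (ℤP.+-injective (ℤP.i-j≡0⇒i≡j (+ (X ℕ.* X)) (+ r) (ℤP.∣i∣≡0⇒i≡0 z)))}} (∣⇒∣ᵤ d))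
      (subst (ℕ._≤ 100) (cong abs (sym (ℤP.m-n≡m⊖n (X ℕ.* X) r)))
        (ℕP.≤-trans (ℤP.∣m⊝n∣≤m⊔n (X ℕ.* X) r) (ℕP.⊔-lub X≤ r≤)))))

    distinct : ∀ {X p} → ¬ (p ℕD.∣ X) → ¬ X ℕ.* X ≡ p ℕ.* p
    distinct {X} {p} p∤X e = p∤X (subst (p ℕD.∣_) (sym (square-unique {X} {p} e)) ℕD.∣-refl)

    square≤ : ∀ {X n} → X ℕ.< suc n → X ℕ.* X ℕ.≤ n ℕ.* n
    square≤ h = ℕP.*-mono-≤ (ℕP.≤-pred h) (ℕP.≤-pred h)

  odd-table : ¬ (2 ℕD.∣ a) → (h , u , v) ∈ oddTable
  odd-table 2∤a = use (extract 2 (s≤s z≤n) λ {p} pr d d′ → 2∤a (subst (ℕD._∣ a) (prime∣2 pr d) d′))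
    where
    2∣w : 2 ℕD.∣ w
    2∣w = even (even-or-odd u) (even-or-odd v)
      where
      even : (∃ λ q → u ≡ q ℕ.* 2) ⊎ (∃ λ q → u ≡ 1 ℕ.+ q ℕ.* 2) → (∃ λ q → v ≡ q ℕ.* 2) ⊎ (∃ λ q → v ≡ 1 ℕ.+ q ℕ.* 2) → 2 ℕD.∣ w
      even (inj₁ (q , e)) _ = ⊥-elim (2∤a (ℕD.∣m⇒∣m*n v (ℕD.∣n⇒∣m*n h (ℕD.divides q e))))
      even _ (inj₁ (q , e)) = ⊥-elim (2∤a (ℕD.∣n⇒∣m*n (h ℕ.* u) (ℕD.divides q e)))
      even (inj₂ (q , e)) (inj₂ (q′ , e′)) = ℕD.divides (1 ℕ.+ q ℕ.+ q′) (trans (cong₂ ℕ._+_ e e′) (r q q′))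
        where
        r : ∀ q q′ → 1 ℕ.+ q ℕ.* 2 ℕ.+ (1 ℕ.+ q′ ℕ.* 2) ≡ (1 ℕ.+ q ℕ.+ q′) ℕ.* 2
        r = solveᴺ-∀
    use : (∃₂ λ X Y → v ℕ.* (X ℕ.* X) ℕ.+ u ℕ.* (Y ℕ.* Y) ≡ w ℕ.* 4 × + (h ℕ.* u) ∣ + (X ℕ.* X) - + 4 ×
      + (h ℕ.* v) ∣ + (Y ℕ.* Y) - + 4 × (∀ {p} → Prime p → p ℕD.∣ w → ¬ (p ℕD.∣ X) × ¬ (p ℕD.∣ Y))) → (h , u , v) ∈ oddTable
    use (X , Y , e , dX , dY , free) = odd-search u<24 v<24 w∣24 (reduced g≡1) X<10 Y<10 e 2∤X 2∤Y
      (small-h {X} 4 dX (distinct {X} {2} 2∤X) (ℕP.≤-trans (square≤ X<10) (ℕP.m≤m+n 81 19)) (ℕP.m≤m+n 4 96)) dX dY 2∤a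
      where
      bounds = small-X {X} {Y} 24 4 10 w≤24 (ℕP.m≤m+n 97 3) e
      X<10 = proj₁ bounds
      Y<10 = proj₂ bounds
      2∤X = proj₁ (free prime[2] 2∣w)
      2∤Y = proj₂ (free prime[2] 2∣w)

  -- When 3 divides w it does not divide a, so r = 3 is admissible although 2 is not; and w divides
  -- 12 because a is even.
  even-table : 2 ℕD.∣ a → 3 ℕD.∣ w → (h , u , v) ∈ evenTable
  even-table 2∣a 3∣w = use (extract 3 (s≤s z≤n) λ {p} pr d d′ →
      3∣w⇒3∤a 3∣w (∣ᵤ⇒∣ {+ 3} {+ a} (subst (ℕD._∣ a) (prime∣3 pr d) d′)))
    where
    w∣12 : w ℕD.∣ 12
    w∣12 = divisor-12 (s≤s w≤24) w∣24 (even⇒8∤w (∣ᵤ⇒∣ {+ 2} {+ a} 2∣a))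
    use : (∃₂ λ X Y → v ℕ.* (X ℕ.* X) ℕ.+ u ℕ.* (Y ℕ.* Y) ≡ w ℕ.* 9 × + (h ℕ.* u) ∣ + (X ℕ.* X) - + 9 ×
      + (h ℕ.* v) ∣ + (Y ℕ.* Y) - + 9 × (∀ {p} → Prime p → p ℕD.∣ w → ¬ (p ℕD.∣ X) × ¬ (p ℕD.∣ Y))) → (h , u , v) ∈ evenTable
    use (X , Y , e , dX , dY , free) = even-search u<24 v<24 w∣12 3∣w (reduced g≡1) X<11 Y<11 e 3∤X 3∤Y
      (small-h {X} 9 dX (distinct {X} {3} 3∤X) (square≤ X<11) (ℕP.m≤m+n 9 91)) dX dY 2∣a
      where
      bounds = small-X {X} {Y} 12 9 11 (ℕD.∣⇒≤ w∣12) (ℕP.m≤m+n 109 12) e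
      X<11 = proj₁ bounds
      Y<11 = proj₂ bounds
      3∤X = proj₁ (free prime[3] 3∣w)
      3∤Y = proj₂ (free prime[3] 3∣w)

  small-table : 2 ℕD.∣ a → ¬ (3 ℕD.∣ w) → (0 , u , v) ∈ smallTable
  small-table 2∣a 3∤w = small-search u<24 v<24 (ℕ.≢-nonZero⁻¹ u) (ℕ.≢-nonZero⁻¹ v) w∣24 (reduced g≡1) 3∤w
    (even⇒8∤w (∣ᵤ⇒∣ {+ 2} {+ a} 2∣a))

record Shape (a b c : ℕ) : Set where
  constructor shape
  field
    h u v : ℕ
    {{nzh}} : ℕ.NonZero h
    {{nzu}} : ℕ.NonZero u
    {{nzv}} : ℕ.NonZero v
    coprime : gcd u v ≡ 1
    a≡ : a ≡ h ℕ.* u ℕ.* v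
    b≡ : b ≡ h ℕ.* u ℕ.* (u ℕ.+ v)
    c≡ : c ≡ h ℕ.* v ℕ.* (u ℕ.+ v)

-- With b = g u, c = g v and g = gcd(b, c), the equation becomes g u v = a (u + v). As u + v is
-- prime to u and v, it divides g, and h is the quotient.
harmonic-shape : ∀ {a b c} .{{_ : ℕ.NonZero b}} .{{_ : ℕ.NonZero c}} → b ℕ.* c ≡ a ℕ.* (b ℕ.+ c) → Shape a b c
harmonic-shape {a} {b} {c} e = go (gcd[m,n]∣m b c) (gcd[m,n]∣n b c)
  where
  g = gcd b c
  go : g ℕD.∣ b → g ℕD.∣ c → Shape a b c
  go (ℕD.divides u b≡) (ℕD.divides v c≡) = fin w∣g
    where
    nz : ∀ {m x y} .{{_ : ℕ.NonZero m}} → m ≡ x ℕ.* y → ¬ x ≡ 0 × ¬ y ≡ 0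
    nz {m} {x} {y} refl = (λ z → ℕ.≢-nonZero⁻¹ (x ℕ.* y) (cong (ℕ._* y) z)) ,
      (λ z → ℕ.≢-nonZero⁻¹ (x ℕ.* y) (trans (cong (x ℕ.*_) z) (ℕP.*-zeroʳ x)))
    instance
      nzg : ℕ.NonZero g
      nzg = ℕ.≢-nonZero (proj₂ (nz {b} {u} {g} b≡))
      nzu : ℕ.NonZero u
      nzu = ℕ.≢-nonZero (proj₁ (nz {b} {u} {g} b≡))
      nzv : ℕ.NonZero v
      nzv = ℕ.≢-nonZero (proj₁ (nz {c} {v} {g} c≡))
      nzw : ℕ.NonZero (u ℕ.+ v)
      nzw = ℕ.>-nonZero (ℕP.<-≤-trans (ℕ.>-nonZero⁻¹ u) (ℕP.m≤m+n u v))
    u⊥v : Coprime u v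
    u⊥v {d} (d∣u , d∣v) = ℕD.∣1⇒≡1 (ℕD.*-cancelʳ-∣ g (subst (d ℕ.* g ℕD.∣_) (sym (ℕP.*-identityˡ g)) (gcd-greatest
      (subst (d ℕ.* g ℕD.∣_) (sym b≡) (ℕD.*-monoˡ-∣ g d∣u)) (subst (d ℕ.* g ℕD.∣_) (sym c≡) (ℕD.*-monoˡ-∣ g d∣v)))))
    guv : g ℕ.* (u ℕ.* v) ≡ a ℕ.* (u ℕ.+ v)
    guv = ℕP.*-cancelʳ-≡ _ _ g (trans (r₁ g u v) (trans (sym (cong₂ ℕ._*_ b≡ c≡)) (trans e
      (trans (cong (a ℕ.*_) (cong₂ ℕ._+_ b≡ c≡)) (r₂ a g u v)))))
      where
      r₁ : ∀ g u v → g ℕ.* (u ℕ.* v) ℕ.* g ≡ u ℕ.* g ℕ.* (v ℕ.* g)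
      r₁ = solveᴺ-∀
      r₂ : ∀ a g u v → a ℕ.* (u ℕ.* g ℕ.+ v ℕ.* g) ≡ a ℕ.* (u ℕ.+ v) ℕ.* g
      r₂ = solveᴺ-∀
    w⊥u : Coprime (u ℕ.+ v) u
    w⊥u (d∣w , d∣u) = u⊥v (d∣u , ℕD.∣m+n∣m⇒∣n d∣w d∣u)
    w⊥v : Coprime (u ℕ.+ v) v
    w⊥v {d} (d∣w , d∣v) = u⊥v (ℕD.∣m+n∣m⇒∣n (subst (d ℕD.∣_) (ℕP.+-comm u v) d∣w) d∣v , d∣v)
    w∣g : u ℕ.+ v ℕD.∣ g
    w∣g = coprime-divisor w⊥v (coprime-divisor w⊥u (ℕD.divides a (trans (r g u v) guv)))
      where
      r : ∀ g u v → u ℕ.* (v ℕ.* g) ≡ g ℕ.* (u ℕ.* v)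
      r = solveᴺ-∀
    fin : u ℕ.+ v ℕD.∣ g → Shape a b c
    fin (ℕD.divides h g≡) = shape h u v {{ℕ.≢-nonZero (proj₁ (nz {g} {h} {u ℕ.+ v} g≡))}} (coprime⇒gcd≡1 u⊥v)
      (sym (ℕP.*-cancelʳ-≡ _ _ (u ℕ.+ v) (trans (r₁ h u v) (trans (cong (ℕ._* (u ℕ.* v)) (sym g≡)) guv))))
      (trans b≡ (trans (cong (u ℕ.*_) g≡) (r₂ h u (u ℕ.+ v)))) (trans c≡ (trans (cong (v ℕ.*_) g≡) (r₂ h v (u ℕ.+ v))))
      where
      r₁ : ∀ h u v → h ℕ.* u ℕ.* v ℕ.* (u ℕ.+ v) ≡ h ℕ.* (u ℕ.+ v) ℕ.* (u ℕ.* v)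
      r₁ = solveᴺ-∀
      r₂ : ∀ h u w → u ℕ.* (h ℕ.* w) ≡ h ℕ.* u ℕ.* w
      r₂ = solveᴺ-∀

-- The identities of the list, and the classification.

even-cofactor : ∀ k {q} → + k ∣ + (k ℕ.* q)
even-cofactor k {q} = ∣ᵤ⇒∣ {+ k} {+ (k ℕ.* q)} (ℕD.m∣m*n q)

odd-multiple : ∀ {q} k → Odd q → (∀ x y → ¬ (+ 2 ∣ y) → ¬ (+ 8 ∣ + k * y)) → ¬ (+ 8 ∣ + (k ℕ.* q))
odd-multiple {q} k odd dec h = dec 0ℤ (+ q) (λ d → 0≢1 (trans (sym (even (∣⇒∣ᵤ d))) odd)) (subst (+ 8 ∣_) (ℤP.pos-* k q) h)
  where
  even : 2 ℕD.∣ q → q % 2 ≡ 0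
  even (ℕD.divides p refl) = m*n%n≡0 p 2

8∤2*odd : ∀ x y → ¬ (+ 2 ∣ y) → ¬ (+ 8 ∣ + 2 * y)
8∤2*odd = decide 8 (ndv 2 𝕪 ⇒ ndv 8 (κ (+ 2) ⊗ 𝕪))

8∤4*odd : ∀ x y → ¬ (+ 2 ∣ y) → ¬ (+ 8 ∣ + 4 * y)
8∤4*odd = decide 8 (ndv 2 𝕪 ⇒ ndv 8 (κ (+ 4) ⊗ 𝕪))

8∤6*odd : ∀ x y → ¬ (+ 2 ∣ y) → ¬ (+ 8 ∣ + 6 * y)
8∤6*odd = decide 8 (ndv 2 𝕪 ⇒ ndv 8 (κ (+ 6) ⊗ 𝕪))

8∤12*odd : ∀ x y → ¬ (+ 2 ∣ y) → ¬ (+ 8 ∣ + 12 * y)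
8∤12*odd = decide 8 (ndv 2 𝕪 ⇒ ndv 8 (κ (+ 12) ⊗ 𝕪))

-- The case g = 1 serves sufficiency. Arbitrary odd g serves necessity, where multiples of (6, 8,
-- 24) have to be excluded.
cancel-24 : ∀ g → Odd g → f (6 ℕ.* g) ≡₂ (f (8 ℕ.* g) ⊛ f (24 ℕ.* g)) → f (8 ℕ.* g) ≡₂ (f (12 ℕ.* g) ⊛ f (24 ℕ.* g))
cancel-24 g odd H = cancel-root {f (6 ℕ.* g)} {f (8 ℕ.* g)} {f (12 ℕ.* g)} {f (24 ℕ.* g)} (f-zero (24 ℕ.* g)) H
  (f-square-root (6 ℕ.* g) (12 ℕ.* g) (r₁ g) (∣ᵤ⇒∣ {+ 2} {+ (6 ℕ.* g)} (ℕD.∣m⇒∣m*n g (ℕD.divides 3 refl))) (odd-multiple {g} 6 odd 8∤6*odd))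
  (f-square-root (12 ℕ.* g) (24 ℕ.* g) (r₂ g) (∣ᵤ⇒∣ {+ 2} {+ (12 ℕ.* g)} (ℕD.∣m⇒∣m*n g (ℕD.divides 6 refl))) (odd-multiple {g} 12 odd 8∤12*odd))
  where
  r₁ : ∀ g → 12 ℕ.* g ≡ 2 ℕ.* (6 ℕ.* g)
  r₁ = solveᴺ-∀
  r₂ : ∀ g → 24 ℕ.* g ≡ 2 ℕ.* (12 ℕ.* g)
  r₂ = solveᴺ-∀

identity-8 : f 8 ≡₂ (f 12 ⊛ f 24)
identity-8 = cancel-24 1 refl Identity6.identity

form-identity : ∀ {a b c} → Form a b c → f a ≡₂ (f b ⊛ f c)
form-identity (form2q q _ odd refl refl refl) = f-square-root (2 ℕ.* q) (4 ℕ.* q) (r q) (even-cofactor 2 {q}) (odd-multiple {q} 2 odd 8∤2*odd)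
  where
  r : ∀ q → 4 ℕ.* q ≡ 2 ℕ.* (2 ℕ.* q)
  r = solveᴺ-∀
form-identity (form4q q _ odd refl refl refl) = f-square-root (4 ℕ.* q) (8 ℕ.* q) (r q)
  (∣ᵤ⇒∣ {+ 2} {+ (4 ℕ.* q)} (ℕD.∣m⇒∣m*n q (ℕD.divides 2 refl))) (odd-multiple {q} 4 odd 8∤4*odd)
  where
  r : ∀ q → 8 ℕ.* q ≡ 2 ℕ.* (4 ℕ.* q)
  r = solveᴺ-∀
-- Squaring an identity halves its indices, because `f m` is the square of `f (2 m)` for the m in
-- question.
form-identity (formExc e1) = square-product {f 8} {f 12} {f 24} {f 4} {f 6} {f 12} identity-8
  (f-square-root 4 8 refl (divides (+ 2) refl) (toWitnessFalse {a? = + 8 ∣? + 4} _))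
  (f-square-root 6 12 refl (divides (+ 3) refl) (toWitnessFalse {a? = + 8 ∣? + 6} _))
  (f-square-root 12 24 refl (divides (+ 6) refl) (toWitnessFalse {a? = + 8 ∣? + 12} _))
form-identity (formExc e2) = Identity6.identity
form-identity (formExc e3) = identity-8
form-identity (formExc e4) = square-product {f 20} {f 24} {f 120} {f 10} {f 12} {f 60} Identity20.identity
  (f-square-root 10 20 refl (divides (+ 5) refl) (toWitnessFalse {a? = + 8 ∣? + 10} _))
  (f-square-root 12 24 refl (divides (+ 6) refl) (toWitnessFalse {a? = + 8 ∣? + 12} _))
  (f-square-root 60 120 refl (divides (+ 30) refl) (toWitnessFalse {a? = + 8 ∣? + 60} _))
form-identity (formExc e5) = Identity15.identity
form-identity (formExc e6) = f-even-part {8} {12} {24} (divides (+ 6) refl) (toWitnessFalse {a? = + 8 ∣? + 12} _) identity-8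
form-identity (formExc e7) = Identity20.identity
form-identity (formExc e8) = Identity21.identity

Forms : ℕ → ℕ → ℕ → Set
Forms a b c = Form a b c ⊎ Form a c b

-- The entries rejected here fail at the coefficient of q.
odd-case : ∀ {h u v} → (h , u , v) ∈ oddTable → f (h ℕ.* u ℕ.* v) ≡₂ (f (h ℕ.* u ℕ.* (u ℕ.+ v)) ⊛ f (h ℕ.* v ℕ.* (u ℕ.+ v))) →
  Forms (h ℕ.* u ℕ.* v) (h ℕ.* u ℕ.* (u ℕ.+ v)) (h ℕ.* v ℕ.* (u ℕ.+ v))
odd-case (here refl) H = ⊥-elim (0≢1 (H 1))
odd-case (there (here refl)) H = inj₁ (formExc e8)
odd-case (there (there (here refl))) H = inj₁ (formExc e5)
odd-case (there (there (there (here refl)))) H = ⊥-elim (0≢1 (H 1))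
odd-case (there (there (there (there (here refl))))) H = inj₂ (formExc e8)
odd-case (there (there (there (there (there (here refl)))))) H = inj₂ (formExc e5)

even-case : ∀ {h u v} → (h , u , v) ∈ evenTable → f (h ℕ.* u ℕ.* v) ≡₂ (f (h ℕ.* u ℕ.* (u ℕ.+ v)) ⊛ f (h ℕ.* v ℕ.* (u ℕ.+ v))) →
  Forms (h ℕ.* u ℕ.* v) (h ℕ.* u ℕ.* (u ℕ.+ v)) (h ℕ.* v ℕ.* (u ℕ.+ v))
even-case (here refl) H = ⊥-elim (0≢1 (H 1))
even-case (there (here refl)) H = inj₁ (formExc e1)
even-case (there (there (here refl))) H = inj₁ (formExc e3)
even-case (there (there (there (here refl)))) H = inj₁ (formExc e6)
even-case (there (there (there (there (here refl))))) H = inj₁ (formExc e4)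
even-case (there (there (there (there (there (here refl)))))) H = inj₁ (formExc e7)
even-case (there (there (there (there (there (there (here refl))))))) H = ⊥-elim (0≢1 (H 1))
even-case (there (there (there (there (there (there (there (here refl)))))))) H = ⊥-elim (0≢1 (H 1))
even-case (there (there (there (there (there (there (there (there (here refl))))))))) H = inj₂ (formExc e1)
even-case (there (there (there (there (there (there (there (there (there (here refl)))))))))) H = inj₂ (formExc e3)
even-case (there (there (there (there (there (there (there (there (there (there (here refl))))))))))) H = inj₂ (formExc e6)
even-case (there (there (there (there (there (there (there (there (there (there (there (here refl)))))))))))) H = inj₂ (formExc e4)
even-case (there (there (there (there (there (there (there (there (there (there (there (there (here refl))))))))))))) H = inj₂ (formExc e7)
even-case (there (there (there (there (there (there (there (there (there (there (there (there (there (here refl)))))))))))))) H = ⊥-elim (0≢1 (H 1))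

odd-half : ∀ q → ¬ (2 ℕD.∣ q) → Odd q
odd-half q h with even-or-odd q
... | inj₁ (p , e) = ⊥-elim (h (ℕD.divides p e))
... | inj₂ (p , refl) = odd%2 p

-- Here u = v = 1, so a = h and b = c = 2h, and the two families are h = 2q and h = 4q. If h = 8k,
-- then ρ = 1 + 4k has ρ² - 1 = 8k (1 + 2k), divisible by a = 8k but not by b = 16k, against
-- `unit-square`.
equal-case : ∀ h .{{_ : ℕ.NonZero h}} → Represents h 1 1 → 2 ℕD.∣ h ℕ.* 1 ℕ.* 1 → Form (h ℕ.* 1 ℕ.* 1) (h ℕ.* 1 ℕ.* 2) (h ℕ.* 1 ℕ.* 2)
equal-case h rep (ℕD.divides q e) = split (2 ℕD.∣? q)
  where
  h≡ : h ≡ q ℕ.* 2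
  h≡ = trans (sym (trans (ℕP.*-identityʳ (h ℕ.* 1)) (ℕP.*-identityʳ h))) e
  0<factor : ∀ q k → h ≡ q ℕ.* k → 0 ℕ.< q
  0<factor zero k e′ = ⊥-elim (ℕ.≢-nonZero⁻¹ h e′)
  0<factor (suc q) k e′ = s≤s z≤n
  scale : ∀ k q j → h ≡ q ℕ.* j → h ℕ.* 1 ℕ.* k ≡ j ℕ.* k ℕ.* q
  scale k q j e′ = trans (cong (λ t → t ℕ.* 1 ℕ.* k) e′) (r k q j)
    where
    r : ∀ k q j → q ℕ.* j ℕ.* 1 ℕ.* k ≡ j ℕ.* k ℕ.* q
    r = solveᴺ-∀
  8∤h : ∀ k → ¬ h ≡ k ℕ.* 8
  8∤h k e′ = ∣-bound {2} {1} (s≤s (s≤s z≤n)) (odd-part (+ k) (nonZero k {{ℕ.>-nonZero (0<factor k 8 e′)}})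
      (subst (_∣ 1ℤ - ρ * ρ) b≡ (Analysis.unit-square h 1 1 (1ℤ , 0ℤ , refl) rep {ρ}
        (subst (Cop ρ) (sym a≡) (1ℤ - + 4 * + k , + 2 * + k , r₁ (+ k))) (1ℤ , - (+ 2 * + k) , r₂ (+ k))
        (subst (_∣ 1ℤ - ρ * ρ) (sym a≡) (divides (- (1ℤ + + 2 * + k)) (r₃ (+ k)))))))
    where
    ρ = 1ℤ + + 4 * + k
    a≡ : + (h ℕ.* 1 ℕ.* 1) ≡ + 8 * + k
    a≡ = trans (cong +_ (scale 1 k 8 e′)) (ℤP.pos-* 8 k)
    b≡ : + (h ℕ.* 1 ℕ.* 2) ≡ + 16 * + k
    b≡ = trans (cong +_ (scale 2 k 8 e′)) (ℤP.pos-* 16 k)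
    r₁ : ∀ k → (1ℤ - + 4 * k) * (1ℤ + + 4 * k) + + 2 * k * (+ 8 * k) ≡ 1ℤ
    r₁ = solve-∀
    r₂ : ∀ k → 1ℤ * (1ℤ + + 4 * k) + - (+ 2 * k) * + 2 ≡ 1ℤ
    r₂ = solve-∀
    r₃ : ∀ k → 1ℤ - (1ℤ + + 4 * k) * (1ℤ + + 4 * k) ≡ - (1ℤ + + 2 * k) * (+ 8 * k)
    r₃ = solve-∀
    odd-part : ∀ k → k ≢ 0ℤ → + 16 * k ∣ 1ℤ - (1ℤ + + 4 * k) * (1ℤ + + 4 * k) → + 2 ∣ 1ℤ
    odd-part k k≢0 (divides s es) = divides (- s - k) (cancelˡ (+ 8) (λ ()) (cancelˡ k k≢0 (lin (- 1ℤ) es (r k s))))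
      where
      r : ∀ k s → k * (+ 8 * 1ℤ) - k * (+ 8 * ((- s - k) * + 2)) ≡
        - 1ℤ * (1ℤ - (1ℤ + + 4 * k) * (1ℤ + + 4 * k) - s * (+ 16 * k))
      r = solve-∀
  split : Dec (2 ℕD.∣ q) → Form (h ℕ.* 1 ℕ.* 1) (h ℕ.* 1 ℕ.* 2) (h ℕ.* 1 ℕ.* 2)
  split (no odd) = form2q q (0<factor q 2 h≡) (odd-half q odd) (scale 1 q 2 h≡) (scale 2 q 2 h≡) (scale 2 q 2 h≡)
  split (yes (ℕD.divides p eq)) = form4q p (0<factor p 4 h≡4) (odd-half p λ { (ℕD.divides k ek) → 8∤h k (trans h≡4 (trans (cong (ℕ._* 4) ek) (r′ k))) })
      (scale 1 p 4 h≡4) (scale 2 p 4 h≡4) (scale 2 p 4 h≡4)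
    where
    r : ∀ p → p ℕ.* 2 ℕ.* 2 ≡ p ℕ.* 4
    r = solveᴺ-∀
    r′ : ∀ k → k ℕ.* 2 ℕ.* 4 ≡ k ℕ.* 8
    r′ = solveᴺ-∀
    h≡4 : h ≡ p ℕ.* 4
    h≡4 = trans h≡ (trans (cong (ℕ._* 2) eq) (r p))

even-table-bound : ∀ {h u v} → (h , u , v) ∈ evenTable → h ℕ.≤ 8
even-table-bound i = All.lookup (toWitness {a? = All.all? (λ t → proj₁ t ℕ.≤? 8) evenTable} _) i

⊛-comm₂ : ∀ a b c → f a ≡₂ (f b ⊛ f c) → f a ≡₂ (f c ⊛ f b)
⊛-comm₂ a b c H n = trans (H n) (cong (_% 2) (⊛-comm (f b) (f c) n))

relabel : ∀ {a a′ b b′ c c′} → a ≡ a′ → b ≡ b′ → c ≡ c′ → f a ≡₂ (f b ⊛ f c) → f a′ ≡₂ (f b′ ⊛ f c′)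
relabel refl refl refl H = H

-- With a = 3 h even and 4 ∤ a, cancellation leads to the shape (8 g , 12 g , 24 g), h = 2 g.
quarter-case : ∀ h .{{_ : ℕ.NonZero h}} → 2 ℕD.∣ h ℕ.* 3 → ¬ (4 ℕD.∣ h ℕ.* 3) → f (h ℕ.* 3) ≡₂ (f (h ℕ.* 4) ⊛ f (h ℕ.* 12)) → h ≡ 2
quarter-case h 2∣a 4∤a H = split (even-or-odd h)
  where
  split : (∃ λ g → h ≡ g ℕ.* 2) ⊎ (∃ λ g → h ≡ 1 ℕ.+ g ℕ.* 2) → h ≡ 2
  split (inj₂ (g , refl)) = ⊥-elim (0≢1 (trans (sym (even 2∣a)) (trans (cong (_% 2) (r g)) (odd%2 (1 ℕ.+ 3 ℕ.* g)))))
    where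
    even : ∀ {n} → 2 ℕD.∣ n → n % 2 ≡ 0
    even (ℕD.divides p refl) = m*n%n≡0 p 2
    r : ∀ g → (1 ℕ.+ g ℕ.* 2) ℕ.* 3 ≡ 1 ℕ.+ (1 ℕ.+ 3 ℕ.* g) ℕ.* 2
    r = solveᴺ-∀
  split (inj₁ (zero , refl)) = ⊥-elim (ℕ.≢-nonZero⁻¹ h refl)
  split (inj₁ (g@(suc _) , refl)) = cong (ℕ._* 2) (one g odd-g 4g≤8)
    where
    odd-g : ¬ (2 ℕD.∣ g)
    odd-g (ℕD.divides p ep) = 4∤a (ℕD.divides (p ℕ.* 3) (trans (cong (λ t → t ℕ.* 2 ℕ.* 3) ep) (r p)))
      where
      r : ∀ p → p ℕ.* 2 ℕ.* 2 ℕ.* 3 ≡ p ℕ.* 3 ℕ.* 4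
      r = solveᴺ-∀
    r₁ : ∀ k g j → g ℕ.* k ℕ.* j ≡ k ℕ.* j ℕ.* g
    r₁ = solveᴺ-∀
    r₂ : ∀ j k l g → j ℕ.* k ℕ.* l ℕ.* g ≡ j ℕ.* g ℕ.* k ℕ.* l
    r₂ = solveᴺ-∀
    -- The triple (8g, 12g, 24g) has the shape h = 4g, u = 1, v = 2. Now w = 3, and the finite table
    -- bounds 4g by 8.
    H′ : f (4 ℕ.* g ℕ.* 1 ℕ.* 2) ≡₂ (f (4 ℕ.* g ℕ.* 1 ℕ.* 3) ⊛ f (4 ℕ.* g ℕ.* 2 ℕ.* 3))
    H′ = relabel {8 ℕ.* g} {b = 12 ℕ.* g} {c = 24 ℕ.* g} (r₂ 4 1 2 g) (r₂ 4 1 3 g) (r₂ 4 2 3 g)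
      (cancel-24 g (odd-half g odd-g) (relabel {g ℕ.* 2 ℕ.* 3} {b = g ℕ.* 2 ℕ.* 4} {c = g ℕ.* 2 ℕ.* 12} (r₁ 2 g 3) (r₁ 2 g 4) (r₁ 2 g 12) H))
    instance
      nz4g : ℕ.NonZero (4 ℕ.* g)
      nz4g = ℕP.m*n≢0 4 g
    4g≤8 : 4 ℕ.* g ℕ.≤ 8
    4g≤8 = even-table-bound (Table.even-table (4 ℕ.* g) 1 2 refl (represents (4 ℕ.* g) 1 2 H′)
      (ℕD.n∣m*n (4 ℕ.* g ℕ.* 1)) (ℕD.divides 1 refl))
    one : ∀ g → ¬ (2 ℕD.∣ g) → 4 ℕ.* g ℕ.≤ 8 → g ≡ 1
    one 0 h _ = ⊥-elim (h (ℕD.divides 0 refl))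
    one 1 _ _ = refl
    one (suc (suc zero)) h _ = ⊥-elim (h (ℕD.divides 1 refl))
    one (suc (suc (suc g))) _ le = ⊥-elim (ℕP.<⇒≱ (ℕP.m≤m+n 9 3) (ℕP.≤-trans (ℕP.*-monoʳ-≤ 4 (ℕP.m≤m+n 3 g)) le))

classify : ∀ h u v .{{_ : ℕ.NonZero h}} .{{_ : ℕ.NonZero u}} .{{_ : ℕ.NonZero v}} → gcd u v ≡ 1 →
  f (h ℕ.* u ℕ.* v) ≡₂ (f (h ℕ.* u ℕ.* (u ℕ.+ v)) ⊛ f (h ℕ.* v ℕ.* (u ℕ.+ v))) →
  Forms (h ℕ.* u ℕ.* v) (h ℕ.* u ℕ.* (u ℕ.+ v)) (h ℕ.* v ℕ.* (u ℕ.+ v))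
classify h u v g≡1 H = split (2 ℕD.∣? h ℕ.* u ℕ.* v) (3 ℕD.∣? u ℕ.+ v)
  where
  rep = represents h u v H
  module Tab = Table h u v g≡1 rep
  Goal = Forms (h ℕ.* u ℕ.* v) (h ℕ.* u ℕ.* (u ℕ.+ v)) (h ℕ.* v ℕ.* (u ℕ.+ v))
  small : ∀ u v → (0 , u , v) ∈ smallTable → Represents h u v → 2 ℕD.∣ h ℕ.* u ℕ.* v →
    (+ 4 ∣ + (h ℕ.* u ℕ.* v) → ¬ (4 ℕD.∣ u ℕ.+ v)) →
    f (h ℕ.* u ℕ.* v) ≡₂ (f (h ℕ.* u ℕ.* (u ℕ.+ v)) ⊛ f (h ℕ.* v ℕ.* (u ℕ.+ v))) →
    Forms (h ℕ.* u ℕ.* v) (h ℕ.* u ℕ.* (u ℕ.+ v)) (h ℕ.* v ℕ.* (u ℕ.+ v))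
  small u v (here refl) rep 2∣a _ _ = inj₁ (equal-case h rep 2∣a)
  small u v (there (here refl)) _ 2∣a 4∤ H = form (quarter-case h (subst (2 ℕD.∣_) (r 3) 2∣a)
      (λ d → 4∤ (∣ᵤ⇒∣ {+ 4} {+ (h ℕ.* 1 ℕ.* 3)} (subst (4 ℕD.∣_) (sym (r 3)) d)) (ℕD.divides 1 refl))
      (relabel {h ℕ.* 1 ℕ.* 3} {b = h ℕ.* 1 ℕ.* 4} {c = h ℕ.* 3 ℕ.* 4} (r 3) (r 4) (ℕP.*-assoc h 3 4) H))
    where
    r : ∀ k → h ℕ.* 1 ℕ.* k ≡ h ℕ.* k
    r k = cong (ℕ._* k) (ℕP.*-identityʳ h)
    form : h ≡ 2 → Forms (h ℕ.* 1 ℕ.* 3) (h ℕ.* 1 ℕ.* 4) (h ℕ.* 3 ℕ.* 4)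
    form refl = inj₁ (formExc e2)
  small u v (there (there (here refl))) _ 2∣a 4∤ H = form (quarter-case h (subst (2 ℕD.∣_) r′ 2∣a)
      (λ d → 4∤ (∣ᵤ⇒∣ {+ 4} {+ (h ℕ.* 3 ℕ.* 1)} (subst (4 ℕD.∣_) (sym r′) d)) (ℕD.divides 1 refl))
      (relabel {h ℕ.* 3 ℕ.* 1} {b = h ℕ.* 1 ℕ.* 4} {c = h ℕ.* 3 ℕ.* 4} r′ (cong (ℕ._* 4) (ℕP.*-identityʳ h)) (ℕP.*-assoc h 3 4)
        (⊛-comm₂ (h ℕ.* 3 ℕ.* 1) (h ℕ.* 3 ℕ.* 4) (h ℕ.* 1 ℕ.* 4) H)))
    where
    r′ : h ℕ.* 3 ℕ.* 1 ≡ h ℕ.* 3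
    r′ = ℕP.*-identityʳ (h ℕ.* 3)
    form : h ≡ 2 → Forms (h ℕ.* 3 ℕ.* 1) (h ℕ.* 3 ℕ.* 4) (h ℕ.* 1 ℕ.* 4)
    form refl = inj₂ (formExc e2)
  split : Dec (2 ℕD.∣ h ℕ.* u ℕ.* v) → Dec (3 ℕD.∣ u ℕ.+ v) → Goal
  split (no odd) _ = odd-case (Tab.odd-table odd) H
  split (yes 2∣a) (yes 3∣w) = even-case (Tab.even-table 2∣a 3∣w) H
  split (yes 2∣a) (no 3∤w) = small u v (Tab.small-table 2∣a 3∤w) rep 2∣a Tab.4∣⇒4∤w H

theorem1p1 : (a b c : ℕ) → 0 ℕ.< a → 0 ℕ.< b → 0 ℕ.< c →
    ((f a ≡₂ (f b ⊛ f c)) → (Form a b c ⊎ Form a c b)) ×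
    ((Form a b c ⊎ Form a c b) → (f a ≡₂ (f b ⊛ f c)))
theorem1p1 a b c 0<a 0<b 0<c = necessary , sufficient
  where
  instance
    nza : ℕ.NonZero a
    nza = ℕ.>-nonZero 0<a
    nzb : ℕ.NonZero b
    nzb = ℕ.>-nonZero 0<b
    nzc : ℕ.NonZero c
    nzc = ℕ.>-nonZero 0<c
  necessary : f a ≡₂ (f b ⊛ f c) → Form a b c ⊎ Form a c b
  necessary H = go (harmonic-shape {a} {b} {c} (Harmonic.harmonic a b c H)) H
    where
    go : ∀ {a b c} → Shape a b c → f a ≡₂ (f b ⊛ f c) → Forms a b c
    go (shape h u v coprime refl refl refl) H = classify h u v coprime H
  sufficient : Form a b c ⊎ Form a c b → f a ≡₂ (f b ⊛ f c)
  sufficient (inj₁ form) = form-identity form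
  sufficient (inj₂ form) = ⊛-comm₂ a c b (form-identity form)
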